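{- Let $k\ge 3$ and $r\ge 1$ be integers. For every $j=1,\ldots,r$, the number $v^r_j$ of $k$-angulations with exactly $r$ $k$-gons (on points in convex position) whose root vertex has degree $j-1$ is $$v_{j}^{r} = \frac{j}{r}\binom{(k-1)r-j-1}{r-j}.$$
   Context: A geometric graph on a finite point set $\mathcal S\subseteq\mathbb R^2$ has vertex set $\mathcal S$ and edges that are straight-line segments with endpoints in $\mathcal S$; it is plane if no two edges intersect except at common endpoints. A $k$-angulation is a 2-connected plane geometric graph in which every internal face is a $k$-gon. A $k$-angulation with exactly $r$ $k$-gons has $(k-2)r+2$ vertices, taken to be points $p_1,\dots,p_{(k-2)r+2}$ in convex position labelled in counter-clockwise order. Its root vertex is $p_{(k-2)r+2}$, and the degree of the root vertex is defined as the number of its incident edges minus $2$. -}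

module Defs where

open import Algebra.Bundles using (CommutativeRing)
open import Data.Fin.Base using (Fin; fromℕ; toℕ) renaming (_<_ to _<ᶠ_)
open import Data.Fin.Subset using (Subset; _∈_; _∉_; ∣_∣)
open import Data.Integer.Base using (ℤ; _⊖_)
open import Data.Nat.Base as ℕ using (ℕ; suc)
open import Data.Nat.DivMod using (_mod_)
open import Data.Product.Base using (Σ; ∃; _×_; _,_; proj₁; proj₂)
open import Data.Sum.Base using (_⊎_)
open import Function.Base using (_on_)
open import Function.Bundles using (Inverse; _⇔_)
open import Function.Definitions using (Injective)
open import Level using (_⊔_) renaming (suc to sucˡ)
open import Relation.Binary.Bundles using (Setoid)
open import Relation.Binary.Core using (Rel)
open import Relation.Binary.Construct.Closure.Equivalence as Eq using (EqClosure)
open import Relation.Binary.Construct.Closure.ReflexiveTransitive using (Star)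
import Relation.Binary.Construct.On as On
open import Relation.Binary.PropositionalEquality as ≡ using (_≡_; _≢_)
open import Relation.Binary.Structures using (IsStrictTotalOrder)
open import Relation.Nullary.Negation using (¬_)
open import Relation.Unary using (Pred)

HasCardinality : ∀ {a ℓ} → Setoid a ℓ → ℕ → Set (a ⊔ ℓ)
HasCardinality S m = Inverse S (≡.setoid (Fin m))

record Graph (n : ℕ) : Set where
  field
    neighbours : Fin n → Subset n
    symmetric  : ∀ {u v} → v ∈ neighbours u → u ∈ neighbours v
    loopless   : ∀ {v} → v ∉ neighbours v

  Edge : Rel (Fin n) _
  Edge u v = v ∈ neighbours u

open Graph

graphSetoid : ℕ → Setoid _ _
graphSetoid n = record
  { Carrier       = Graph n
  ; _≈_           = λ G H → ∀ u → neighbours G u ≡ neighbours H u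
  ; isEquivalence = record
    { refl  = λ _ → ≡.refl
    ; sym   = λ e u → ≡.sym (e u)
    ; trans = λ e f u → ≡.trans (e u) (f u)
    }
  }

ConnectedWithout : ∀ {n} → Graph n → Subset n → Set
ConnectedWithout G X = ∀ u v → u ∉ X → v ∉ X →
  Star (λ x y → Edge G x y × x ∉ X × y ∉ X) u v

-- m-connectedness: more than m vertices, and no set of fewer than m
-- vertices disconnects the graph.
_-Connected_ : ∀ {n} → ℕ → Graph n → Set
_-Connected_ {n} m G = m ℕ.< n × (∀ X → ∣ X ∣ ℕ.< m → ConnectedWithout G X)

-- Indices are shifted by one: p₁, …, pₙ are p 0, …, p (n - 1), and the root
-- pₙ is the largest element of Fin n.
root : ∀ m → Fin (suc m)
root m = fromℕ m

-- The number of edges at the root, minus 2; an integer, to avoid truncation.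
rootDegree : ∀ {m} → Graph (suc m) → ℤ
rootDegree {m} G = ∣ neighbours G (root m) ∣ ⊖ 2

next : ∀ {k} → Fin k → Fin k
next {suc k} i = suc (toℕ i) mod suc k

-- The plane is taken over an arbitrary ordered field; ℝ is the intended one.
record OrderedField c ℓ₁ ℓ₂ : Set (sucˡ (c ⊔ ℓ₁ ⊔ ℓ₂)) where
  infix 4 _<_ _≤_
  field
    commutativeRing : CommutativeRing c ℓ₁

  open CommutativeRing commutativeRing public

  field
    _<_                : Rel Carrier ℓ₂
    isStrictTotalOrder : IsStrictTotalOrder _≈_ _<_
    +-monoˡ-<          : ∀ z {x y} → x < y → x + z < y + z
    *-pos              : ∀ {x y} → 0# < x → 0# < y → 0# < x * y
    0<1                : 0# < 1#
    inverse            : ∀ x → ¬ (x ≈ 0#) → ∃ λ y → x * y ≈ 1#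

  _≤_ : Rel Carrier ℓ₂
  x ≤ y = ¬ (y < x)

module Plane {c ℓ₁ ℓ₂} (F : OrderedField c ℓ₁ ℓ₂) where

  open OrderedField F
  open import Algebra.Properties.Monoid.Sum +-monoid using (sum)

  Point : Set c
  Point = Carrier × Carrier

  infix 4 _≈ᴾ_
  _≈ᴾ_ : Rel Point ℓ₁
  (x₁ , x₂) ≈ᴾ (y₁ , y₂) = x₁ ≈ y₁ × x₂ ≈ y₂

  Segment : Point → Point → Pred Point _
  Segment (a₁ , a₂) (b₁ , b₂) x = ∃ λ t → 0# ≤ t × t ≤ 1# ×
    x ≈ᴾ ((1# - t) * a₁ + t * b₁ , (1# - t) * a₂ + t * b₂)

  -- Twice the signed area of the triangle abc; positive for a left turn.
  orient : Point → Point → Point → Carrier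
  orient (a₁ , a₂) (b₁ , b₂) (c₁ , c₂) =
    (b₁ - a₁) * (c₂ - a₂) - (b₂ - a₂) * (c₁ - a₁)

  -- No point is a convex combination of the others.
  ConvexPosition : ∀ {n} → (Fin n → Point) → Set _
  ConvexPosition {n} p = ∀ i → ¬ (Σ (Fin n → Carrier) λ w →
    (∀ j → 0# ≤ w j) × w i ≈ 0# × sum w ≈ 1# ×
    p i ≈ᴾ ( sum (λ j → w j * proj₁ (p j))
           , sum (λ j → w j * proj₂ (p j)) ))

  CounterClockwise : ∀ {n} → (Fin n → Point) → Set _
  CounterClockwise p = ∀ {h i j} → h <ᶠ i → i <ᶠ j →
    0# < orient (p h) (p i) (p j)

  -- y lies in the open square of side 2ε centred at x.
  Near : Carrier → Point → Point → Set _
  Near ε (x₁ , x₂) (y₁ , y₂) =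
    (x₁ - ε < y₁ × y₁ < x₁ + ε) × (x₂ - ε < y₂ × y₂ < x₂ + ε)

  Bounded : ∀ {ℓ} → Pred Point ℓ → Set _
  Bounded P = ∃ λ M → ∀ y → P y → Near M (0# , 0#) y

  Frontier : ∀ {ℓ} → Pred Point ℓ → Pred Point _
  Frontier P x = ∀ ε → 0# < ε →
    (∃ λ y → Near ε x y × P y) × (∃ λ z → Near ε x z × ¬ P z)

  -- G drawn with vertex i at p i and straight edges.
  module _ {n} (p : Fin n → Point) (G : Graph n) where

    SameEdge : (u v u′ v′ : Fin n) → Set
    SameEdge u v u′ v′ = (u ≡ u′ × v ≡ v′) ⊎ (u ≡ v′ × v ≡ u′)

    IsPlane : Set _
    IsPlane = ∀ {u v u′ v′} → Edge G u v → Edge G u′ v′ →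
      ¬ SameEdge u v u′ v′ →
      ∀ x → Segment (p u) (p v) x → Segment (p u′) (p v′) x →
      ∃ λ w → (w ≡ u ⊎ w ≡ v) × (w ≡ u′ ⊎ w ≡ v′) × x ≈ᴾ p w

    Drawing : Pred Point _
    Drawing x = (∃ λ v → x ≈ᴾ p v) ⊎
                (∃ λ u → ∃ λ v → Edge G u v × Segment (p u) (p v) x)

    Visible : Rel Point _
    Visible x y = ∀ z → Segment x y z → ¬ Drawing z

    -- Faces are the classes of points off the drawing under being joined by
    -- a polygonal path that avoids the drawing.
    Face : Point → Pred Point _
    Face x y = EqClosure Visible x y

    IsInternal : Pred Point _
    IsInternal x = ¬ Drawing x × Bounded (Face x)

    -- An internal face is represented by any of its points.
    internalFaces : Setoid _ _
    internalFaces = On.setoid {B = Σ Point IsInternal} (Eq.setoid Visible) proj₁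

    -- The region P is bounded by a cycle of length k of G.
    IsGon : ∀ {ℓ} → ℕ → Pred Point ℓ → Set _
    IsGon k P = Σ (Fin k → Fin n) λ γ →
      Injective _≡_ _≡_ γ ×
      (∀ i → Edge G (γ i) (γ (next i))) ×
      (∀ x → Frontier P x ⇔ ∃ λ i → Segment (p (γ i)) (p (γ (next i))) x)

    IsAngulation : ℕ → Set _
    IsAngulation k =
      2 -Connected G × IsPlane × (∀ x → IsInternal x → IsGon k (Face x))

  -- The k-angulations on p with exactly r k-gons and root degree d.
  angulations : ∀ {m} → (Fin (suc m) → Point) → (k r : ℕ) → ℤ → Setoid _ _
  angulations {m} p k r d = On.setoid
    {B = Σ (Graph (suc m)) λ G →
           IsAngulation p G k ×
           HasCardinality (internalFaces p G) r ×
           rootDegree G ≡ d}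
    (graphSetoid (suc m)) proj₁

-- A k-angulation is the dual of a rooted tree: the hull edge between the first
-- and the last point is the root, the cells are the internal nodes, all of arity
-- d = k - 1, and the other hull edges are the leaves.  The root vertex lies on
-- the chords of the rightmost spine, so its degree plus one is the number j of
-- nodes on that spine.  Removing the spine leaves a forest of (k - 2) j trees
-- with r - j nodes, and such forests are counted by the ballot formula.
--
-- On the geometric side, a cell is the intersection of the open half-planes of
-- its sides.  It is convex, it misses the drawing, and a segment that leaves it
-- meets a side; so it is exactly one face, and the frontier of that face is the
-- union of the sides.  Points beyond a hull edge lie in unbounded faces, and
-- adding the chords one by one shows that every other point off the drawing is
-- in a cell.  Conversely, two-connectivity and planarity force the hull edges,
-- the chords do not cross, and the frontier condition on the faces makes every
-- cell a k-gon, so that the tree can be recovered by a shift-reduce parser.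
module Submission where

open import Defs
open import Algebra.Bundles using (CommutativeRing)
import Algebra.Solver.Ring
open import Algebra.Solver.Ring.AlmostCommutativeRing using (AlmostCommutativeRing; _-Raw-AlmostCommutative⟶_; fromCommutativeRing)
open import Data.Bool.Base using (true; false)
open import Data.Empty using (⊥-elim) renaming (⊥ to Empty)
open import Data.Fin.Base using (Fin; zero; suc; toℕ; fromℕ; fromℕ<; inject₁)
import Data.Fin.Properties as Finₚ
open import Data.Fin.Subset using (Subset; _∈_; _∉_; ∣_∣; ⁅_⁆; ⊥)
import Data.Fin.Subset.Properties as Subsetₚ
open import Data.Integer.Base as ℤ using (ℤ; +_; -[1+_]; _⊖_)
import Data.Integer.Properties as ℤₚ
open import Algebra.Properties.AbelianGroup ℤₚ.+-0-abelianGroup using (∙-cancelʳ)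
open import Data.Maybe.Base using (Maybe; just; nothing)
open import Data.Nat.Base as ℕ using (ℕ; zero; suc; z≤n; s≤s; NonZero)
open import Data.Nat.Combinatorics using (_C_; nC1≡n; k>n⇒nCk≡0; nCk+nC[k+1]≡[n+1]C[k+1])
open import Data.Nat.DivMod using (_mod_; _%_; n%n≡0; m<n⇒m%n≡m)
import Data.Nat.Properties as ℕₚ
open import Data.Nat.Tactic.RingSolver using (solve-∀)
open import Data.Product.Base using (Σ; ∃; _×_; _,_; proj₁; proj₂)
open import Data.Rational.Base as ℚ using (_/_) renaming (_*_ to _*ℚ_)
import Data.Rational.Properties as ℚₚ
open import Data.Rational.Unnormalised.Base as ℚᵘ using (*≡*)
import Data.Rational.Unnormalised.Properties as ℚᵘₚ
open import Data.Sum.Base using (_⊎_; inj₁; inj₂; swap)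
open import Data.Sum.Function.Propositional using (_⊎-↔_)
open import Data.Vec.Base using ([]; _∷_; tabulate; here; there)
open import Data.Vec.Properties using (lookup∘tabulate; []=⇒lookup; lookup⇒[]=)
open import Function.Base using (_∘_; id)
open import Function.Bundles using (_⇔_; mk⇔; module Equivalence; Inverse; _↔_; mk↔ₛ′)
open import Function.Properties.Inverse using (↔-sym; ↔-trans)
open import Level using (_⊔_)
import Relation.Binary.Construct.Closure.Equivalence as Eq
open import Relation.Binary.Construct.Closure.ReflexiveTransitive as Star using (Star; _◅_; _◅◅_)
open import Relation.Binary.Construct.Closure.Symmetric using (fwd; bwd)
open import Relation.Binary.Core using (Rel)
open import Relation.Binary.Definitions using (Tri; tri<; tri≈; tri>)
open import Relation.Binary.PropositionalEquality as ≡ using (_≡_; _≢_)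
import Relation.Binary.Reasoning.Setoid
open import Relation.Binary.Structures using (IsStrictTotalOrder)
open import Relation.Nullary.Decidable using (dec-true)
open import Relation.Nullary.Decidable.Core using (Dec; yes; no; does; _×-dec_; _⊎-dec_)
open import Relation.Nullary.Negation using (¬_; contradiction)
open import Relation.Unary using (Pred)

open Graph

-- Ordered fields

-- Over an arbitrary ordered field neither completeness nor compactness is at hand. Visibility,
-- frontiers and boundedness are therefore reduced to signs of affine functions, and each
-- intersection point is written down with one division; trichotomy of the order supplies the case
-- splits. The trees never appear as a recursive type. A forest is kept as its postorder code: the
-- parser extends it by one symbol at a time, each symbol adds exactly one chord, and noncrossing,
-- disjointness of cells and uniqueness are inductions on the last symbol. The parser cannot know
-- the size of a cell beforehand. It exhibits a polygon that no edge of the whole graph enters,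
-- edges not yet read included. Such a polygon is a face, and comparing its vertices with those of
-- the k-gon that bounds this face gives its size. The same notion of a cell thus serves both
-- directions of the bijection. Throughout, e = k - 3: a node has arity d = e + 2, and its cell has
-- the d sides below it and one base side.

module IntegerSolver {c ℓ} (R : CommutativeRing c ℓ) where

  open CommutativeRing R
  open import Algebra.Properties.Ring ring
  open import Algebra.Properties.Semiring.Mult.TCOptimised semiring renaming (_×_ to _·_)
  open Relation.Binary.Reasoning.Setoid setoid

  -- The canonical map from ℤ. Integer coefficients have decidable equality, so the solver can
  -- cancel terms without deciding equality in the ring. The optimised multiple makes `1 · 1#`
  -- compute to `1#`, so that `:1` stands for `1#` itself.
  ⟦_⟧ᶻ : ℤ → Carrier
  ⟦ + n ⟧ᶻ      = n · 1#
  ⟦ -[1+ n ] ⟧ᶻ = - (suc n · 1#)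

  private
    cancelˡ : ∀ x y z → (x + y) - (x + z) ≈ y - z
    cancelˡ x y z = begin
      (x + y) - (x + z)      ≈⟨ +-cong (+-comm x y) (sym (-‿+-comm x z)) ⟩
      (y + x) + (- x - z)    ≈⟨ +-assoc y x _ ⟩
      y + (x + (- x - z))    ≈⟨ +-congˡ (+-assoc x (- x) _) ⟨
      y + ((x - x) - z)      ≈⟨ +-congˡ (+-congʳ (-‿inverseʳ x)) ⟩
      y + (0# - z)           ≈⟨ +-congˡ (+-identityˡ _) ⟩
      y - z                  ∎

    -0≈0 : - 0# ≈ 0#
    -0≈0 = trans (sym (+-identityˡ _)) (-‿inverseʳ 0#)

    ⊖-homo : ∀ m n → ⟦ m ℤ.⊖ n ⟧ᶻ ≈ m · 1# - n · 1#
    ⊖-homo zero    zero    = sym (-‿inverseʳ 0#)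
    ⊖-homo zero    (suc n) = sym (+-identityˡ _)
    ⊖-homo (suc m) zero    = trans (sym (+-identityʳ _)) (+-congˡ (sym -0≈0))
    ⊖-homo (suc m) (suc n) = begin
      ⟦ suc m ℤ.⊖ suc n ⟧ᶻ     ≡⟨ ≡.cong ⟦_⟧ᶻ (ℤₚ.[1+m]⊖[1+n]≡m⊖n m n) ⟩
      ⟦ m ℤ.⊖ n ⟧ᶻ             ≈⟨ ⊖-homo m n ⟩
      m · 1# - n · 1#          ≈⟨ cancelˡ 1# _ _ ⟨
      (1# + m · 1#) - (1# + n · 1#)
        ≈⟨ +-cong (1+× m 1#) (-‿cong (1+× n 1#)) ⟨
      suc m · 1# - suc n · 1#  ∎

    +-homo : ∀ i j → ⟦ i ℤ.+ j ⟧ᶻ ≈ ⟦ i ⟧ᶻ + ⟦ j ⟧ᶻ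
    +-homo (+ m)    (+ n)    = ×-homo-+ 1# m n
    +-homo (+ m)    -[1+ n ] = ⊖-homo m (suc n)
    +-homo -[1+ m ] (+ n)    = trans (⊖-homo n (suc m)) (+-comm _ _)
    +-homo -[1+ m ] -[1+ n ] = begin
      - (suc (suc (m ℕ.+ n)) · 1#)        ≡⟨ ≡.cong (λ l → - (l · 1#)) (ℕₚ.+-suc (suc m) n) ⟨
      - ((suc m ℕ.+ suc n) · 1#)          ≈⟨ -‿cong (×-homo-+ 1# (suc m) (suc n)) ⟩
      - (suc m · 1# + suc n · 1#)         ≈⟨ -‿+-comm _ _ ⟨
      - (suc m · 1#) - suc n · 1#         ∎

    -‿homo : ∀ i → ⟦ ℤ.- i ⟧ᶻ ≈ - ⟦ i ⟧ᶻ
    -‿homo (+ zero)  = sym -0≈0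
    -‿homo (+ suc n) = refl
    -‿homo -[1+ n ]  = sym (-‿involutive _)

    *-homo-+ : ∀ m n → ⟦ + m ℤ.* + n ⟧ᶻ ≈ m · 1# * n · 1#
    *-homo-+ m n = trans (reflexive (≡.cong ⟦_⟧ᶻ (≡.sym (ℤₚ.pos-* m n)))) (×1-homo-* m n)

    neg-*-+ : ∀ m j → ⟦ + m ℤ.* j ⟧ᶻ ≈ m · 1# * ⟦ j ⟧ᶻ → ⟦ ℤ.- (+ m) ℤ.* j ⟧ᶻ ≈ - (m · 1#) * ⟦ j ⟧ᶻ
    neg-*-+ m j eq = begin
      ⟦ ℤ.- (+ m) ℤ.* j ⟧ᶻ    ≡⟨ ≡.cong ⟦_⟧ᶻ (ℤₚ.neg-distribˡ-* (+ m) j) ⟨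
      ⟦ ℤ.- (+ m ℤ.* j) ⟧ᶻ    ≈⟨ -‿homo (+ m ℤ.* j) ⟩
      - ⟦ + m ℤ.* j ⟧ᶻ        ≈⟨ -‿cong eq ⟩
      - (m · 1# * ⟦ j ⟧ᶻ)     ≈⟨ -‿distribˡ-* _ _ ⟩
      - (m · 1#) * ⟦ j ⟧ᶻ     ∎

    *-homoˡ : ∀ m j → ⟦ + m ℤ.* j ⟧ᶻ ≈ m · 1# * ⟦ j ⟧ᶻ
    *-homoˡ m (+ n)    = *-homo-+ m n
    *-homoˡ m -[1+ n ] = begin
      ⟦ + m ℤ.* -[1+ n ] ⟧ᶻ         ≡⟨ ≡.cong ⟦_⟧ᶻ (ℤₚ.neg-distribʳ-* (+ m) (+ suc n)) ⟨
      ⟦ ℤ.- (+ m ℤ.* + suc n) ⟧ᶻ    ≈⟨ -‿homo (+ m ℤ.* + suc n) ⟩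
      - ⟦ + m ℤ.* + suc n ⟧ᶻ        ≈⟨ -‿cong (*-homo-+ m (suc n)) ⟩
      - (m · 1# * suc n · 1#)       ≈⟨ -‿distribʳ-* _ _ ⟩
      m · 1# * - (suc n · 1#)       ∎

    *-homo : ∀ i j → ⟦ i ℤ.* j ⟧ᶻ ≈ ⟦ i ⟧ᶻ * ⟦ j ⟧ᶻ
    *-homo (+ m)    j = *-homoˡ m j
    *-homo -[1+ m ] j = neg-*-+ (suc m) j (*-homoˡ (suc m) j)

    almostRing : AlmostCommutativeRing _ _
    almostRing = fromCommutativeRing R

    morphism : ℤ.+-*-rawRing -Raw-AlmostCommutative⟶ almostRing
    morphism = record
      { ⟦_⟧    = ⟦_⟧ᶻ
      ; +-homo = +-homo
      ; *-homo = *-homo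
      ; -‿homo = -‿homo
      ; 0-homo = refl
      ; 1-homo = refl
      }

    coeff≟ : ∀ i j → Maybe (⟦ i ⟧ᶻ ≈ ⟦ j ⟧ᶻ)
    coeff≟ i j with i ℤₚ.≟ j
    ... | yes eq = just (reflexive (≡.cong ⟦_⟧ᶻ eq))
    ... | no _   = nothing

  open Algebra.Solver.Ring ℤ.+-*-rawRing almostRing morphism coeff≟ public
    hiding (⟦_⟧)

  :0 :1 : ∀ {n} → Polynomial n
  :0 = con (+ 0)
  :1 = con (+ 1)

module OrderedFieldProperties {c ℓ₁ ℓ₂} (F : OrderedField c ℓ₁ ℓ₂) where

  open OrderedField F hiding (zero)
  open IntegerSolver commutativeRing
  open IsStrictTotalOrder isStrictTotalOrder public
    using (compare; irrefl; asym; <-respˡ-≈; <-respʳ-≈) renaming (trans to <-trans)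
  open Relation.Binary.Reasoning.Setoid setoid

  Pos NonNeg : Carrier → Set ℓ₂
  Pos x    = 0# < x
  NonNeg x = 0# ≤ x

  <⇒≤ : ∀ {x y} → x < y → x ≤ y
  <⇒≤ = asym

  pos-resp : ∀ {x y} → x ≈ y → Pos x → Pos y
  pos-resp = <-respʳ-≈

  nonNeg-resp : ∀ {x y} → x ≈ y → NonNeg x → NonNeg y
  nonNeg-resp x≈y 0≤x y<0 = 0≤x (<-respˡ-≈ (sym x≈y) y<0)

  ≈⇒nonNeg : ∀ {x} → x ≈ 0# → NonNeg x
  ≈⇒nonNeg x≈0 x<0 = irrefl x≈0 x<0

  <⇒pos : ∀ {x y} → x < y → Pos (y - x)
  <⇒pos {x} x<y = <-respˡ-≈ (-‿inverseʳ x) (+-monoˡ-< (- x) x<y)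

  pos⇒< : ∀ {x y} → Pos (y - x) → x < y
  pos⇒< {x} {y} 0<y-x = <-respˡ-≈ (+-identityˡ x)
    (<-respʳ-≈ (solve 2 (λ x y → (y :- x) :+ x := y) refl x y) (+-monoˡ-< x 0<y-x))

  ≤⇒nonNeg : ∀ {x y} → x ≤ y → NonNeg (y - x)
  ≤⇒nonNeg {x} {y} x≤y y-x<0 = x≤y (pos⇒< (pos-resp
    (solve 2 (λ x y → :0 :- (y :- x) := x :- y) refl x y) (<⇒pos y-x<0)))

  nonNeg⇒≤ : ∀ {x y} → NonNeg (y - x) → x ≤ y
  nonNeg⇒≤ {x} {y} 0≤y-x y<x = 0≤y-x (pos⇒< (pos-resp
    (solve 2 (λ x y → x :- y := :0 :- (y :- x)) refl x y) (<⇒pos y<x)))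

  pos-+ : ∀ {x y} → Pos x → Pos y → Pos (x + y)
  pos-+ {x} {y} 0<x 0<y = <-trans 0<y (<-respˡ-≈ (+-identityˡ y) (+-monoˡ-< y 0<x))

  nonNeg-split : ∀ {x} → NonNeg x → Pos x ⊎ x ≈ 0#
  nonNeg-split {x} 0≤x with compare 0# x
  ... | tri< 0<x _ _ = inj₁ 0<x
  ... | tri≈ _ 0≈x _ = inj₂ (sym 0≈x)
  ... | tri> _ _ x<0 = contradiction x<0 0≤x

  pos-+-nonNeg : ∀ {x y} → Pos x → NonNeg y → Pos (x + y)
  pos-+-nonNeg {x} 0<x 0≤y with nonNeg-split 0≤y
  ... | inj₁ 0<y = pos-+ 0<x 0<y
  ... | inj₂ y≈0 = pos-resp (trans (sym (+-identityʳ x)) (+-congˡ (sym y≈0))) 0<x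

  nonNeg-+-pos : ∀ {x y} → NonNeg x → Pos y → Pos (x + y)
  nonNeg-+-pos 0≤x 0<y = pos-resp (+-comm _ _) (pos-+-nonNeg 0<y 0≤x)

  nonNeg-+ : ∀ {x y} → NonNeg x → NonNeg y → NonNeg (x + y)
  nonNeg-+ {x} {y} 0≤x 0≤y with nonNeg-split 0≤x
  ... | inj₁ 0<x = <⇒≤ (pos-+-nonNeg 0<x 0≤y)
  ... | inj₂ x≈0 = nonNeg-resp (trans (sym (+-identityˡ y)) (+-congʳ (sym x≈0))) 0≤y

  nonNeg-* : ∀ {x y} → NonNeg x → NonNeg y → NonNeg (x * y)
  nonNeg-* {x} {y} 0≤x 0≤y with nonNeg-split 0≤x | nonNeg-split 0≤y
  ... | inj₁ 0<x | inj₁ 0<y = <⇒≤ (*-pos 0<x 0<y)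
  ... | inj₂ x≈0 | _        = ≈⇒nonNeg (trans (*-congʳ x≈0) (zeroˡ y))
  ... | inj₁ _   | inj₂ y≈0 = ≈⇒nonNeg (trans (*-congˡ y≈0) (zeroʳ x))

  neg⇒pos : ∀ {x} → x < 0# → Pos (- x)
  neg⇒pos x<0 = pos-resp (+-identityˡ _) (<⇒pos x<0)

  ¬pos∧neg : ∀ {x} → Pos x → ¬ NonNeg (- x)
  ¬pos∧neg {x} 0<x 0≤-x =
    irrefl refl (pos-resp (-‿inverseʳ x) (pos-+-nonNeg 0<x 0≤-x))

  -- The negative case is stored as positivity of `- x`, so that it can be fed to the sum and
  -- product rules for `Pos` directly.
  data Sign (x : Carrier) : Set (ℓ₁ ⊔ ℓ₂) where
    positive : Pos x → Sign x
    null     : x ≈ 0# → Sign x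
    negative : Pos (- x) → Sign x

  sign : ∀ x → Sign x
  sign x with compare 0# x
  ... | tri< 0<x _ _ = positive 0<x
  ... | tri≈ _ 0≈x _ = null (sym 0≈x)
  ... | tri> _ _ x<0 = negative (neg⇒pos x<0)

  pos-*-cancelˡ : ∀ {d x} → Pos d → Pos (d * x) → Pos x
  pos-*-cancelˡ {d} {x} 0<d 0<dx with sign x
  ... | positive 0<x = 0<x
  ... | null x≈0     = contradiction (trans (*-congˡ x≈0) (zeroʳ d)) λ eq → irrefl (sym eq) 0<dx
  ... | negative 0<-x = contradiction
    (nonNeg-resp (solve 2 (λ d x → d :* (:- x) := :- (d :* x)) refl d x) (<⇒≤ (*-pos 0<d 0<-x)))
    (¬pos∧neg 0<dx)

  nonNeg-*-cancelˡ : ∀ {d x} → Pos d → NonNeg (d * x) → NonNeg x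
  nonNeg-*-cancelˡ {d} {x} 0<d 0≤dx with sign x
  ... | positive 0<x = <⇒≤ 0<x
  ... | null x≈0     = ≈⇒nonNeg x≈0
  ... | negative 0<-x = contradiction 0≤dx λ 0≤dx → ¬pos∧neg
    (pos-resp (solve 2 (λ d x → d :* (:- x) := :- (d :* x)) refl d x) (*-pos 0<d 0<-x))
    (nonNeg-resp (solve 1 (λ x → x := :- (:- x)) refl (d * x)) 0≤dx)

  recip : ∀ {d} → Pos d → ∃ λ i → d * i ≈ 1# × Pos i
  recip {d} 0<d with inverse d (λ d≈0 → irrefl (sym d≈0) 0<d)
  ... | i , di≈1 = i , di≈1 , pos-*-cancelˡ 0<d (pos-resp (sym di≈1) 0<1)

  *-cancelˡ : ∀ {d x y} → Pos d → d * x ≈ d * y → x ≈ y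
  *-cancelˡ {d} {x} {y} 0<d dx≈dy with recip 0<d
  ... | i , di≈1 , _ = begin
    x            ≈⟨ *-identityˡ x ⟨
    1# * x       ≈⟨ *-congʳ di≈1 ⟨
    d * i * x    ≈⟨ solve 3 (λ d i x → d :* i :* x := i :* (d :* x)) refl d i x ⟩
    i * (d * x)  ≈⟨ *-congˡ dx≈dy ⟩
    i * (d * y)  ≈⟨ solve 3 (λ d i x → i :* (d :* x) := d :* i :* x) refl d i y ⟩
    d * i * y    ≈⟨ *-congʳ di≈1 ⟩
    1# * y       ≈⟨ *-identityˡ y ⟩
    y            ∎

  pos-≢0 : ∀ {x} → Pos x → ¬ (x ≈ 0#)
  pos-≢0 0<x x≈0 = irrefl (sym x≈0) 0<x

  max : ∀ x y → ∃ λ z → x ≤ z × y ≤ z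
  max x y with compare x y
  ... | tri< x<y _ _ = y , <⇒≤ x<y , irrefl refl
  ... | tri≈ _ x≈y _ = y , irrefl (sym x≈y) , irrefl refl
  ... | tri> _ _ y<x = x , irrefl refl , <⇒≤ y<x

  <-≤-trans : ∀ {x y z} → x < y → y ≤ z → x < z
  <-≤-trans {x} {y} {z} x<y y≤z = pos⇒<
    (pos-resp (solve 3 (λ x y z → (y :- x) :+ (z :- y) := z :- x) refl x y z)
      (pos-+-nonNeg (<⇒pos x<y) (≤⇒nonNeg y≤z)))

  ≤-<-trans : ∀ {x y z} → x ≤ y → y < z → x < z
  ≤-<-trans {x} {y} {z} x≤y y<z = pos⇒<
    (pos-resp (solve 3 (λ x y z → (y :- x) :+ (z :- y) := z :- x) refl x y z)
      (nonNeg-+-pos (≤⇒nonNeg x≤y) (<⇒pos y<z)))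

  <-add1 : ∀ x → x < x + 1#
  <-add1 x = pos⇒< (pos-resp (solve 1 (λ x → :1 := (x :+ :1) :- x) refl x) 0<1)

  -- Plays the part of a minimum of finitely many positive radii; `down` says that a smaller radius
  -- serves as well.
  common-scale : ∀ {a n} (P : Fin n → Carrier → Set a) →
    (∀ i {x y} → x ≤ y → P i y → P i x) →
    (∀ i → ∃ λ x → Pos x × P i x) → ∃ λ x → Pos x × (∀ i → P i x)
  common-scale {n = zero}  P down hyp = 1# , 0<1 , λ ()
  common-scale {n = suc n} P down hyp
    with hyp zero | common-scale (λ i → P (suc i)) (λ i → down (suc i)) (λ i → hyp (suc i))
  ... | x , 0<x , p | y , 0<y , ps with compare x y
  ... | tri< x<y _ _ = x , 0<x , λ { zero → p ; (suc i) → down (suc i) (<⇒≤ x<y) (ps i) }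
  ... | tri≈ _ x≈y _ = x , 0<x , λ { zero → p ; (suc i) → down (suc i) (irrefl (sym x≈y)) (ps i) }
  ... | tri> _ _ y<x = y , 0<y , λ { zero → down zero (<⇒≤ y<x) p ; (suc i) → ps i }

  upper-bound : ∀ {n} (f : Fin n → Carrier) → ∃ λ M → ∀ i → f i < M
  upper-bound {zero}  f = 0# , λ ()
  upper-bound {suc n} f with upper-bound (λ i → f (suc i))
  ... | M , bound with max (f zero + 1#) M
  ... | L , f₀<L , M≤L = L , λ { zero → <-≤-trans (<-add1 _) f₀<L ; (suc i) → <-≤-trans (bound i) M≤L }

-- Points, lines and segments

toℕ-next : ∀ {n} (i : Fin (suc n)) → toℕ (next i) ≡ suc (toℕ i) % suc n
toℕ-next i = Finₚ.toℕ-fromℕ< _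

-- Hides the modular arithmetic of `next`: arguments about a cyclic successor split on whether it
-- wraps around.
data NextView {n} (i : Fin (suc n)) : Set where
  step : toℕ (next i) ≡ suc (toℕ i) → NextView i
  wrap : toℕ i ≡ n → next i ≡ zero → NextView i

nextView : ∀ {n} (i : Fin (suc n)) → NextView i
nextView {n} i with toℕ i ℕₚ.≟ n
... | yes i≡n = wrap i≡n (Finₚ.toℕ-injective (≡.trans (toℕ-next i)
  (≡.trans (≡.cong (λ m → suc m % suc n) i≡n) (n%n≡0 (suc n)))))
... | no  i≢n = step (≡.trans (toℕ-next i)
  (m<n⇒m%n≡m (s≤s (ℕₚ.≤∧≢⇒< (Finₚ.toℕ≤pred[n] i) i≢n))))

next-fromℕ : ∀ n → next (fromℕ n) ≡ zero
next-fromℕ n = Finₚ.toℕ-injective (≡.trans (toℕ-next (fromℕ n))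
  (≡.trans (≡.cong (λ m → suc m % suc n) (Finₚ.toℕ-fromℕ n)) (n%n≡0 (suc n))))

next-inject₁ : ∀ {n} (i : Fin n) → next (inject₁ i) ≡ suc i
next-inject₁ {suc n} i = Finₚ.toℕ-injective (≡.trans (toℕ-next (inject₁ i))
  (≡.trans (≡.cong (λ m → suc m % suc (suc n)) (Finₚ.toℕ-inject₁ i))
    (m<n⇒m%n≡m (s≤s (Finₚ.toℕ<n i)))))

next-surjective : ∀ {n} (i : Fin (suc n)) → ∃ λ j → next j ≡ i
next-surjective {n} zero    = fromℕ n , next-fromℕ n
next-surjective     (suc i) = inject₁ i , next-inject₁ i

next-≢ : ∀ {n} → 1 ℕ.≤ n → (i : Fin (suc n)) → i ≢ next i
next-≢ 1≤n i eq with nextView i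
... | step s   = ℕₚ.m≢1+m+n (toℕ i) (≡.trans (≡.cong toℕ eq) (≡.trans s (≡.cong suc (≡.sym (ℕₚ.+-identityʳ _)))))
... | wrap i≡n n≡0 = ℕₚ.<⇒≢ 1≤n (≡.trans (≡.sym (≡.cong toℕ (≡.trans eq n≡0))) i≡n)

next²-≢ : ∀ {n} → 2 ℕ.≤ n → (i : Fin (suc n)) → i ≢ next (next i)
next²-≢ {n} 2≤n i eq with nextView i | nextView (next i)
... | step s   | step s′  = ℕₚ.m≢1+m+n (toℕ i) (≡.trans (≡.cong toℕ eq)
  (≡.trans s′ (≡.cong suc (≡.trans s (≡.sym (ℕₚ.+-comm (toℕ i) 1))))))
... | step s   | wrap e z = ℕₚ.<⇒≢ 2≤n (≡.trans (≡.sym (≡.trans s (≡.cong (suc ∘ toℕ) (≡.trans eq z)))) e)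
... | wrap e z | step s′  = ℕₚ.<⇒≢ 2≤n (≡.trans (≡.sym (≡.trans (≡.cong toℕ eq) (≡.trans s′ (≡.cong (suc ∘ toℕ) z)))) e)
... | wrap e z | wrap e′ z′ = ℕₚ.<⇒≢ (ℕₚ.<-trans (s≤s z≤n) 2≤n) (≡.trans (≡.sym (≡.cong toℕ z)) e′)

module Lines {c ℓ₁ ℓ₂} (F : OrderedField c ℓ₁ ℓ₂) where

  open OrderedField F hiding (zero)
  open Plane F
  open IntegerSolver commutativeRing
  open OrderedFieldProperties F
  open Relation.Binary.Reasoning.Setoid setoid

  -- The coefficients of an affine function. Sides of polygons, walls of a bounding box and the two
  -- coordinates are all of this form, so one set of sign lemmas covers them.
  Line : Set c
  Line = Carrier × Carrier × Carrier

  infix 8 _at_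
  _at_ : Line → Point → Carrier
  (α , β , γ) at (x , y) = α * x + β * y + γ

  side : Point → Point → Line
  side (a₁ , a₂) (b₁ , b₂) = a₂ - b₂ , b₁ - a₁ , a₁ * b₂ - a₂ * b₁

  opposite : Line → Line
  opposite (α , β , γ) = - α , - β , - γ

  private
    orientᴱ : ∀ {n} (a₁ a₂ b₁ b₂ c₁ c₂ : Polynomial n) → Polynomial n
    orientᴱ a₁ a₂ b₁ b₂ c₁ c₂ = (b₁ :- a₁) :* (c₂ :- a₂) :- (b₂ :- a₂) :* (c₁ :- a₁)

    atᴱ : ∀ {n} (α β γ x y : Polynomial n) → Polynomial n
    atᴱ α β γ x y = α :* x :+ β :* y :+ γ

  side-at : ∀ a b x → side a b at x ≈ orient a b x
  side-at (a₁ , a₂) (b₁ , b₂) (x₁ , x₂) = solve 6 (λ a₁ a₂ b₁ b₂ x₁ x₂ →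
    atᴱ (a₂ :- b₂) (b₁ :- a₁) (a₁ :* b₂ :- a₂ :* b₁) x₁ x₂ := orientᴱ a₁ a₂ b₁ b₂ x₁ x₂)
    refl a₁ a₂ b₁ b₂ x₁ x₂

  opposite-at : ∀ ℓ x → opposite ℓ at x ≈ - (ℓ at x)
  opposite-at (α , β , γ) (x₁ , x₂) = solve 5 (λ α β γ x₁ x₂ →
    atᴱ (:- α) (:- β) (:- γ) x₁ x₂ := :- atᴱ α β γ x₁ x₂) refl α β γ x₁ x₂

  orient-cyclic : ∀ a b x → orient a b x ≈ orient b x a
  orient-cyclic (a₁ , a₂) (b₁ , b₂) (x₁ , x₂) = solve 6 (λ a₁ a₂ b₁ b₂ x₁ x₂ →
    orientᴱ a₁ a₂ b₁ b₂ x₁ x₂ := orientᴱ b₁ b₂ x₁ x₂ a₁ a₂) refl a₁ a₂ b₁ b₂ x₁ x₂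

  orient-swap : ∀ a b x → orient a b x ≈ - orient b a x
  orient-swap (a₁ , a₂) (b₁ , b₂) (x₁ , x₂) = solve 6 (λ a₁ a₂ b₁ b₂ x₁ x₂ →
    orientᴱ a₁ a₂ b₁ b₂ x₁ x₂ := :- orientᴱ b₁ b₂ a₁ a₂ x₁ x₂) refl a₁ a₂ b₁ b₂ x₁ x₂

  orient-left : ∀ a b → orient a b a ≈ 0#
  orient-left (a₁ , a₂) (b₁ , b₂) = solve 4 (λ a₁ a₂ b₁ b₂ →
    orientᴱ a₁ a₂ b₁ b₂ a₁ a₂ := :0) refl a₁ a₂ b₁ b₂

  orient-right : ∀ a b → orient a b b ≈ 0#
  orient-right (a₁ , a₂) (b₁ , b₂) = solve 4 (λ a₁ a₂ b₁ b₂ →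
    orientᴱ a₁ a₂ b₁ b₂ b₁ b₂ := :0) refl a₁ a₂ b₁ b₂

  ≈ᴾ-refl : ∀ {x} → x ≈ᴾ x
  ≈ᴾ-refl = refl , refl

  at-cong : ∀ ℓ {x y} → x ≈ᴾ y → ℓ at x ≈ ℓ at y
  at-cong ℓ (e₁ , e₂) = +-congʳ (+-cong (*-congˡ e₁) (*-congˡ e₂))

  -- The weights are the areas of the three triangles that x spans with the
  -- sides of abd (barycentric coordinates).
  barycentric : ∀ ℓ a b d x → orient a b d * (ℓ at x) ≈
    orient x b d * (ℓ at a) + orient a x d * (ℓ at b) + orient a b x * (ℓ at d)
  barycentric (α , β , γ) (a₁ , a₂) (b₁ , b₂) (d₁ , d₂) (x₁ , x₂) =
    solve 11 (λ α β γ a₁ a₂ b₁ b₂ d₁ d₂ x₁ x₂ →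
      orientᴱ a₁ a₂ b₁ b₂ d₁ d₂ :* atᴱ α β γ x₁ x₂ :=
      orientᴱ x₁ x₂ b₁ b₂ d₁ d₂ :* atᴱ α β γ a₁ a₂ :+
      orientᴱ a₁ a₂ x₁ x₂ d₁ d₂ :* atᴱ α β γ b₁ b₂ :+
      orientᴱ a₁ a₂ b₁ b₂ x₁ x₂ :* atᴱ α β γ d₁ d₂)
    refl α β γ a₁ a₂ b₁ b₂ d₁ d₂ x₁ x₂

  mix : Carrier → Point → Point → Point
  mix t (a₁ , a₂) (b₁ , b₂) = (1# - t) * a₁ + t * b₁ , (1# - t) * a₂ + t * b₂

  at-mix : ∀ ℓ t a b → ℓ at mix t a b ≈ (1# - t) * (ℓ at a) + t * (ℓ at b)
  at-mix (α , β , γ) t (a₁ , a₂) (b₁ , b₂) = solve 8 (λ α β γ t a₁ a₂ b₁ b₂ →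
    atᴱ α β γ ((:1 :- t) :* a₁ :+ t :* b₁) ((:1 :- t) :* a₂ :+ t :* b₂) :=
    (:1 :- t) :* atᴱ α β γ a₁ a₂ :+ t :* atᴱ α β γ b₁ b₂) refl α β γ t a₁ a₂ b₁ b₂

  at-segment : ∀ ℓ {a b x} ((t , _) : Segment a b x) → ℓ at x ≈ (1# - t) * (ℓ at a) + t * (ℓ at b)
  at-segment ℓ {a} {b} (t , _ , _ , x≈) = trans (at-cong ℓ x≈) (at-mix ℓ t a b)

  segment-nonNeg : ∀ ℓ {a b x} → NonNeg (ℓ at a) → NonNeg (ℓ at b) → Segment a b x → NonNeg (ℓ at x)
  segment-nonNeg ℓ 0≤a 0≤b s@(t , 0≤t , t≤1 , _) = nonNeg-resp (sym (at-segment ℓ s))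
    (nonNeg-+ (nonNeg-* (≤⇒nonNeg t≤1) 0≤a) (nonNeg-* 0≤t 0≤b))

  mix-pos : ∀ {t u v} → NonNeg t → t ≤ 1# → Pos u → Pos v → Pos ((1# - t) * u + t * v)
  mix-pos {t} {u} {v} 0≤t t≤1 0<u 0<v with nonNeg-split 0≤t
  ... | inj₁ 0<t = nonNeg-+-pos (nonNeg-* (≤⇒nonNeg t≤1) (<⇒≤ 0<u)) (*-pos 0<t 0<v)
  ... | inj₂ t≈0 = pos-+-nonNeg
    (pos-resp (trans (solve 1 (λ u → u := (:1 :- :0) :* u) refl u) (*-congʳ (+-congˡ (-‿cong (sym t≈0))))) 0<u)
    (nonNeg-* 0≤t (<⇒≤ 0<v))

  segment-pos : ∀ ℓ {a b x} → Pos (ℓ at a) → Pos (ℓ at b) → Segment a b x → Pos (ℓ at x)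
  segment-pos ℓ 0<a 0<b s@(t , 0≤t , t≤1 , _) =
    pos-resp (sym (at-segment ℓ s)) (mix-pos 0≤t t≤1 0<a 0<b)

  segment-left : ∀ a b → Segment a b a
  segment-left (a₁ , a₂) (b₁ , b₂) = 0# , irrefl refl , <⇒≤ 0<1 , eq a₁ b₁ , eq a₂ b₂
    where eq = solve 2 (λ a b → a := (:1 :- :0) :* a :+ :0 :* b) refl

  segment-sym : ∀ {a b x} → Segment a b x → Segment b a x
  segment-sym {a₁ , a₂} {b₁ , b₂} (t , 0≤t , t≤1 , e₁ , e₂) =
    1# - t , ≤⇒nonNeg t≤1 ,
    nonNeg⇒≤ (nonNeg-resp (solve 1 (λ t → t := :1 :- (:1 :- t)) refl t) 0≤t) ,
    trans e₁ (eq t a₁ b₁) , trans e₂ (eq t a₂ b₂)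
    where
    eq = solve 3 (λ t a b → (:1 :- t) :* a :+ t :* b :=
                            (:1 :- (:1 :- t)) :* b :+ (:1 :- t) :* a) refl

  segment-right : ∀ a b → Segment a b b
  segment-right a b = segment-sym (segment-left b a)

  segment-initial : ∀ {a b x y} → Segment a b x → Segment a x y → Segment a b y
  segment-initial {a₁ , a₂} {b₁ , b₂} (t , 0≤t , t≤1 , e₁ , e₂) (s , 0≤s , s≤1 , f₁ , f₂) =
    s * t , nonNeg-* 0≤s 0≤t ,
    nonNeg⇒≤ (nonNeg-resp (solve 2 (λ s t → (:1 :- s) :+ s :* (:1 :- t) := :1 :- s :* t) refl s t)
      (nonNeg-+ (≤⇒nonNeg s≤1) (nonNeg-* 0≤s (≤⇒nonNeg t≤1)))) ,
    trans f₁ (trans (+-congˡ (*-congˡ e₁)) (eq s t a₁ b₁)) ,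
    trans f₂ (trans (+-congˡ (*-congˡ e₂)) (eq s t a₂ b₂))
    where
    eq = solve 4 (λ s t a b → (:1 :- s) :* a :+ s :* ((:1 :- t) :* a :+ t :* b) :=
                              (:1 :- s :* t) :* a :+ s :* t :* b) refl

  -- Triangle areas come as homogeneous weights; dividing by their sum `d` turns them into the
  -- parameter of a segment.
  fromWeights : ∀ {a₁ a₂ b₁ b₂ x₁ x₂ d u v} → Pos d → NonNeg u → NonNeg v → d ≈ u + v →
    d * x₁ ≈ u * a₁ + v * b₁ → d * x₂ ≈ u * a₂ + v * b₂ → Segment (a₁ , a₂) (b₁ , b₂) (x₁ , x₂)
  fromWeights {a₁} {a₂} {b₁} {b₂} {x₁} {x₂} {d} {u} {v} 0<d 0≤u 0≤v d≈u+v e₁ e₂ with recip 0<d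
  ... | i , di≈1 , 0<i = v * i , nonNeg-* 0≤v (<⇒≤ 0<i) ,
        nonNeg⇒≤ (nonNeg-resp (sym 1-vi) (nonNeg-* 0≤u (<⇒≤ 0<i))) , eq e₁ , eq e₂
    where
    1-vi : 1# - v * i ≈ u * i
    1-vi = begin
      1# - v * i           ≈⟨ +-congʳ di≈1 ⟨
      d * i - v * i        ≈⟨ +-congʳ (*-congʳ d≈u+v) ⟩
      (u + v) * i - v * i  ≈⟨ solve 3 (λ u v i → (u :+ v) :* i :- v :* i := u :* i) refl u v i ⟩
      u * i                ∎
    eq : ∀ {a b x} → d * x ≈ u * a + v * b → x ≈ (1# - v * i) * a + v * i * b
    eq {a} {b} {x} e = *-cancelˡ 0<d (begin
      d * x                              ≈⟨ e ⟩
      u * a + v * b                      ≈⟨ *-identityˡ _ ⟨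
      1# * (u * a + v * b)               ≈⟨ *-congʳ di≈1 ⟨
      d * i * (u * a + v * b)            ≈⟨ solve 6 (λ d i u a v b → d :* i :* (u :* a :+ v :* b) := d :* (u :* i :* a :+ v :* i :* b)) refl d i u a v b ⟩
      d * (u * i * a + v * i * b)        ≈⟨ *-congˡ (+-congʳ (*-congʳ 1-vi)) ⟨
      d * ((1# - v * i) * a + v * i * b) ∎)

  -- The identity `barycentric` for the constant function 1.
  orient-sum : ∀ a b d x → orient a b d ≈ orient x b d + orient a x d + orient a b x
  orient-sum (a₁ , a₂) (b₁ , b₂) (d₁ , d₂) (x₁ , x₂) = solve 8 (λ a₁ a₂ b₁ b₂ d₁ d₂ x₁ x₂ →
    orientᴱ a₁ a₂ b₁ b₂ d₁ d₂ := orientᴱ x₁ x₂ b₁ b₂ d₁ d₂ :+ orientᴱ a₁ a₂ x₁ x₂ d₁ d₂ :+ orientᴱ a₁ a₂ b₁ b₂ x₁ x₂)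
    refl a₁ a₂ b₁ b₂ d₁ d₂ x₁ x₂

  X Y : Line
  X = 1# , 0# , 0#
  Y = 0# , 1# , 0#

  X-at : ∀ x → X at x ≈ proj₁ x
  X-at (x , y) = solve 2 (λ x y → atᴱ :1 :0 :0 x y := x) refl x y

  Y-at : ∀ x → Y at x ≈ proj₂ x
  Y-at (x , y) = solve 2 (λ x y → atᴱ :0 :1 :0 x y := y) refl x y

  -- On the line ab the barycentric weight of d vanishes, so the two remaining areas are the weights
  -- of a and b.
  on-line : ∀ {a b d x} → Pos (orient a b d) → orient a b x ≈ 0# →
    NonNeg (orient x b d) → NonNeg (orient a x d) → Segment a b x
  on-line {a} {b} {d} {x} 0<abd abx≈0 0≤xbd 0≤axd = fromWeights 0<abd 0≤xbd 0≤axd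
    (trans (orient-sum a b d x) (drop-null abx≈0 (+-identityʳ _)))
    (coordinate X X-at) (coordinate Y Y-at)
    where
    drop-null : ∀ {u v w} → w ≈ 0# → v + 0# ≈ u → v + w ≈ u
    drop-null w≈0 eq = trans (+-congˡ w≈0) eq
    coordinate : ∀ ℓ {f : Point → Carrier} → (∀ z → ℓ at z ≈ f z) →
      orient a b d * f x ≈ orient x b d * f a + orient a x d * f b
    coordinate ℓ {f} eq = begin
      orient a b d * f x       ≈⟨ *-congˡ (eq x) ⟨
      orient a b d * ℓ at x    ≈⟨ barycentric ℓ a b d x ⟩
      orient x b d * ℓ at a + orient a x d * ℓ at b + orient a b x * ℓ at d
        ≈⟨ drop-null (trans (*-congʳ abx≈0) (zeroˡ _)) (+-identityʳ _) ⟩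
      orient x b d * ℓ at a + orient a x d * ℓ at b
        ≈⟨ +-cong (*-congˡ (eq a)) (*-congˡ (eq b)) ⟩
      orient x b d * f a + orient a x d * f b ∎

  -- Linear interpolation: with A the value at x and B minus the value at z, the zero has parameter
  -- A / (A + B).
  crossing : ∀ ℓ {x z} → Pos (ℓ at x) → Pos (- (ℓ at z)) → ∃ λ y → Segment x z y × ℓ at y ≈ 0#
  crossing ℓ {x} {z} 0<A 0<B with recip (pos-+ 0<A 0<B)
  ... | i , di≈1 , 0<i = mix t x z , seg , (begin
      ℓ at mix t x z           ≈⟨ at-mix ℓ t x z ⟩
      (1# - t) * A + t * (ℓ at z)  ≈⟨ +-congʳ (*-congʳ 1-t) ⟩
      B * i * A + t * (ℓ at z) ≈⟨ solve 3 (λ a z i → (:- z) :* i :* a :+ a :* i :* z := :0) refl A (ℓ at z) i ⟩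
      0#                       ∎)
    where
    A B t : Carrier
    A = ℓ at x
    B = - (ℓ at z)
    t = A * i
    1-t : 1# - t ≈ B * i
    1-t = trans (+-congʳ (sym di≈1)) (solve 3 (λ a b i → (a :+ b) :* i :- a :* i := b :* i) refl A B i)
    seg : Segment x z (mix t x z)
    seg = t , <⇒≤ (*-pos 0<A 0<i) , nonNeg⇒≤ (nonNeg-resp (sym 1-t) (<⇒≤ (*-pos 0<B 0<i))) , ≈ᴾ-refl

  -- Going from x to z, stop as soon as one of the functions vanishes.
  FirstZero : ∀ {m} → (Fin m → Line) → Point → Point → Set _
  FirstZero f x z = (∀ i → Pos (f i at z)) ⊎
    (∃ λ y → Segment x z y × (∀ i → NonNeg (f i at y)) × ∃ λ i → f i at y ≈ 0#)

  -- Induction on the number of functions. If the new function is negative at the point found for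
  -- the others, go back towards x to its zero; the others are nonnegative at both ends of that
  -- piece and hence at the zero.
  first-zero : ∀ {m} (f : Fin m → Line) {x} z → (∀ i → Pos (f i at x)) → FirstZero f x z
  first-zero {zero}  f z pos = inj₁ λ ()
  first-zero {suc m} f {x} z pos = extend (first-zero g z (λ i → pos (suc i)))
    where
    g : Fin m → Line
    g i = f (suc i)
    halt : ∀ {y} → Segment x z y → f zero at y ≈ 0# → (∀ i → NonNeg (g i at y)) → FirstZero f x z
    halt {y} s y≈0 nonNeg = inj₂ (y , s , (λ { zero → ≈⇒nonNeg y≈0 ; (suc i) → nonNeg i }) , zero , y≈0)
    back : ∀ {y} → Segment x z y → (∀ i → NonNeg (g i at y)) → Pos (- (f zero at y)) → FirstZero f x z
    back s nonNeg y<0 = let w , s′ , w≈0 = crossing (f zero) (pos zero) y<0 in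
      halt (segment-initial s s′) w≈0 λ i → segment-nonNeg (g i) (<⇒≤ (pos (suc i))) (nonNeg i) s′
    extend₁ : (∀ i → Pos (g i at z)) → Sign (f zero at z) → FirstZero f x z
    extend₁ all (positive 0<z) = inj₁ λ { zero → 0<z ; (suc i) → all i }
    extend₁ all (null z≈0)     = halt (segment-right x z) z≈0 λ i → <⇒≤ (all i)
    extend₁ all (negative z<0) = back (segment-right x z) (λ i → <⇒≤ (all i)) z<0
    extend₂ : ∀ {y i} → Segment x z y → (∀ i → NonNeg (g i at y)) → g i at y ≈ 0# →
      Sign (f zero at y) → FirstZero f x z
    extend₂ {y} {i} s nonNeg yᵢ≈0 (positive 0<y) =
      inj₂ (y , s , (λ { zero → <⇒≤ 0<y ; (suc i) → nonNeg i }) , suc i , yᵢ≈0)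
    extend₂ s nonNeg _ (null y≈0)     = halt s y≈0 nonNeg
    extend₂ s nonNeg _ (negative y<0) = back s nonNeg y<0
    extend : FirstZero g x z → FirstZero f x z
    extend (inj₁ all) = extend₁ all (sign _)
    extend (inj₂ (y , s , nonNeg , i , yᵢ≈0)) = extend₂ s nonNeg yᵢ≈0 (sign _)

  all-or-null : ∀ {m} (f : Fin m → Carrier) → (∀ i → NonNeg (f i)) → (∀ i → Pos (f i)) ⊎ ∃ λ i → f i ≈ 0#
  all-or-null {zero}  f nonNeg = inj₁ λ ()
  all-or-null {suc m} f nonNeg with nonNeg-split (nonNeg zero) | all-or-null (λ i → f (suc i)) (λ i → nonNeg (suc i))
  ... | inj₂ eq  | _               = inj₂ (zero , eq)
  ... | inj₁ _   | inj₂ (i , eq)   = inj₂ (suc i , eq)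
  ... | inj₁ pos | inj₁ all        = inj₁ λ { zero → pos ; (suc i) → all i }

  sign-change : ∀ {m} (f : Fin (suc m) → Carrier) → Pos (f zero) → NonNeg (- f (fromℕ m)) →
    ∃ λ (i : Fin m) → Pos (f (inject₁ i)) × NonNeg (- f (suc i))
  sign-change {zero}  f 0<f f≤0 = contradiction f≤0 (¬pos∧neg 0<f)
  sign-change {suc m} f 0<f f≤0 with sign (f (suc zero))
  ... | null f₁≈0     = zero , 0<f , ≈⇒nonNeg (trans (-‿cong f₁≈0) (solve 0 (:- :0 := :0) refl))
  ... | negative 0<-f = zero , 0<f , <⇒≤ 0<-f
  ... | positive 0<f₁ with sign-change (λ i → f (suc i)) 0<f₁ f≤0
  ...   | i , p , q = suc i , p , q

  abs-bound : ∀ x → ∃ λ A → Pos A × Pos (A - x) × Pos (A + x)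
  abs-bound x with max x (- x)
  ... | z , x≤z , -x≤z = z + 1# , pos-*-cancelˡ (pos-+ 0<1 0<1)
      (pos-resp (solve 2 (λ x A → (A :- x) :+ (A :+ x) := (:1 :+ :1) :* A) refl x (z + 1#)) (pos-+ p q)) , p , q
    where
    p : Pos (z + 1# - x)
    p = <⇒pos (≤-<-trans x≤z (<-add1 z))
    q : Pos (z + 1# + x)
    q = pos-resp (solve 2 (λ x A → A :- (:- x) := A :+ x) refl x (z + 1#)) (<⇒pos (≤-<-trans -x≤z (<-add1 z)))

  near⇒pos : ∀ {ε x y} → x - ε < y × y < x + ε → Pos (ε - (y - x)) × Pos (ε + (y - x))
  near⇒pos {ε} {x} {y} (l , r) =
    pos-resp (solve 3 (λ ε x y → x :+ ε :- y := ε :- (y :- x)) refl ε x y) (<⇒pos r) ,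
    pos-resp (solve 3 (λ ε x y → y :- (x :- ε) := ε :+ (y :- x)) refl ε x y) (<⇒pos l)

  pos⇒near : ∀ {ε x y} → Pos (ε - (y - x)) → Pos (ε + (y - x)) → x - ε < y × y < x + ε
  pos⇒near {ε} {x} {y} l r =
    pos⇒< (pos-resp (solve 3 (λ ε x y → ε :+ (y :- x) := y :- (x :- ε)) refl ε x y) r) ,
    pos⇒< (pos-resp (solve 3 (λ ε x y → ε :- (y :- x) := x :+ ε :- y) refl ε x y) l)

  near-refl : ∀ {ε} x → Pos ε → Near ε x x
  near-refl {ε} (x₁ , x₂) 0<ε = coordinate x₁ , coordinate x₂
    where
    coordinate : ∀ x → x - ε < x × x < x + ε
    coordinate x = pos⇒near
      (pos-resp (solve 2 (λ ε x → ε := ε :- (x :- x)) refl ε x) 0<ε)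
      (pos-resp (solve 2 (λ ε x → ε := ε :+ (x :- x)) refl ε x) 0<ε)

  near-mono : ∀ {ε δ x y} → ε ≤ δ → Near ε x y → Near δ x y
  near-mono {ε} {δ} ε≤δ (n₁ , n₂) = coordinate n₁ , coordinate n₂
    where
    coordinate : ∀ {x y} → x - ε < y × y < x + ε → x - δ < y × y < x + δ
    coordinate {x} {y} n with near⇒pos n
    ... | p , q = pos⇒near
      (pos-resp (solve 3 (λ ε δ u → (ε :- u) :+ (δ :- ε) := δ :- u) refl ε δ (y - x)) (pos-+-nonNeg p (≤⇒nonNeg ε≤δ)))
      (pos-resp (solve 3 (λ ε δ u → (ε :+ u) :+ (δ :- ε) := δ :+ u) refl ε δ (y - x)) (pos-+-nonNeg q (≤⇒nonNeg ε≤δ)))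

  -- Says that `α * u` exceeds `- (A * ε)` when |α| < A and |u| < ε, without absolute values: twice
  -- the claim is a sum of two products of positive factors.
  product-bound : ∀ {A α ε u} → Pos (A - α) → Pos (A + α) → Pos (ε - u) → Pos (ε + u) → Pos (A * ε + α * u)
  product-bound {A} {α} {ε} {u} p q r s = pos-*-cancelˡ (pos-+ 0<1 0<1) (pos-resp
    (solve 4 (λ A α ε u → (A :- α) :* (ε :- u) :+ (A :+ α) :* (ε :+ u) := (:1 :+ :1) :* (A :* ε :+ α :* u)) refl A α ε u)
    (pos-+ (*-pos p r) (*-pos q s)))

  at-difference : ∀ α β γ x₁ x₂ y₁ y₂ →
    α * (y₁ - x₁) + β * (y₂ - x₂) ≈ (α , β , γ) at (y₁ , y₂) - (α , β , γ) at (x₁ , x₂)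
  at-difference = solve 7 (λ α β γ x₁ x₂ y₁ y₂ →
    α :* (y₁ :- x₁) :+ β :* (y₂ :- x₂) := atᴱ α β γ y₁ y₂ :- atᴱ α β γ x₁ x₂) refl

  perturbation-pos : ∀ {A B α β v i u w} → (A + B) * i ≈ 1# →
    Pos (A * (v * i) + α * u) → Pos (B * (v * i) + β * w) → Pos (v + (α * u + β * w))
  perturbation-pos {A} {B} {α} {β} {v} {i} {u} {w} di≈1 p q = pos-resp (begin
    A * (v * i) + α * u + (B * (v * i) + β * w)
      ≈⟨ solve 6 (λ A B v i U W → A :* (v :* i) :+ U :+ (B :* (v :* i) :+ W) :=
           v :* ((A :+ B) :* i) :+ (U :+ W)) refl A B v i (α * u) (β * w) ⟩
    v * ((A + B) * i) + (α * u + β * w)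
      ≈⟨ +-congʳ (trans (*-congˡ di≈1) (*-identityʳ v)) ⟩
    v + (α * u + β * w) ∎) (pos-+ p q)

  -- The radius is the value at x divided by a strict bound A + B for |α| + |β|, the most by which
  -- the function can vary per unit of distance.
  open-pos : ∀ ℓ x → Pos (ℓ at x) → ∃ λ ε → Pos ε × (∀ y → Near ε x y → Pos (ℓ at y))
  open-pos ℓ@(α , β , γ) x@(x₁ , x₂) 0<v =
    let A , 0<A , A-α , A+α = abs-bound α
        B , 0<B , B-β , B+β = abs-bound β
        i , di≈1 , 0<i      = recip (pos-+ 0<A 0<B)
    in ℓ at x * i , *-pos 0<v 0<i , λ (y₁ , y₂) (n₁ , n₂) →
      let p₁ , q₁ = near⇒pos n₁
          p₂ , q₂ = near⇒pos n₂
      in pos-resp (trans (+-congˡ (at-difference α β γ x₁ x₂ y₁ y₂))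
                         (solve 2 (λ v w → v :+ (w :- v) := w) refl (ℓ at x) (ℓ at (y₁ , y₂))))
           (perturbation-pos di≈1 (product-bound A-α A+α p₁ q₁) (product-bound B-β B+β p₂ q₂))

  approach : ∀ {ε d x g t} → t * d ≈ ε → Pos t → Pos (d - (g - x)) → Pos (d + (g - x)) →
    x - ε < (1# - t) * x + t * g × (1# - t) * x + t * g < x + ε
  approach {ε} {d} {x} {g} {t} td≈ε 0<t p q = pos⇒near
    (pos-resp (trans (solve 4 (λ t d x g → t :* (d :- (g :- x)) := t :* d :- (((:1 :- t) :* x :+ t :* g) :- x)) refl t d x g)
      (+-congʳ td≈ε)) (*-pos 0<t p))
    (pos-resp (trans (solve 4 (λ t d x g → t :* (d :+ (g :- x)) := t :* d :+ (((:1 :- t) :* x :+ t :* g) :- x)) refl t d x g)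
      (+-congʳ td≈ε)) (*-pos 0<t q))

  -- The parameter is ε / (ε + A + B), where A and B bound the coordinates of g - x. The summand ε
  -- in the denominator keeps it at most 1.
  near-mix : ∀ {ε} x g → Pos ε → ∃ λ t → Pos t × t ≤ 1# × Near ε x (mix t x g)
  near-mix {ε} (x₁ , x₂) (g₁ , g₂) 0<ε =
    let A , 0<A , A-u , A+u = abs-bound (g₁ - x₁)
        B , 0<B , B-u , B+u = abs-bound (g₂ - x₂)
        i , di≈1 , 0<i      = recip (pos-+ 0<ε (pos-+ 0<A 0<B))
        td≈ε = trans (solve 3 (λ ε i d → ε :* i :* d := ε :* (d :* i)) refl ε i (ε + (A + B)))
                     (trans (*-congˡ di≈1) (*-identityʳ ε))
        0<t = *-pos 0<ε 0<i
        raiseA = λ u → solve 4 (λ ε A B u → (A :+ u) :+ (ε :+ B) := (ε :+ (A :+ B)) :+ u) refl ε A B u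
        raiseB = λ u → solve 4 (λ ε A B u → (B :+ u) :+ (ε :+ A) := (ε :+ (A :+ B)) :+ u) refl ε A B u
    in ε * i , 0<t ,
       nonNeg⇒≤ (<⇒≤ (pos-resp (trans
         (solve 4 (λ ε A B i → (A :+ B) :* i := (ε :+ (A :+ B)) :* i :- ε :* i) refl ε A B i)
         (+-congʳ di≈1)) (*-pos (pos-+ 0<A 0<B) 0<i))) ,
       approach td≈ε 0<t (pos-resp (raiseA _) (pos-+ A-u (pos-+ 0<ε 0<B)))
                         (pos-resp (raiseA _) (pos-+ A+u (pos-+ 0<ε 0<B))) ,
       approach td≈ε 0<t (pos-resp (raiseB _) (pos-+ B-u (pos-+ 0<ε 0<A)))
                         (pos-resp (raiseB _) (pos-+ B+u (pos-+ 0<ε 0<A)))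

-- Convex polygons

module Polygon {c ℓ₁ ℓ₂} (F : OrderedField c ℓ₁ ℓ₂)
  {s : ℕ} (q : Fin (3 ℕ.+ s) → Plane.Point F)
  (convex : ∀ i j → j ≢ i → j ≢ next i →
    OrderedField._<_ F (OrderedField.0# F) (Plane.orient F (q i) (q (next i)) (q j)))
  where

  open OrderedField F hiding (zero)
  open Plane F
  open IntegerSolver commutativeRing
  open OrderedFieldProperties F
  open Lines F
  open Relation.Binary.Reasoning.Setoid setoid

  edge : Fin (3 ℕ.+ s) → Line
  edge i = side (q i) (q (next i))

  Interior Closed : Pred Point _
  Interior x = ∀ i → Pos (edge i at x)
  Closed   x = ∀ i → NonNeg (edge i at x)

  OnBoundary : Pred Point _
  OnBoundary x = ∃ λ i → Segment (q i) (q (next i)) x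

  edge-at : ∀ i x → edge i at x ≈ orient (q i) (q (next i)) x
  edge-at i x = side-at (q i) (q (next i)) x

  edge-left : ∀ i → edge i at q i ≈ 0#
  edge-left i = trans (edge-at i (q i)) (orient-left (q i) (q (next i)))

  edge-right : ∀ i → edge i at q (next i) ≈ 0#
  edge-right i = trans (edge-at i (q (next i))) (orient-right (q i) (q (next i)))

  edge-pos : ∀ i j → j ≢ i → j ≢ next i → Pos (edge i at q j)
  edge-pos i j ≢₁ ≢₂ = pos-resp (sym (edge-at i (q j))) (convex i j ≢₁ ≢₂)

  edge-vertex : ∀ i j → NonNeg (edge i at q j)
  edge-vertex i j with j Finₚ.≟ i | j Finₚ.≟ next i
  ... | yes ≡.refl | _          = ≈⇒nonNeg (edge-left i)
  ... | no _       | yes ≡.refl = ≈⇒nonNeg (edge-right i)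
  ... | no ≢₁      | no ≢₂      = <⇒≤ (edge-pos i j ≢₁ ≢₂)

  i≢next : ∀ (i : Fin (3 ℕ.+ s)) → i ≢ next i
  i≢next = next-≢ (s≤s z≤n)

  i≢next² : ∀ (i : Fin (3 ℕ.+ s)) → i ≢ next (next i)
  i≢next² = next²-≢ (s≤s (s≤s z≤n))

  -- Apply `on-line` to the triangle of a, b and the vertex d before a. The side from d to a gives
  -- one area its sign. For the other, evaluate the function of the side after b by `barycentric`:
  -- it vanishes at b, and d has weight 0, so only the term at a survives.
  on-side : ∀ {x} → Closed x → ∀ i → edge i at x ≈ 0# → Segment (q i) (q (next i)) x
  on-side {x} closed i x≈0 = before (next-surjective i)
    where
    a b : Point
    a = q i
    b = q (next i)
    abx≈0 : orient a b x ≈ 0#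
    abx≈0 = trans (sym (edge-at i x)) x≈0
    before : (∃ λ h → next h ≡ i) → Segment a b x
    before (h , nh≡i) = on-line 0<abd abx≈0 0≤xbd 0≤axd
      where
      d : Point
      d = q h
      h≢i : h ≢ i
      h≢i h≡i = i≢next h (≡.trans h≡i (≡.sym nh≡i))
      h≢ni : h ≢ next i
      h≢ni = ≡.subst (λ j → h ≢ next j) nh≡i (i≢next² h)
      0<abd : Pos (orient a b d)
      0<abd = convex i h h≢i h≢ni
      0≤axd : NonNeg (orient a x d)
      0≤axd = nonNeg-resp (trans (edge-at h x) (trans
        (reflexive (≡.cong (λ j → orient d (q j) x) nh≡i)) (orient-cyclic d a x))) (closed h)
      e : Line
      e = edge (next i)
      weight : orient a b d * (e at x) ≈ (e at a) * orient x b d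
      weight = begin
        orient a b d * (e at x)
          ≈⟨ barycentric e a b d x ⟩
        orient x b d * (e at a) + orient a x d * (e at b) + orient a b x * (e at d)
          ≈⟨ +-cong (+-congˡ (*-congˡ (edge-left (next i)))) (*-congʳ abx≈0) ⟩
        orient x b d * (e at a) + orient a x d * 0# + 0# * (e at d)
          ≈⟨ solve 4 (λ u v w z → u :* v :+ w :* :0 :+ :0 :* z := v :* u) refl (orient x b d) (e at a) (orient a x d) (e at d) ⟩
        (e at a) * orient x b d ∎
      0≤xbd : NonNeg (orient x b d)
      0≤xbd = nonNeg-*-cancelˡ (edge-pos (next i) i (i≢next i) (i≢next² i))
        (nonNeg-resp weight (nonNeg-* (<⇒≤ 0<abd) (closed (next i))))

  exit : ∀ {x} z → Interior x → Interior z ⊎ (∃ λ y → Segment x z y × OnBoundary y)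
  exit z int = boundary (first-zero edge z int)
    where
    boundary : ∀ {x} → FirstZero edge x z → Interior z ⊎ (∃ λ y → Segment x z y × OnBoundary y)
    boundary (inj₁ int)                     = inj₁ int
    boundary (inj₂ (y , seg , nonNeg , i , y≈0)) = inj₂ (y , seg , i , on-side nonNeg i y≈0)

  closed-boundary : ∀ {x} → OnBoundary x → Closed x
  closed-boundary (i , seg) j = segment-nonNeg (edge j) (edge-vertex j i) (edge-vertex j (next i)) seg

  onBoundary-null : ∀ {x} → ((i , _) : OnBoundary x) → edge i at x ≈ 0#
  onBoundary-null {x} (i , seg@(t , _)) = begin
    edge i at x                                          ≈⟨ at-segment (edge i) seg ⟩
    (1# - t) * (edge i at q i) + t * (edge i at q (next i)) ≈⟨ +-cong (*-congˡ (edge-left i)) (*-congˡ (edge-right i)) ⟩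
    (1# - t) * 0# + t * 0#                               ≈⟨ solve 1 (λ t → (:1 :- t) :* :0 :+ t :* :0 := :0) refl t ⟩
    0#                                                   ∎

  interior-segment : ∀ {x y z} → Interior x → Interior y → Segment x y z → Interior z
  interior-segment int-x int-y seg i = segment-pos (edge i) (int-x i) (int-y i) seg

  interior-resp : ∀ {x y} → x ≈ᴾ y → Interior x → Interior y
  interior-resp x≈y int i = pos-resp (at-cong (edge i) x≈y) (int i)

  ½ : Carrier
  ½ = proj₁ (recip (pos-+ 0<1 0<1))

  0<½ : Pos ½
  0<½ = proj₂ (proj₂ (recip (pos-+ 0<1 0<1)))

  1-½≈½ : 1# - ½ ≈ ½
  1-½≈½ = trans (+-congʳ (sym (proj₁ (proj₂ (recip (pos-+ 0<1 0<1))))))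
                (solve 1 (λ h → (:1 :+ :1) :* h :- h := h) refl ½)

  midpoint : Point → Point → Point
  midpoint = mix ½

  midpoint-segment : ∀ a b → Segment a b (midpoint a b)
  midpoint-segment a b = ½ , <⇒≤ 0<½ , nonNeg⇒≤ (<⇒≤ (pos-resp (sym 1-½≈½) 0<½)) , ≈ᴾ-refl

  midpoint-at : ∀ ℓ a b → ℓ at midpoint a b ≈ ½ * (ℓ at a) + ½ * (ℓ at b)
  midpoint-at ℓ a b = trans (at-mix ℓ ½ a b) (+-congʳ (*-congʳ 1-½≈½))

  midpoint-posˡ : ∀ ℓ a b → Pos (ℓ at a) → NonNeg (ℓ at b) → Pos (ℓ at midpoint a b)
  midpoint-posˡ ℓ a b 0<a 0≤b = pos-resp (sym (midpoint-at ℓ a b))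
    (pos-+-nonNeg (*-pos 0<½ 0<a) (nonNeg-* (<⇒≤ 0<½) 0≤b))

  midpoint-posʳ : ∀ ℓ a b → NonNeg (ℓ at a) → Pos (ℓ at b) → Pos (ℓ at midpoint a b)
  midpoint-posʳ ℓ a b 0≤a 0<b = pos-resp (sym (midpoint-at ℓ a b))
    (nonNeg-+-pos (nonNeg-* (<⇒≤ 0<½) 0≤a) (*-pos 0<½ 0<b))

  q₁q₂ centre : Point
  q₁q₂   = midpoint (q (suc zero)) (q (suc (suc zero)))
  centre = midpoint (q zero) q₁q₂

  centre-nonNeg : ∀ ℓ → (∀ i → NonNeg (ℓ at q i)) → NonNeg (ℓ at centre)
  centre-nonNeg ℓ nonNeg = segment-nonNeg ℓ (nonNeg zero)
    (segment-nonNeg ℓ (nonNeg (suc zero)) (nonNeg (suc (suc zero))) (midpoint-segment _ _)) (midpoint-segment _ _)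

  -- A side contains just two vertices, so one of the vertices 0, 1, 2 lies strictly inside it:
  -- vertex 2 for side 0, vertex 0 for side 1, and vertex 1 for all others. All three have positive
  -- weight in `centre`.
  centre-interior : Interior centre
  centre-interior i = positive-at i (nextView i) ≡.refl
    where
    e₁₂ : NonNeg (edge i at q₁q₂)
    e₁₂ = segment-nonNeg (edge i) (edge-vertex i (suc zero)) (edge-vertex i (suc (suc zero))) (midpoint-segment _ _)
    from₀ : zero ≢ i → zero ≢ next i → Pos (edge i at centre)
    from₀ p r = midpoint-posˡ (edge i) (q zero) q₁q₂ (edge-pos i zero p r) e₁₂
    from₁ : suc zero ≢ i → suc zero ≢ next i → Pos (edge i at centre)
    from₁ p r = midpoint-posʳ (edge i) (q zero) q₁q₂ (edge-vertex i zero)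
      (midpoint-posˡ (edge i) (q (suc zero)) (q (suc (suc zero))) (edge-pos i (suc zero) p r) (edge-vertex i (suc (suc zero))))
    from₂ : suc (suc zero) ≢ i → suc (suc zero) ≢ next i → Pos (edge i at centre)
    from₂ p r = midpoint-posʳ (edge i) (q zero) q₁q₂ (edge-vertex i zero)
      (midpoint-posʳ (edge i) (q (suc zero)) (q (suc (suc zero))) (edge-vertex i (suc zero)) (edge-pos i (suc (suc zero)) p r))
    positive-at : ∀ j → NextView j → j ≡ i → Pos (edge i at centre)
    positive-at zero (step e) ≡.refl = from₂ (λ ()) λ eq → case (≡.trans (≡.cong toℕ eq) e)
      where case : 2 ≢ 1
            case ()
    positive-at zero (wrap () _)
    positive-at (suc zero) (step e) ≡.refl = from₀ (λ ()) λ eq → case (≡.trans (≡.cong toℕ eq) e)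
      where case : 0 ≢ 2
            case ()
    positive-at (suc zero) (wrap () _)
    positive-at (suc (suc j)) (step e) ≡.refl = from₁ (λ ()) λ eq → case (≡.trans (≡.cong toℕ eq) e)
      where case : 1 ≢ suc (suc (suc (toℕ j)))
            case ()
    positive-at (suc (suc j)) (wrap _ e) ≡.refl = from₁ (λ ()) λ eq → case (≡.trans eq e)
      where case : suc zero ≢ zero
            case ()

  -- Triangulate by the diagonals at q zero.
  interior-pos : ∀ ℓ → (∀ i → Pos (ℓ at q i)) → ∀ {x} → Interior x → Pos (ℓ at x)
  interior-pos ℓ pos {x} int = fan (sign-change f
      (pos-resp (trans (edge-at zero x) (reflexive (≡.cong (λ j → orient (q zero) (q j) x) (next-inject₁ zero)))) (int zero))
      (<⇒≤ (pos-resp (trans (edge-at last x) (trans (reflexive (≡.cong (λ j → orient (q last) (q j) x) (next-fromℕ (2 ℕ.+ s))))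
        (orient-swap (q last) (q zero) x))) (int last))))
    where
    last : Fin (3 ℕ.+ s)
    last = fromℕ (2 ℕ.+ s)
    f : Fin (2 ℕ.+ s) → Carrier
    f i = orient (q zero) (q (suc i)) x
    fan : (∃ λ (i : Fin (suc s)) → Pos (f (inject₁ i)) × NonNeg (- f (suc i))) → Pos (ℓ at x)
    fan (i , 0<abx , adx≤0) = pos-*-cancelˡ 0<abd (pos-resp (sym (barycentric ℓ a b d x))
      (pos-+ (pos-+-nonNeg (*-pos 0<xbd (pos zero)) (nonNeg-* 0≤axd (<⇒≤ (pos j)))) (*-pos 0<abx (pos (suc (suc i))))))
      where
      j : Fin (3 ℕ.+ s)
      j = inject₁ (suc i)
      nj : next j ≡ suc (suc i)
      nj = next-inject₁ (suc i)
      a b d : Point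
      a = q zero
      b = q j
      d = q (suc (suc i))
      0<abd : Pos (orient a b d)
      0<abd = pos-resp (trans (reflexive (≡.cong (λ k → orient b (q k) a) nj)) (sym (orient-cyclic a b d)))
        (convex j zero (λ ()) (λ eq → case (≡.trans eq nj)))
        where case : zero ≢ suc (suc i)
              case ()
      0<xbd : Pos (orient x b d)
      0<xbd = pos-resp (trans (edge-at j x) (trans (reflexive (≡.cong (λ k → orient b (q k) x) nj)) (sym (orient-cyclic x b d)))) (int j)
      0≤axd : NonNeg (orient a x d)
      0≤axd = nonNeg-resp (trans (sym (orient-swap d a x)) (orient-cyclic d a x)) adx≤0

  -- A face is defined by paths and agrees with `Interior` only up to equivalence, so the frontier
  -- is computed for any such predicate.
  module _ {ℓ} {P : Pred Point ℓ} (P⇒int : ∀ {x} → P x → Interior x) (int⇒P : ∀ {x} → Interior x → P x) where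

    frontier-closed : ∀ {x} → Frontier P x → Closed x
    frontier-closed {x} frontier i x<0 =
      let ε , 0<ε , near = open-pos (opposite (edge i)) x (pos-resp (sym (opposite-at (edge i) x)) (neg⇒pos x<0))
          (y , x-y , Py) , _ = frontier ε 0<ε
      in ¬pos∧neg (P⇒int Py i) (nonNeg-resp (opposite-at (edge i) y) (<⇒≤ (near y x-y)))

    frontier-not-interior : ∀ {x} → Frontier P x → ¬ Interior x
    frontier-not-interior {x} frontier int =
      let ε , 0<ε , near = common-scale (λ i ε → ∀ y → Near ε x y → Pos (edge i at y))
            (λ i ε≤δ near y x-y → near y (near-mono ε≤δ x-y)) (λ i → open-pos (edge i) x (int i))
          _ , (z , x-z , ¬Pz) = frontier ε 0<ε
      in ¬Pz (int⇒P (λ i → near i z x-z))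

    frontier⇒boundary : ∀ {x} → Frontier P x → OnBoundary x
    frontier⇒boundary {x} frontier = null-side (all-or-null (λ i → edge i at x) (frontier-closed frontier))
      where
      null-side : (∀ i → Pos (edge i at x)) ⊎ (∃ λ i → edge i at x ≈ 0#) → OnBoundary x
      null-side (inj₁ int)       = contradiction int (frontier-not-interior frontier)
      null-side (inj₂ (i , x≈0)) = i , on-side (frontier-closed frontier) i x≈0

    -- A small step towards the centre makes every side function positive; the nearby point outside
    -- `P` is x itself.
    boundary⇒frontier : ∀ {x} → OnBoundary x → Frontier P x
    boundary⇒frontier {x} on@(i , _) ε 0<ε =
      let t , 0<t , t≤1 , near = near-mix x centre 0<ε
      in (mix t x centre , near , int⇒P λ j → pos-resp (sym (at-mix (edge j) t x centre))
           (nonNeg-+-pos (nonNeg-* (≤⇒nonNeg t≤1) (closed-boundary on j)) (*-pos 0<t (centre-interior j)))) ,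
         (x , near-refl x 0<ε , λ Px → pos-≢0 (P⇒int Px i) (onBoundary-null on))

    frontier⇔boundary : ∀ x → Frontier P x ⇔ OnBoundary x
    frontier⇔boundary x = mk⇔ frontier⇒boundary boundary⇒frontier

-- Trees

module Trees where

  open import Data.Nat.Base using (_+_; _*_; _∸_; _<_; _≤_)

  Decreasing : (ℕ → ℕ) → ℕ → Set
  Decreasing f m = ∀ {i} → i < m → f (suc i) < f i

  decreasing-≤ : ∀ {f m} → Decreasing f m → ∀ {i j} → i ≤ j → j ≤ m → f j ≤ f i
  decreasing-≤ dec {i} {j} i≤j j≤m with ℕₚ.m≤n⇒m<n∨m≡n i≤j
  ... | inj₂ ≡.refl = ℕₚ.≤-refl
  decreasing-≤ dec {i} {suc j} i≤j j<m | inj₁ (s≤s i≤j′) =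
    ℕₚ.≤-trans (ℕₚ.<⇒≤ (dec j<m)) (decreasing-≤ dec i≤j′ (ℕₚ.<⇒≤ j<m))

  decreasing-< : ∀ {f m} → Decreasing f m → ∀ {i j} → i < j → j ≤ m → f j < f i
  decreasing-< dec {i} {suc j} (s≤s i≤j) j<m = ℕₚ.<-≤-trans (dec j<m) (decreasing-≤ dec i≤j (ℕₚ.<⇒≤ j<m))

  -- The sides of the polygon with vertices c 0 > c 1 > … > c s, and the vertices
  -- of the big convex polygon lying weakly on the outer side of each of them.
  data Side (s : ℕ) : Set where
    gap  : ∀ i → i < s → Side s
    base : Side s

  Beyond : ∀ {s} → (ℕ → ℕ) → Side s → ℕ → Set
  Beyond     c (gap i _) v = c (suc i) ≤ v × v ≤ c i
  Beyond {s} c base      v = v ≤ c s ⊎ c 0 ≤ v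

  Nested : (u v u′ v′ : ℕ) → Set
  Nested u v u′ v′ = v ≤ u′ ⊎ v′ ≤ u ⊎ (u ≤ u′ × v′ ≤ v) ⊎ (u′ ≤ u × v ≤ v′)

  nested-sym : ∀ {u v u′ v′} → Nested u v u′ v′ → Nested u′ v′ u v
  nested-sym (inj₁ x)               = inj₂ (inj₁ x)
  nested-sym (inj₂ (inj₁ x))        = inj₁ x
  nested-sym (inj₂ (inj₂ (inj₁ x))) = inj₂ (inj₂ (inj₂ x))
  nested-sym (inj₂ (inj₂ (inj₂ x))) = inj₂ (inj₂ (inj₁ x))

  -- Postorder codes of forests, their chords and their cells.

  module Paths (e : ℕ) where

    d : ℕ
    d = suc (suc e)

    -- Postorder code of a forest of m trees with q internal nodes, all of arity d:
    -- leaf appends a tree, node joins the last d trees.  The leaves are the hull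
    -- edges (v , v + 1), and a tree is drawn as the chord that spans its leaves.
    data Path : ℕ → ℕ → Set where
      []   : Path 0 0
      leaf : ∀ {m q} → Path m q → Path (suc m) q
      node : ∀ {m q} → Path (m + d) q → Path (suc m) (suc q)

    -- The ends of the trees from right to left; 0 from index m on.
    stack : ∀ {m q} → Path m q → ℕ → ℕ
    stack []       _       = 0
    stack (leaf P) zero    = suc (stack P 0)
    stack (leaf P) (suc i) = stack P i
    stack (node P) zero    = stack P 0
    stack (node P) (suc i) = stack P (i + d)

    top : ∀ {m q} → Path m q → ℕ
    top P = stack P 0

    Chord : ∀ {m q} → Path m q → ℕ → ℕ → Set
    Chord []       u v = Empty
    Chord (leaf P) u v = (u ≡ top P × v ≡ suc (top P)) ⊎ Chord P u v
    Chord (node P) u v = (u ≡ stack P d × v ≡ top P) ⊎ Chord P u v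

    chord? : ∀ {m q} (P : Path m q) u v → Dec (Chord P u v)
    chord? []       u v = no λ ()
    chord? (leaf P) u v = (u ℕₚ.≟ top P ×-dec v ℕₚ.≟ suc (top P)) ⊎-dec chord? P u v
    chord? (node P) u v = (u ℕₚ.≟ stack P d ×-dec v ℕₚ.≟ top P) ⊎-dec chord? P u v

    cell : ∀ {m q} → Path m q → Fin q → ℕ → ℕ
    cell (leaf P) i       = cell P i
    cell (node P) zero    = stack P
    cell (node P) (suc i) = cell P i

    top-size : ∀ {m q} (P : Path m q) → top P ≡ m + q * suc e
    top-size []       = ≡.refl
    top-size (leaf P) = ≡.cong suc (top-size P)
    top-size (node {m} {q} P) = begin
      top P                             ≡⟨ top-size P ⟩
      m + suc (suc e) + q * suc e       ≡⟨ ℕₚ.+-assoc m (suc (suc e)) _ ⟩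
      m + suc (suc e + q * suc e)       ≡⟨ ℕₚ.+-suc m _ ⟩
      suc m + suc q * suc e             ∎
      where open ≡.≡-Reasoning

    stack-bottom : ∀ {m q} (P : Path m q) → stack P m ≡ 0
    stack-bottom []       = ≡.refl
    stack-bottom (leaf P) = stack-bottom P
    stack-bottom (node P) = stack-bottom P

    stack-decreasing : ∀ {m q} (P : Path m q) → Decreasing (stack P) m
    stack-decreasing (leaf P) {zero}  _         = ℕₚ.≤-refl
    stack-decreasing (leaf P) {suc i} (s≤s i<m) = stack-decreasing P i<m
    stack-decreasing (node {m} P) {zero} _ = decreasing-< (stack-decreasing P) (s≤s z≤n) (ℕₚ.m≤n+m d m)
    stack-decreasing (node {m} P) {suc i} (s≤s i<m) = stack-decreasing P (ℕₚ.+-monoˡ-≤ d i<m)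

    -- The invariant behind all comparisons of chords and cells: whatever has been drawn lies under
    -- a single tree of the current forest.
    Gap : ∀ {m q} → Path m q → ℕ → ℕ → Set
    Gap {m} P u v = ∃ λ i → i < m × stack P (suc i) ≤ u × v ≤ stack P i

    gap-leaf : ∀ {m q u v} (P : Path m q) → Gap P u v → Gap (leaf P) u v
    gap-leaf P (i , i<m , p) = suc i , s≤s i<m , p

    -- The gaps of P either become part of the new chord's gap or lie to its left.
    data Merged (m : ℕ) : ℕ → Set where
      under : ∀ {i} → i < d → Merged m i
      left  : ∀ {i} → i < m → Merged m (i + d)

    merged : ∀ m i → i < m + d → Merged m i
    merged m i i<m+d with i ℕₚ.<? d
    ... | yes i<d = under i<d
    ... | no  i≮d = ≡.subst (Merged m) (ℕₚ.m∸n+n≡m (ℕₚ.≮⇒≥ i≮d))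
      (left (ℕₚ.+-cancelʳ-< d (i ∸ d) m (≡.subst (_< m + d) (≡.sym (ℕₚ.m∸n+n≡m (ℕₚ.≮⇒≥ i≮d))) i<m+d)))

    gap-node : ∀ {m q u v} (P : Path (m + d) q) → Gap P u v → Gap (node P) u v
    gap-node {m} P (i , i<m+d , l , r) with merged m i i<m+d
    ... | under i<d = 0 , s≤s z≤n ,
          ℕₚ.≤-trans (decreasing-≤ (stack-decreasing P) i<d (ℕₚ.m≤n+m d m)) l ,
          ℕₚ.≤-trans r (decreasing-≤ (stack-decreasing P) z≤n (ℕₚ.<⇒≤ i<m+d))
    ... | left {j} j<m = suc j , s≤s j<m , l , r

    chord-< : ∀ {m q u v} (P : Path m q) → Chord P u v → u < v
    chord-< (leaf P) (inj₁ (≡.refl , ≡.refl)) = ℕₚ.≤-refl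
    chord-< (leaf P) (inj₂ c)                 = chord-< P c
    chord-< (node {m} P) (inj₁ (≡.refl , ≡.refl)) = stack-decreasing (node {m} P) {0} (s≤s z≤n)
    chord-< (node P) (inj₂ c)                 = chord-< P c

    chord-gap : ∀ {m q u v} (P : Path m q) → Chord P u v → Gap P u v
    chord-gap (leaf P) (inj₁ (≡.refl , ≡.refl)) = 0 , s≤s z≤n , ℕₚ.≤-refl , ℕₚ.≤-refl
    chord-gap (leaf P) (inj₂ c)                 = gap-leaf P (chord-gap P c)
    chord-gap (node P) (inj₁ (≡.refl , ≡.refl)) = 0 , s≤s z≤n , ℕₚ.≤-refl , ℕₚ.≤-refl
    chord-gap (node P) (inj₂ c)                 = gap-node P (chord-gap P c)

    chord-≤top : ∀ {m q u v} (P : Path m q) → Chord P u v → v ≤ top P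
    chord-≤top P c with chord-gap P c
    ... | i , i<m , _ , v≤ = ℕₚ.≤-trans v≤ (decreasing-≤ (stack-decreasing P) z≤n (ℕₚ.<⇒≤ i<m))

    cell-decreasing : ∀ {m q} (P : Path m q) j → Decreasing (cell P j) d
    cell-decreasing (leaf P) j       = cell-decreasing P j
    cell-decreasing (node {m} P) zero i<d = stack-decreasing P (ℕₚ.≤-trans i<d (ℕₚ.m≤n+m d m))
    cell-decreasing (node P) (suc j) = cell-decreasing P j

    cell-gap : ∀ {m q} (P : Path m q) j → Gap P (cell P j d) (cell P j 0)
    cell-gap (leaf P) j       = gap-leaf P (cell-gap P j)
    cell-gap (node P) zero    = 0 , s≤s z≤n , ℕₚ.≤-refl , ℕₚ.≤-refl
    cell-gap (node P) (suc j) = gap-node P (cell-gap P j)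

    cell-≤top : ∀ {m q} (P : Path m q) j → cell P j 0 ≤ top P
    cell-≤top P j with cell-gap P j
    ... | i , i<m , _ , v≤ = ℕₚ.≤-trans v≤ (decreasing-≤ (stack-decreasing P) z≤n (ℕₚ.<⇒≤ i<m))

    stack-chord : ∀ {m q i} (P : Path m q) → i < m → Chord P (stack P (suc i)) (stack P i)
    stack-chord {i = zero}  (leaf P) _         = inj₁ (≡.refl , ≡.refl)
    stack-chord {i = suc i} (leaf P) (s≤s i<m) = inj₂ (stack-chord P i<m)
    stack-chord {i = zero}  (node P) _         = inj₁ (≡.refl , ≡.refl)
    stack-chord {i = suc i} (node P) (s≤s i<m) = inj₂ (stack-chord P (ℕₚ.+-monoˡ-≤ d i<m))

    hull-chord : ∀ {m q b} (P : Path m q) → b < top P → Chord P b (suc b)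
    hull-chord {b = b} (leaf P) b<1+t with ℕₚ.m≤n⇒m<n∨m≡n (ℕₚ.≤-pred b<1+t)
    ... | inj₁ b<t = inj₂ (hull-chord P b<t)
    ... | inj₂ b≡t = inj₁ (b≡t , ≡.cong suc b≡t)
    hull-chord (node P) b<t = inj₂ (hull-chord P b<t)

    cell-side : ∀ {m q i} (P : Path m q) j → i < d → Chord P (cell P j (suc i)) (cell P j i)
    cell-side (leaf P) j       i<d = inj₂ (cell-side P j i<d)
    cell-side (node {m} P) zero i<d = inj₂ (stack-chord P (ℕₚ.≤-trans i<d (ℕₚ.m≤n+m d m)))
    cell-side (node P) (suc j) i<d = inj₂ (cell-side P j i<d)

    cell-base : ∀ {m q} (P : Path m q) j → Chord P (cell P j d) (cell P j 0)
    cell-base (leaf P) j       = inj₂ (cell-base P j)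
    cell-base (node P) zero    = inj₁ (≡.refl , ≡.refl)
    cell-base (node P) (suc j) = inj₂ (cell-base P j)

    -- Speaks of all vertices from u to v, so that it applies to a chord and to a whole cell below
    -- that chord.
    Separated : (ℕ → ℕ) → ℕ → ℕ → Set
    Separated c u v = ∃ λ (s : Side d) → ∀ w → u ≤ w → w ≤ v → Beyond c s w

    gap-separated : ∀ {m q u v} (P : Path (m + d) q) → Gap P u v → Separated (stack P) u v
    gap-separated {m} P (i , i<m+d , l , r) with merged m i i<m+d
    ... | under i<d = gap i i<d , λ w u≤w w≤v → ℕₚ.≤-trans l u≤w , ℕₚ.≤-trans w≤v r
    ... | left {j} j<m = base , λ w u≤w w≤v → inj₁ (ℕₚ.≤-trans w≤v (ℕₚ.≤-trans r
          (decreasing-≤ (stack-decreasing P) (ℕₚ.m≤n+m d j) (ℕₚ.<⇒≤ i<m+d))))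

    -- Only the two ends: a chord that spans a cell has its ends beyond the base side, but not the
    -- vertices in between.
    SeparatedPair : (ℕ → ℕ) → ℕ → ℕ → Set
    SeparatedPair c u v = ∃ λ (s : Side d) → Beyond c s u × Beyond c s v

    separatedPair : ∀ {c u v} → u ≤ v → Separated c u v → SeparatedPair c u v
    separatedPair u≤v (s , beyond) = s , beyond _ ℕₚ.≤-refl u≤v , beyond _ u≤v ℕₚ.≤-refl

    -- A new leaf lies to the right of all cells. At a node, each older chord lies under one tree,
    -- hence behind one side of the new cell or to its left; and the new chord either spans an older
    -- cell or lies to its right, so that its ends are beyond that cell's base side.
    chord-separated : ∀ {m q u v} (P : Path m q) → Chord P u v → ∀ j → SeparatedPair (cell P j) u v
    chord-separated (leaf P) (inj₁ (≡.refl , ≡.refl)) j =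
      base , inj₂ (cell-≤top P j) , inj₂ (ℕₚ.m≤n⇒m≤1+n (cell-≤top P j))
    chord-separated (leaf P) (inj₂ c) j = chord-separated P c j
    chord-separated (node P) (inj₁ (≡.refl , ≡.refl)) zero = base , inj₁ ℕₚ.≤-refl , inj₂ ℕₚ.≤-refl
    chord-separated (node P) (inj₂ c) zero =
      separatedPair (ℕₚ.<⇒≤ (chord-< P c)) (gap-separated P (chord-gap P c))
    chord-separated (node {m} P) (inj₁ (≡.refl , ≡.refl)) (suc j) with cell-gap P j
    ... | i , i<m+d , l , r with merged m i i<m+d
    ...   | under i<d = base ,
            inj₁ (ℕₚ.≤-trans (decreasing-≤ (stack-decreasing P) i<d (ℕₚ.m≤n+m d m)) l) ,
            inj₂ (cell-≤top P j)
    ...   | left {i′} _ = base ,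
            inj₂ (ℕₚ.≤-trans r (decreasing-≤ (stack-decreasing P) (ℕₚ.m≤n+m d i′) (ℕₚ.<⇒≤ i<m+d))) ,
            inj₂ (cell-≤top P j)
    chord-separated (node P) (inj₂ c) (suc j) = chord-separated P c j

    Apart : (ℕ → ℕ) → (ℕ → ℕ) → Set
    Apart c c′ = ∃ λ (s : Side d) → ∀ {i} → i ≤ d → Beyond c s (c′ i)

    separated-apart : ∀ {c c′} → Decreasing c′ d → Separated c (c′ d) (c′ 0) → Apart c c′
    separated-apart dec (s , beyond) = s , λ i≤d →
      beyond _ (decreasing-≤ dec i≤d ℕₚ.≤-refl) (decreasing-≤ dec z≤n i≤d)

    -- The cell closed later supplies the separating side, since the earlier one lies under a single
    -- tree at that moment; hence the disjunction.
    cells-apart : ∀ {m q} (P : Path m q) i j → i ≢ j →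
      Apart (cell P i) (cell P j) ⊎ Apart (cell P j) (cell P i)
    cells-apart (leaf P) i       j       i≢j = cells-apart P i j i≢j
    cells-apart (node P) zero    zero    i≢j = contradiction ≡.refl i≢j
    cells-apart (node P) zero    (suc j) _   = inj₁ (separated-apart (cell-decreasing P j) (gap-separated P (cell-gap P j)))
    cells-apart (node P) (suc i) zero    _   = inj₂ (separated-apart (cell-decreasing P i) (gap-separated P (cell-gap P i)))
    cells-apart (node P) (suc i) (suc j) i≢j = cells-apart P i j (i≢j ∘ ≡.cong suc)

    private
      new-old : ∀ {m q u v} (P : Path (m + d) q) → Gap P u v → Nested (stack P d) (top P) u v
      new-old {m} P (i , i<m+d , l , r) with merged m i i<m+d
      ... | under i<d = inj₂ (inj₂ (inj₁
            ( ℕₚ.≤-trans (decreasing-≤ (stack-decreasing P) i<d (ℕₚ.m≤n+m d m)) l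
            , ℕₚ.≤-trans r (decreasing-≤ (stack-decreasing P) z≤n (ℕₚ.<⇒≤ i<m+d)))))
      ... | left {j} _ = inj₂ (inj₁ (ℕₚ.≤-trans r (decreasing-≤ (stack-decreasing P) (ℕₚ.m≤n+m d j) (ℕₚ.<⇒≤ i<m+d))))

    chords-nested : ∀ {m q u v u′ v′} (P : Path m q) → Chord P u v → Chord P u′ v′ → Nested u v u′ v′
    chords-nested (leaf P) (inj₁ (≡.refl , ≡.refl)) (inj₁ (≡.refl , ≡.refl)) = inj₂ (inj₂ (inj₁ (ℕₚ.≤-refl , ℕₚ.≤-refl)))
    chords-nested (leaf P) (inj₁ (≡.refl , ≡.refl)) (inj₂ c′) = inj₂ (inj₁ (chord-≤top P c′))
    chords-nested (leaf P) (inj₂ c) (inj₁ (≡.refl , ≡.refl)) = inj₁ (chord-≤top P c)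
    chords-nested (leaf P) (inj₂ c) (inj₂ c′) = chords-nested P c c′
    chords-nested (node P) (inj₁ (≡.refl , ≡.refl)) (inj₁ (≡.refl , ≡.refl)) = inj₂ (inj₂ (inj₁ (ℕₚ.≤-refl , ℕₚ.≤-refl)))
    chords-nested (node P) (inj₁ (≡.refl , ≡.refl)) (inj₂ c′) = new-old P (chord-gap P c′)
    chords-nested (node P) (inj₂ c) (inj₁ (≡.refl , ≡.refl)) = nested-sym (new-old P (chord-gap P c))
    chords-nested (node P) (inj₂ c) (inj₂ c′) = chords-nested P c c′

  -- The rule (k + 1) C(n, k + 1) = (n - k) C(n, k) with n = k + a, which avoids subtraction.
  absorption : ∀ a k → suc k * ((k + a) C suc k) ≡ a * ((k + a) C k)
  absorption zero k = ≡.trans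
    (≡.cong (suc k *_) (k>n⇒nCk≡0 (s≤s (ℕₚ.≤-reflexive (ℕₚ.+-identityʳ k))))) (ℕₚ.*-zeroʳ (suc k))
  absorption (suc a) zero = ≡.trans (ℕₚ.*-identityˡ _) (≡.trans (nC1≡n (suc a)) (≡.sym (ℕₚ.*-identityʳ (suc a))))
  absorption (suc a) (suc k) = begin
    suc (suc k) * (suc N C suc (suc k))          ≡⟨ ≡.cong (suc (suc k) *_) (nCk+nC[k+1]≡[n+1]C[k+1] N (suc k)) ⟨
    suc (suc k) * (X + N C suc (suc k))          ≡⟨ ℕₚ.*-distribˡ-+ (suc (suc k)) X _ ⟩
    suc (suc k) * X + suc (suc k) * (N C suc (suc k)) ≡⟨ ≡.cong (λ n → suc (suc k) * X + n) second ⟩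
    suc (suc k) * X + a * X                      ≡⟨ shift k a X ⟩
    suc k * X + suc a * X                        ≡⟨ ≡.cong (_+ suc a * X) (absorption (suc a) k) ⟩
    suc a * (N C k) + suc a * X                  ≡⟨ ℕₚ.*-distribˡ-+ (suc a) _ X ⟨
    suc a * (N C k + X)                          ≡⟨ ≡.cong (suc a *_) (nCk+nC[k+1]≡[n+1]C[k+1] N k) ⟩
    suc a * (suc N C suc k)                      ∎
    where
    open ≡.≡-Reasoning
    N X : ℕ
    N = k + suc a
    X = N C suc k
    shift : ∀ k a X → suc (suc k) * X + a * X ≡ suc k * X + suc a * X
    shift = solve-∀
    second : suc (suc k) * (N C suc (suc k)) ≡ a * X
    second = ≡.subst (λ M → suc (suc k) * (M C suc (suc k)) ≡ a * (M C suc k))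
      (≡.sym (ℕₚ.+-suc k a)) (absorption a (suc k))

  -- Counting forests: the ballot formula.

  module Counting (e : ℕ) where

    open Paths e

    count : ℕ → ℕ → ℕ
    count zero    zero    = 1
    count zero    (suc q) = 0
    count (suc m) zero    = count m zero
    count (suc m) (suc q) = count m (suc q) + count (m + d) q

    private
      none : ∀ {q} → ¬ Path 0 (suc q)
      none ()

    path↔fin : ∀ m q → Path m q ↔ Fin (count m q)
    path↔fin zero    zero    = mk↔ₛ′ (λ _ → zero) (λ _ → []) (λ { zero → ≡.refl }) (λ { [] → ≡.refl })
    path↔fin zero    (suc q) = mk↔ₛ′ (λ P → ⊥-elim (none P)) (λ ()) (λ ()) (λ P → ⊥-elim (none P))
    path↔fin (suc m) zero    = ↔-trans
      (mk↔ₛ′ (λ { (leaf P) → P }) leaf (λ _ → ≡.refl) (λ { (leaf P) → ≡.refl })) (path↔fin m zero)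
    path↔fin (suc m) (suc q) = ↔-trans
      (mk↔ₛ′ (λ { (leaf P) → inj₁ P ; (node P) → inj₂ P }) (λ { (inj₁ P) → leaf P ; (inj₂ P) → node P })
        (λ { (inj₁ _) → ≡.refl ; (inj₂ _) → ≡.refl }) (λ { (leaf _) → ≡.refl ; (node _) → ≡.refl }))
      (↔-trans (path↔fin m (suc q) ⊎-↔ path↔fin (m + d) q) (↔-sym Finₚ.+↔⊎))

    -- In postorder the nodes above the rightmost leaf are exactly those that follow the last
    -- `leaf`.
    spine : ∀ {m q} → Path m q → ℕ
    spine []       = 0
    spine (leaf P) = 0
    spine (node P) = suc (spine P)

    Spined : ℕ → ℕ → ℕ → Set
    Spined j m q = Σ (Path m q) λ P → spine P ≡ j

    -- Remove the rightmost leaf and the nodes above it.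
    spined↔path : ∀ j m q → Spined j (suc m) (j + q) ↔ Path (m + j * suc e) q
    spined↔path zero m q = ≡.subst (λ n → Spined 0 (suc m) q ↔ Path n q) (≡.sym (ℕₚ.+-identityʳ m))
      (mk↔ₛ′ (λ { (leaf P , _) → P }) (λ P → leaf P , ≡.refl) (λ _ → ≡.refl) (λ { (leaf P , ≡.refl) → ≡.refl }))
    spined↔path (suc j) m q = ↔-trans
      (mk↔ₛ′ (λ { (leaf _ , ()) ; (node P , eq) → P , ℕₚ.suc-injective eq }) (λ { (P , eq) → node P , ≡.cong suc eq })
        (λ { (P , eq) → ≡.cong (P ,_) (ℕₚ.≡-irrelevant _ eq) })
        (λ { (leaf _ , ()) ; (node P , eq) → ≡.cong (node P ,_) (ℕₚ.≡-irrelevant _ eq) }))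
      (≡.subst₂ (λ m₁ m₂ → Spined j m₁ (j + q) ↔ Path m₂ q)
        (≡.sym (ℕₚ.+-suc m (suc e))) (ℕₚ.+-assoc m (suc e) (j * suc e))
        (spined↔path j (m + suc e) q))

    spined↔fin : ∀ {j r} → j ≤ r → Spined j 1 r ↔ Fin (count (j * suc e) (r ∸ j))
    spined↔fin {j} {r} j≤r = ↔-trans
      (≡.subst (λ n → Spined j 1 n ↔ Path (j * suc e) (r ∸ j)) (ℕₚ.m+[n∸m]≡n j≤r) (spined↔path j 0 (r ∸ j)))
      (path↔fin (j * suc e) (r ∸ j))

    count-zero : ∀ m → count m 0 ≡ 1
    count-zero zero    = ≡.refl
    count-zero (suc m) = count-zero m

    -- The ballot number as C(N, q + 1) - (d - 1) C(N, q), with the subtraction moved across. Both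
    -- terms of the recurrence for `count` have the same N, one less than that of the claim, so
    -- Pascal's rule adds them up. For m = 0 the count vanishes and `absorption` gives the equation.
    count-formula : ∀ m q → let N = m + (suc e + q * d) in
      count m (suc q) + suc e * (N C q) ≡ N C suc q
    count-formula zero q = ℕₚ.*-cancelˡ-≡ _ _ (suc q) (begin
      suc q * (suc e * (N C q))     ≡⟨ ℕₚ.*-assoc (suc q) (suc e) (N C q) ⟨
      suc q * suc e * (N C q)       ≡⟨ ≡.cong (λ n → suc q * suc e * (n C q)) (size q e) ⟩
      suc q * suc e * (M C q)       ≡⟨ absorption (suc q * suc e) q ⟨
      suc q * (M C suc q)           ≡⟨ ≡.cong (λ n → suc q * (n C suc q)) (size q e) ⟨
      suc q * (N C suc q)           ∎)
      where
      open ≡.≡-Reasoning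
      N M : ℕ
      N = suc e + q * d
      M = q + suc q * suc e
      size : ∀ q e → suc e + q * suc (suc e) ≡ q + suc q * suc e
      size = solve-∀
    count-formula (suc m) zero = begin
      count m 1 + count (m + d) 0 + suc e * 1   ≡⟨ ≡.cong (λ n → count m 1 + n + suc e * 1) (count-zero (m + d)) ⟩
      count m 1 + 1 + suc e * 1                 ≡⟨ shift (count m 1) e ⟩
      suc (count m 1 + suc e * 1)               ≡⟨ ≡.cong suc (count-formula m zero) ⟩
      suc (N C 1)                               ≡⟨ ≡.cong suc (nC1≡n N) ⟩
      suc N                                     ≡⟨ nC1≡n (suc N) ⟨
      suc N C 1                                 ∎
      where
      open ≡.≡-Reasoning
      N : ℕ
      N = m + (suc e + zero)
      shift : ∀ x e → x + 1 + suc e * 1 ≡ suc (x + suc e * 1)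
      shift = solve-∀
    count-formula (suc m) (suc q) = begin
      A + B + suc e * (suc N C suc q)                     ≡⟨ ≡.cong (λ n → A + B + suc e * n) (nCk+nC[k+1]≡[n+1]C[k+1] N q) ⟨
      A + B + suc e * (N C q + N C suc q)                 ≡⟨ shift A B (suc e) (N C q) (N C suc q) ⟩
      (B + suc e * (N C q)) + (A + suc e * (N C suc q))   ≡⟨ ≡.cong₂ _+_ lower (count-formula m (suc q)) ⟩
      N C suc q + N C suc (suc q)                         ≡⟨ nCk+nC[k+1]≡[n+1]C[k+1] N (suc q) ⟩
      suc N C suc (suc q)                                 ∎
      where
      open ≡.≡-Reasoning
      N A B : ℕ
      N = m + (suc e + suc q * d)
      A = count m (suc (suc q))
      B = count (m + d) (suc q)
      shift : ∀ A B f X Y → A + B + f * (X + Y) ≡ (B + f * X) + (A + f * Y)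
      shift = solve-∀
      size : ∀ m e q → m + suc (suc e) + (suc e + q * suc (suc e)) ≡ m + (suc e + suc q * suc (suc e))
      size = solve-∀
      lower : B + suc e * (N C q) ≡ N C suc q
      lower = ≡.subst (λ n → B + suc e * (n C q) ≡ n C suc q) (size m e q) (count-formula (m + d) q)

    -- For m = j (d - 1) the number N of `count-formula` is q + r (d - 1). Multiplying by r and
    -- absorbing turns the subtracted term into q + 1 copies of C(N, q + 1), and r - (q + 1) = j
    -- copies remain.
    ballot : ∀ j q → (q + j) * count (j * suc e) q ≡ j * ((d * (q + j) ∸ j ∸ 1) C q)
    ballot j zero    = ≡.cong (j *_) (count-zero (j * suc e))
    ballot j (suc q) = ℕₚ.+-cancelʳ-≡ (suc q * (N C suc q)) _ _ (begin
      r * A + suc q * (N C suc q)                   ≡⟨ ≡.cong (λ n → r * A + suc q * (n C suc q)) (size₁ j e q) ⟩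
      r * A + suc q * (M C suc q)                   ≡⟨ ≡.cong (λ n → r * A + n) (absorption (r * suc e) q) ⟩
      r * A + r * suc e * (M C q)                   ≡⟨ ≡.cong (λ n → r * A + r * suc e * (n C q)) (size₁ j e q) ⟨
      r * A + r * suc e * (N C q)                   ≡⟨ shift r A (suc e) (N C q) ⟩
      r * (A + suc e * (N C q))                     ≡⟨ ≡.cong (r *_) (count-formula (j * suc e) q) ⟩
      r * (N C suc q)                               ≡⟨ split q j (N C suc q) ⟩
      j * (N C suc q) + suc q * (N C suc q)         ≡⟨ ≡.cong (λ n → j * (n C suc q) + suc q * (N C suc q)) size₂ ⟨
      j * ((d * r ∸ j ∸ 1) C suc q) + suc q * (N C suc q) ∎)
      where
      open ≡.≡-Reasoning
      r A N M : ℕ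
      r = suc q + j
      A = count (j * suc e) (suc q)
      N = j * suc e + (suc e + q * d)
      M = q + r * suc e
      size₁ : ∀ j e q → j * suc e + (suc e + q * suc (suc e)) ≡ q + (suc q + j) * suc e
      size₁ = solve-∀
      total : ∀ j e q → suc (suc e) * (suc q + j) ≡ j + suc (j * suc e + (suc e + q * suc (suc e)))
      total = solve-∀
      size₂ : d * r ∸ j ∸ 1 ≡ N
      size₂ = ≡.trans (≡.cong (λ n → n ∸ j ∸ 1) (total j e q)) (≡.cong (_∸ 1) (ℕₚ.m+n∸m≡n j (suc N)))
      shift : ∀ r A f X → r * A + r * f * X ≡ r * (A + f * X)
      shift = solve-∀
      split : ∀ q j X → (suc q + j) * X ≡ j * X + suc q * X
      split = solve-∀

  -- Checked on unnormalised rationals, where equality is cross-multiplication and no common divisor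
  -- has to be removed.
  fraction : ∀ v j r c .{{_ : NonZero r}} → r * v ≡ j * c → + v / 1 ≡ (+ j / r) ℚ.* (+ c / 1)
  fraction v j r@(suc _) c eq = ℚₚ.toℚᵘ-injective (begin
    ℚ.toℚᵘ (+ v / 1)                              ≈⟨ ℚₚ.toℚᵘ-fromℚᵘ (+ v ℚᵘ./ 1) ⟩
    + v ℚᵘ./ 1                                    ≈⟨ *≡* (cross eq) ⟩
    (+ j ℚᵘ./ r) ℚᵘ.* (+ c ℚᵘ./ 1)                ≈⟨ ℚᵘₚ.*-cong (ℚₚ.toℚᵘ-fromℚᵘ (+ j ℚᵘ./ r)) (ℚₚ.toℚᵘ-fromℚᵘ (+ c ℚᵘ./ 1)) ⟨
    ℚ.toℚᵘ (+ j / r) ℚᵘ.* ℚ.toℚᵘ (+ c / 1)        ≈⟨ ℚₚ.toℚᵘ-homo-* (+ j / r) (+ c / 1) ⟨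
    ℚ.toℚᵘ ((+ j / r) ℚ.* (+ c / 1))              ∎)
    where
    open import Relation.Binary.Reasoning.Setoid ℚᵘₚ.≃-setoid
    cross : r * v ≡ j * c → + v ℤ.* + (r * 1) ≡ (+ j ℤ.* + c) ℤ.* + 1
    cross eq = ≡.trans (≡.sym (ℤₚ.pos-* v (r * 1))) (≡.trans (≡.cong +_
      (≡.trans (≡.cong (v *_) (ℕₚ.*-identityʳ r)) (≡.trans (ℕₚ.*-comm v r) eq)))
      (≡.trans (ℤₚ.pos-* j c) (≡.sym (ℤₚ.*-identityʳ _))))

  -- A forest is determined by its chords.

  module PathInjectivity (e : ℕ) where

    open Paths e

    -- Every other tree ends strictly before the top, so a chord that reaches the top lies under the
    -- last tree.
    chord-top : ∀ {m q u} (P : Path m q) → Chord P u (top P) → stack P 1 ≤ u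
    chord-top {m} P c with chord-gap P c
    ... | zero  , _ , l , _         = l
    ... | suc i , i<m , _ , top≤ = contradiction (ℕₚ.<-≤-trans (decreasing-< (stack-decreasing P) (s≤s z≤n) (ℕₚ.<⇒≤ i<m)) top≤)
                                    (ℕₚ.<-irrefl ≡.refl)

    chord-top′ : ∀ {m q u v} (P : Path m q) → v ≡ top P → Chord P u v → stack P 1 ≤ u
    chord-top′ P ≡.refl = chord-top P

    stack-1-d : ∀ {m q} (P : Path (m + d) q) → stack P d < stack P 1
    stack-1-d {m} P = decreasing-< (stack-decreasing P) (s≤s (s≤s z≤n)) (ℕₚ.m≤n+m d m)

    top-unique : ∀ {m q} (P P′ : Path m q) → top P ≡ top P′
    top-unique P P′ = ≡.trans (top-size P) (≡.sym (top-size P′))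

    infix 4 _⊑_
    _⊑_ : ∀ {m q m′ q′} → Path m q → Path m′ q′ → Set
    P ⊑ P′ = ∀ {u v} → Chord P u v → Chord P′ u v

    private
      leaf-⊑ : ∀ {m q} {P P′ : Path m q} → leaf P ⊑ leaf P′ → P ⊑ P′
      leaf-⊑ {P = P} {P′} sub c with sub (inj₂ c)
      ... | inj₂ c′       = c′
      ... | inj₁ (_ , v≡) = contradiction (chord-≤top P c)
        (ℕₚ.<⇒≱ (≡.subst (top P <_) (≡.sym (≡.trans v≡ (≡.cong suc (top-unique P′ P)))) ℕₚ.≤-refl))

      node-lowest : ∀ {m q} {P P′ : Path (m + d) q} → node {m} P ⊑ node {m} P′ → stack P′ d ≤ stack P d
      node-lowest {m} {P = P} {P′} sub with sub (inj₁ (≡.refl , ≡.refl))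
      ... | inj₁ (u≡ , _) = ℕₚ.≤-reflexive (≡.sym u≡)
      ... | inj₂ c = ℕₚ.<⇒≤ (ℕₚ.<-≤-trans (stack-1-d {m} P′) (chord-top′ P′ (top-unique P P′) c))

      node-⊑ : ∀ {m q} {P P′ : Path (m + d) q} → stack P d ≡ stack P′ d → node {m} P ⊑ node {m} P′ → P ⊑ P′
      node-⊑ {m} {P = P} {P′} d≡d sub c with sub (inj₂ c)
      ... | inj₂ c′ = c′
      ... | inj₁ (u≡ , v≡) = contradiction (chord-top′ P (≡.trans v≡ (top-unique P′ P)) c)
        (ℕₚ.<⇒≱ (≡.subst (_< stack P 1) (≡.trans d≡d (≡.sym u≡)) (stack-1-d {m} P)))

      leaf≢node : ∀ {m q} {P : Path m (suc q)} {P′ : Path (m + d) q} → ¬ (node P′ ⊑ leaf P)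
      leaf≢node {m} {P = P} {P′} sub with sub (inj₁ (≡.refl , ≡.refl))
      ... | inj₂ c = contradiction (chord-≤top P c)
        (ℕₚ.<⇒≱ (≡.subst (top P <_) (top-unique (leaf P) (node {m} P′)) ℕₚ.≤-refl))
      ... | inj₁ (u≡ , v≡) = contradiction
        (ℕₚ.<-≤-trans (s≤s (stack-1-d {m} P′)) (stack-decreasing P′ (ℕₚ.≤-trans (s≤s z≤n) (ℕₚ.m≤n+m d m))))
        (ℕₚ.<-irrefl (≡.trans (≡.cong suc u≡) (≡.sym v≡)))

    -- The last symbol can be read off the chords at the common top: after a leaf the only such
    -- chord is a hull edge, while the chord of a node is longer than that and starts strictly below
    -- all others. So its start is determined, and deleting it from both sides leaves the inclusions
    -- for the shorter codes.
    path-unique : ∀ {m q} (P P′ : Path m q) → P ⊑ P′ → P′ ⊑ P → P ≡ P′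
    path-unique []       []        _ _ = ≡.refl
    path-unique (leaf P) (leaf P′) s t = ≡.cong leaf (path-unique P P′ (leaf-⊑ s) (leaf-⊑ t))
    path-unique (leaf P) (node P′) s t = contradiction (λ {u} {v} → t {u} {v}) (leaf≢node {P = P} {P′})
    path-unique (node P) (leaf P′) s t = contradiction (λ {u} {v} → s {u} {v}) (leaf≢node {P = P′} {P})
    path-unique (node {m} P) (node P′) s t = ≡.cong node (path-unique P P′ (node-⊑ {m} d≡d s) (node-⊑ {m} (≡.sym d≡d) t))
      where
      d≡d : stack P d ≡ stack P′ d
      d≡d = ℕₚ.≤-antisym (node-lowest {m} {P = P′} {P} t) (node-lowest {m} {P = P} {P′} s)

  -- The shift-reduce parser.

  largest : ∀ {p} {P : ℕ → Set p} → (∀ u → Dec (P u)) → ∀ n →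
    (∀ {u} → u < n → ¬ P u) ⊎ (∃ λ u → u < n × P u × (∀ {w} → w < n → P w → w ≤ u))
  largest P? zero = inj₁ λ ()
  largest P? (suc n) with P? n
  ... | yes p = inj₂ (n , ℕₚ.≤-refl , p , λ w<1+n _ → ℕₚ.≤-pred w<1+n)
  ... | no ¬p with largest P? n
  ...   | inj₁ none = inj₁ λ {u} u<1+n p → below u<1+n p (ℕₚ.m≤n⇒m<n∨m≡n (ℕₚ.≤-pred u<1+n))
    where
    below : ∀ {u} → u < suc n → _ → u < n ⊎ u ≡ n → Empty
    below _ p (inj₁ u<n)    = none u<n p
    below _ p (inj₂ ≡.refl) = ¬p p
  ...   | inj₂ (u , u<n , p , max) = inj₂ (u , ℕₚ.m≤n⇒m≤1+n u<n , p , λ {w} w<1+n pw →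
          below pw (ℕₚ.m≤n⇒m<n∨m≡n (ℕₚ.≤-pred w<1+n)))
    where
    below : ∀ {w} → _ → w < n ⊎ w ≡ n → w ≤ u
    below pw (inj₁ w<n)    = max w<n pw
    below pw (inj₂ ≡.refl) = contradiction pw ¬p

  locate : ∀ {f : ℕ → ℕ} {m u} → f m ≤ u → u < f 0 → ∃ λ i → i < m × f (suc i) ≤ u × u < f i
  locate {m = zero} l r = contradiction r (ℕₚ.≤⇒≯ l)
  locate {f} {suc m} {u} l r with f m ℕₚ.≤? u
  ... | no  fm≰u = m , ℕₚ.≤-refl , l , ℕₚ.≰⇒> fm≰u
  ... | yes fm≤u with locate {f} {m} fm≤u r
  ...   | i , i<m , p = i , ℕₚ.m≤n⇒m≤1+n i<m , p

  -- `separates` ranges over all of `E`, not only over the edges parsed so far; this is what makes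
  -- the polygon a face of the entire graph. There are s + 1 vertices.
  record IsCell (E : ℕ → ℕ → Set) (c : ℕ → ℕ) (s : ℕ) : Set where
    field
      decreasing : Decreasing c s
      sides      : ∀ {i} → i < s → E (c (suc i)) (c i)
      closing    : E (c s) (c 0)
      separates  : ∀ {u v} → E u v → ∃ λ (t : Side s) → Beyond c t u × Beyond c t v

  module Parse (e N : ℕ) (E : ℕ → ℕ → Set)
    (E? : ∀ u v → Dec (E u v))
    (E-< : ∀ {u v} → E u v → u < v) (E-≤ : ∀ {u v} → E u v → v ≤ N)
    (noncrossing : ∀ {t u v w} → t < u → u < v → v < w → E t v → ¬ E u w)
    (hull : ∀ {u} → u < N → E u (suc u)) (1≤N : 1 ≤ N) (base-edge : E 0 N)
    (cells : ∀ {c s} → 2 ≤ s → IsCell E c s → s ≡ suc (suc e))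
    where

    open Paths e
    open PathInjectivity e

    Sound : ∀ {m q} → Path m q → Set
    Sound P = ∀ {u v} → Chord P u v → E u v

    -- Completeness in the midst of the reductions at the top vertex: the edges ending there are
    -- accounted for only down to the start `stack P 1` of the last tree.
    Partial : ∀ {m q} → Path m q → Set
    Partial P = ∀ {u v} → E u v → v < top P ⊎ (v ≡ top P × stack P 1 ≤ u) → Chord P u v

    record Upto (b : ℕ) : Set where
      constructor upto
      field
        {m q}    : ℕ
        path     : Path (suc m) q
        reached  : top path ≡ b
        sound    : Sound path
        complete : ∀ {u v} → E u v → v ≤ b → Chord path u v

    -- At the top vertex b, take the chord (u , b) with the largest u below the
    -- last tree.  As chords do not cross, u is on the stack and the polygon from
    -- u to b along the stack is a cell; so it has the right size for a node.
    private
      top-cell : ∀ {m q s u} (P : Path m q) → s ≤ m → Sound P → Partial P →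
        stack P s ≡ u → E u (top P) → (∀ {w} → w < stack P 1 → E w (top P) → w ≤ u) →
        IsCell E (stack P) s
      top-cell {s = s} {u} P s≤m sound partial u≡ E-u max = record
        { decreasing = λ i<s → stack-decreasing P (ℕₚ.<-≤-trans i<s s≤m)
        ; sides      = λ i<s → sound (stack-chord P (ℕₚ.<-≤-trans i<s s≤m))
        ; closing    = ≡.subst (λ w → E w (top P)) (≡.sym u≡) E-u
        ; separates  = separates
        }
        where
        drawn : ∀ {x y} → E x y → Chord P x y → ∃ λ (t : Side s) → Beyond (stack P) t x × Beyond (stack P) t y
        drawn E-xy c with chord-gap P c
        ... | i , i<m , l , r with i ℕₚ.<? s
        ...   | yes i<s = gap i i<s , (l , ℕₚ.≤-trans (ℕₚ.<⇒≤ (E-< E-xy)) r) , (ℕₚ.≤-trans l (ℕₚ.<⇒≤ (E-< E-xy)) , r)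
        ...   | no  i≮s = base , inj₁ (ℕₚ.≤-trans (ℕₚ.<⇒≤ (E-< E-xy)) y≤) , inj₁ y≤
          where y≤ = ℕₚ.≤-trans r (decreasing-≤ (stack-decreasing P) (ℕₚ.≮⇒≥ i≮s) (ℕₚ.<⇒≤ i<m))
        around : ∀ {x y} → x ≤ u → top P ≤ y → ∃ λ (t : Side s) → Beyond (stack P) t x × Beyond (stack P) t y
        around x≤u t≤y = base , inj₁ (ℕₚ.≤-trans x≤u (ℕₚ.≤-reflexive (≡.sym u≡))) , inj₂ t≤y
        separates : ∀ {x y} → E x y → ∃ λ (t : Side s) → Beyond (stack P) t x × Beyond (stack P) t y
        separates {x} {y} E-xy with ℕₚ.<-cmp y (top P)
        ... | tri< y<t _ _ = drawn E-xy (partial E-xy (inj₁ y<t))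
        ... | tri≈ _ ≡.refl _ with stack P 1 ℕₚ.≤? x
        ...   | yes l = drawn E-xy (partial E-xy (inj₂ (≡.refl , l)))
        ...   | no ¬l = around (max (ℕₚ.≰⇒> ¬l) E-xy) ℕₚ.≤-refl
        separates {x} {y} E-xy | tri> _ _ t<y with x ℕₚ.≤? u | top P ℕₚ.≤? x
        ...   | yes x≤u | _       = around x≤u (ℕₚ.<⇒≤ t<y)
        ...   | no  _   | yes t≤x = base , inj₂ t≤x , inj₂ (ℕₚ.<⇒≤ t<y)
        -- What remains is an edge from strictly between u and the top to a vertex beyond the top;
        -- it would cross the chord from u to the top.
        ...   | no  x≰u | no  t≰x = contradiction E-xy (noncrossing (ℕₚ.≰⇒> x≰u) (ℕₚ.≰⇒> t≰x) t<y E-u)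

      -- Were u strictly under a tree, the chord over that tree would cross the edge from u to the
      -- top. The index is at least 2 because u is below the last tree, so the polygon has at least
      -- three vertices.
      on-stack : ∀ {m q u} (P : Path (suc m) q) → Sound P → u < stack P 1 → E u (top P) →
        ∃ λ i → suc (suc i) ≤ suc m × stack P (suc (suc i)) ≡ u
      on-stack {m} {u = u} P sound u<1 E-u
        with locate {stack P} {suc m} (ℕₚ.≤-trans (ℕₚ.≤-reflexive (stack-bottom P)) z≤n) (ℕₚ.<-trans u<1 (stack-decreasing P (s≤s z≤n)))
      ... | zero  , _   , l , _ = contradiction u<1 (ℕₚ.≤⇒≯ l)
      ... | suc i , i<m , l , r with ℕₚ.m≤n⇒m<n∨m≡n l
      ...   | inj₂ eq = i , i<m , eq
      ...   | inj₁ l′ = contradiction E-u (noncrossing l′ r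
                (decreasing-< (stack-decreasing P) (s≤s z≤n) (ℕₚ.<⇒≤ i<m)) (sound (stack-chord P i<m)))

      -- The fuel bounds the number of edges of the path.
      reduce : ∀ fuel {m q} (P : Path (suc m) q) → m ≤ fuel → Sound P → Partial P → Upto (top P)
      -- The height `n` is a variable tied by two equations to `suc m` and to `m′ + d`; matching on
      -- the second one gives the code the shape that `node` expects.
      reduce-at : ∀ fuel {m n q u} (P : Path n q) → n ≡ suc m → m ≤ fuel → Sound P → Partial P →
        (∃ λ m′ → n ≡ m′ + d) → stack P d ≡ u → E u (top P) →
        (∀ {w} → w < stack P 1 → E w (top P) → w ≤ u) → Upto (top P)

      reduce fuel {m} P m≤fuel sound partial with largest (λ u → E? u (top P)) (stack P 1)
      ... | inj₁ none = upto P ≡.refl sound complete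
        where
        complete : ∀ {u v} → E u v → v ≤ top P → Chord P u v
        complete {u} E-uv v≤t with ℕₚ.m≤n⇒m<n∨m≡n v≤t
        ... | inj₁ v<t    = partial E-uv (inj₁ v<t)
        ... | inj₂ ≡.refl = partial E-uv (inj₂ (≡.refl , ℕₚ.≮⇒≥ λ u<1 → none u<1 E-uv))
      ... | inj₂ (u , u<1 , E-u , max) with on-stack P sound u<1 E-u
      ...   | i , s≤m , u≡ with cells (s≤s (s≤s z≤n)) (top-cell P s≤m sound partial u≡ E-u max)
      ...     | ≡.refl = reduce-at fuel P ≡.refl m≤fuel sound partial
                           (suc m ∸ d , ≡.sym (ℕₚ.m∸n+n≡m s≤m)) u≡ E-u max

      reduce-at zero {m} {n} P n≡ z≤n _ _ (m′ , n≡′) = contradiction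
        (≡.subst (2 ≤_) (≡.trans (≡.sym n≡′) n≡) (ℕₚ.≤-trans (s≤s (s≤s z≤n)) (ℕₚ.m≤n+m d m′))) λ { (s≤s ()) }
      reduce-at (suc fuel) {m} P n≡ m≤fuel sound partial (m′ , ≡.refl) ≡.refl E-u max =
        reduce fuel (node P) m′≤fuel sound′ partial′
        where
        m′≤fuel : m′ ≤ fuel
        m′≤fuel = ℕₚ.≤-pred (ℕₚ.≤-trans (≡.subst (suc m′ ≤_) (ℕₚ.suc-injective (≡.trans (≡.sym (ℕₚ.+-suc m′ (suc e))) n≡))
          (≡.subst (suc m′ ≤_) (≡.sym (ℕₚ.+-suc m′ e)) (s≤s (ℕₚ.m≤m+n m′ e)))) m≤fuel)
        sound′ : Sound (node P)
        sound′ (inj₁ (≡.refl , ≡.refl)) = E-u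
        sound′ (inj₂ c)                 = sound c
        partial′ : Partial (node P)
        partial′ E-uv (inj₁ v<t) = inj₂ (partial E-uv (inj₁ v<t))
        partial′ {u} E-uv (inj₂ (≡.refl , l)) with stack P 1 ℕₚ.≤? u
        ... | yes l′ = inj₂ (partial E-uv (inj₂ (≡.refl , l′)))
        -- The edge starts in the new last tree but below the old one; maximality of the chosen
        -- start leaves only the new chord.
        ... | no ¬l′ = inj₁ (ℕₚ.≤-antisym (max (ℕₚ.≰⇒> ¬l′) E-uv) l , ≡.refl)

      start : Upto 1
      start = reduce 0 (leaf []) z≤n sound partial
        where
        sound : Sound (leaf [])
        sound (inj₁ (≡.refl , ≡.refl)) = hull 1≤N
        partial : Partial (leaf [])
        partial E-uv (inj₁ (s≤s z≤n)) = contradiction (E-< E-uv) λ ()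
        partial E-uv (inj₂ (≡.refl , _)) = inj₁ (ℕₚ.n≤0⇒n≡0 (ℕₚ.≤-pred (E-< E-uv)) , ≡.refl)

      shift : ∀ {b} → b < N → Upto b → Upto (suc b)
      shift b<N (upto {m} P ≡.refl sound complete) = reduce (suc m) (leaf P) ℕₚ.≤-refl sound′ partial
        where
        sound′ : Sound (leaf P)
        sound′ (inj₁ (≡.refl , ≡.refl)) = hull b<N
        sound′ (inj₂ c)                 = sound c
        partial : Partial (leaf P)
        partial E-uv (inj₁ v<1+b) = inj₂ (complete E-uv (ℕₚ.≤-pred v<1+b))
        partial E-uv (inj₂ (≡.refl , b≤u)) = inj₁ (ℕₚ.≤-antisym (ℕₚ.≤-pred (E-< E-uv)) b≤u , ≡.refl)

      run : ∀ b → suc b ≤ N → Upto (suc b)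
      run zero    _     = start
      run (suc b) b<N = shift b<N (run b (ℕₚ.<⇒≤ b<N))

    parse : ∃ λ q → Σ (Path 1 q) λ P → top P ≡ N × (∀ {u v} → Chord P u v → E u v) × (∀ {u v} → E u v → Chord P u v)
    parse = finish N ≡.refl 1≤N
      where
      finish : ∀ n → N ≡ n → 1 ≤ n → ∃ λ q → Σ (Path 1 q) λ P →
        top P ≡ N × (∀ {u v} → Chord P u v → E u v) × (∀ {u v} → E u v → Chord P u v)
      finish (suc b) N≡ _ with run b (ℕₚ.≤-reflexive (≡.sym N≡))
      ... | upto {zero} {q} P top≡ sound complete =
            q , P , ≡.trans top≡ (≡.sym N≡) , sound , λ E-uv → complete E-uv (≡.subst (_ ≤_) N≡ (E-≤ E-uv))
      -- With two or more trees the last one starts above 0, yet the edge from 0 to N has been drawn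
      -- and must lie under the last tree.
      ... | upto {suc m} P top≡ sound complete = contradiction
            (ℕₚ.<-≤-trans (stack-decreasing P (s≤s (s≤s z≤n)))
              (chord-top′ P (≡.sym top≡) (complete (≡.subst (E 0) N≡ base-edge) ℕₚ.≤-refl))) λ ()

open Trees

-- Geometric graphs on points in convex position

module PlaneGraphs where

  open import Data.Fin.Base using (_<_; _≤_)
  open import Data.Nat.Base using (_∸_)

  ∈-tabulate⁺ : ∀ {n} {P : Fin n → Set} (P? : ∀ i → Dec (P i)) {i} → P i → i ∈ tabulate (λ j → does (P? j))
  ∈-tabulate⁺ P? {i} p = lookup⇒[]= i _ (≡.trans (lookup∘tabulate _ i) (dec-true (P? i) p))

  ∈-tabulate⁻ : ∀ {n} {P : Fin n → Set} (P? : ∀ i → Dec (P i)) {i} → i ∈ tabulate (λ j → does (P? j)) → P i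
  ∈-tabulate⁻ P? {i} i∈ with P? i | ≡.trans (≡.sym (lookup∘tabulate (λ j → does (P? j)) i)) ([]=⇒lookup i∈)
  ... | yes p | _ = p

  graphOf : ∀ {n} {A : Fin n → Fin n → Set} → (∀ u v → Dec (A u v)) →
    (∀ {u v} → A u v → A v u) → (∀ {v} → ¬ A v v) → Graph n
  graphOf A? A-sym A-irrefl = record
    { neighbours = λ u → tabulate (λ v → does (A? u v))
    ; symmetric  = λ {u} {v} v∈ → ∈-tabulate⁺ (A? v) (A-sym (∈-tabulate⁻ (A? u) v∈))
    ; loopless   = λ {v} v∈ → A-irrefl (∈-tabulate⁻ (A? v) v∈)
    }

  subset-≡ : ∀ {n} (S T : Subset n) → (∀ {x} → x ∈ S → x ∈ T) → (∀ {x} → x ∈ T → x ∈ S) → S ≡ T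
  subset-≡ S T S⊆T T⊆S = Subsetₚ.⊆-antisym S⊆T T⊆S

  -- Phrased by membership, so that tabulated subsets need not be rewritten as unions.
  ∣insert∣ : ∀ {n} (S T : Subset n) x → x ∉ S → x ∈ T →
    (∀ {y} → y ∈ S → y ∈ T) → (∀ {y} → y ≢ x → y ∈ T → y ∈ S) → ∣ T ∣ ≡ suc ∣ S ∣
  ∣insert∣ (false ∷ S) (true ∷ T) zero _ _ S⊆T T⊆S =
    ≡.cong (suc ∘ ∣_∣) (subset-≡ T S (λ x∈ → Subsetₚ.drop-there (T⊆S (λ ()) (there x∈))) (λ x∈ → Subsetₚ.drop-there (S⊆T (there x∈))))
  ∣insert∣ (true ∷ S) T zero x∉S _ _ _ = contradiction here x∉S
  ∣insert∣ (false ∷ S) (false ∷ T) (suc x) x∉S (there x∈T) S⊆T T⊆S = ∣insert∣ S T x (x∉S ∘ there) x∈T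
    (λ y∈ → Subsetₚ.drop-there (S⊆T (there y∈))) (λ y≢x y∈ → Subsetₚ.drop-there (T⊆S (y≢x ∘ Finₚ.suc-injective) (there y∈)))
  ∣insert∣ (true ∷ S) (true ∷ T) (suc x) x∉S (there x∈T) S⊆T T⊆S = ≡.cong suc (∣insert∣ S T x (x∉S ∘ there) x∈T
    (λ y∈ → Subsetₚ.drop-there (S⊆T (there y∈))) (λ y≢x y∈ → Subsetₚ.drop-there (T⊆S (y≢x ∘ Finₚ.suc-injective) (there y∈))))
  ∣insert∣ (false ∷ S) (true ∷ T) (suc x) _ _ _ T⊆S = contradiction (T⊆S {zero} (λ ()) here) λ ()
  ∣insert∣ (true ∷ S) (false ∷ T) (suc x) _ _ S⊆T _ = contradiction (S⊆T {zero} here) λ ()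

  ∣X∣<2⇒unique : ∀ {n} (X : Subset n) → ∣ X ∣ ℕ.< 2 → ∀ {x y} → x ∈ X → y ∈ X → y ≡ x
  ∣X∣<2⇒unique X ∣X∣<2 {x} {y} x∈X y∈X with y Finₚ.≟ x
  ... | yes y≡x = y≡x
  ... | no  y≢x = contradiction (ℕₚ.≤-trans (s≤s (ℕₚ.≤-trans (s≤s z≤n)
        (Subsetₚ.x∈p⇒∣p-x∣<∣p∣ (Subsetₚ.x∈p∧x≢y⇒x∈p-y y∈X y≢x)))) (Subsetₚ.x∈p⇒∣p-x∣<∣p∣ x∈X)) (ℕₚ.<⇒≱ ∣X∣<2)

  least : ∀ {n p} {P : Fin n → Set p} → (∀ i → Dec (P i)) →
    (∀ i → ¬ P i) ⊎ (∃ λ i → P i × (∀ {j} → j < i → ¬ P j))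
  least {zero}  P? = inj₁ λ ()
  least {suc n} P? with P? zero
  ... | yes p = inj₂ (zero , p , λ ())
  ... | no ¬p with least (P? ∘ suc)
  ...   | inj₁ none = inj₁ λ { zero → ¬p ; (suc i) → none i }
  ...   | inj₂ (i , p , min) = inj₂ (suc i , p , λ { {zero} _ → ¬p ; {suc j} (s≤s j<i) → min j<i })

  module _ {n} (G : Graph n) where

    edge? : ∀ u v → Dec (Edge G u v)
    edge? u v = v Subsetₚ.∈? neighbours G u

    NonCrossing : Set
    NonCrossing = ∀ {t u v w} → t < u → u < v → v < w → Edge G t v → ¬ Edge G u w

    edge-≢ : ∀ {u v} → Edge G u v → u ≢ v
    edge-≢ e ≡.refl = loopless G e

  -- Two-connectedness and the hull cycle.

  module _ {N} (2≤N : 2 ℕ.≤ N) (G : Graph (suc N)) where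

    module _ (cycle : ∀ i → Edge G i (next i)) where

      private
        Step : Subset (suc N) → Rel (Fin (suc N)) _
        Step X x y = Edge G x y × x ∉ X × y ∉ X

        step-sym : ∀ {X x y} → Step X x y → Step X y x
        step-sym (e , x∉ , y∉) = symmetric G e , y∉ , x∉

        arc : ∀ X k a b → toℕ b ≡ k ℕ.+ toℕ a → (∀ w → a ≤ w → w ≤ b → w ∉ X) → Star (Step X) a b
        arc X zero a b eq off with Finₚ.toℕ-injective eq
        ... | ≡.refl = Star.ε
        arc X (suc k) a b eq off with nextView a
        ... | wrap a≡N _ = contradiction (Finₚ.toℕ≤pred[n] b)
                (ℕₚ.<⇒≱ (≡.subst (ℕ._< toℕ b) a≡N (≡.subst (toℕ a ℕ.<_) (≡.sym eq) (s≤s (ℕₚ.m≤n+m (toℕ a) k)))))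
        ... | step s = (cycle a , off a ℕₚ.≤-refl a≤b , off (next a) (ℕₚ.≤-trans (ℕₚ.n≤1+n _) (ℕₚ.≤-reflexive (≡.sym s))) next≤b) ◅
              arc X k (next a) b (≡.trans eq (≡.trans (≡.sym (ℕₚ.+-suc k (toℕ a))) (≡.cong (λ l → k ℕ.+ l) (≡.sym s))))
                (λ w next≤w → off w (ℕₚ.≤-trans (ℕₚ.≤-trans (ℕₚ.n≤1+n _) (ℕₚ.≤-reflexive (≡.sym s))) next≤w))
          where
          next≤b : next a ≤ b
          next≤b = ≡.subst₂ ℕ._≤_ (≡.sym s) (≡.sym eq) (s≤s (ℕₚ.m≤n+m (toℕ a) k))
          a≤b : a ≤ b
          a≤b = ≡.subst (toℕ a ℕ.≤_) (≡.sym eq) (ℕₚ.m≤n⇒m≤1+n (ℕₚ.m≤n+m (toℕ a) k))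

        arc-≤ : ∀ X {a b} → a ≤ b → (∀ w → a ≤ w → w ≤ b → w ∉ X) → Star (Step X) a b
        arc-≤ X {a} {b} a≤b = arc X (toℕ b ∸ toℕ a) a b (≡.sym (ℕₚ.m∸n+n≡m a≤b))

        -- At most one vertex is deleted. If it lies strictly between u and v, the other arc,
        -- through the edge between the first and the last vertex, is free.
        around : ∀ X → ∣ X ∣ ℕ.< 2 → ∀ {u v} → u < v → u ∉ X → v ∉ X → Star (Step X) u v
        around X ∣X∣<2 {u} {v} u<v u∉ v∉ with Finₚ.any? (λ x → x Subsetₚ.∈? X ×-dec (u Finₚ.<? x ×-dec x Finₚ.<? v))
        ... | no none = arc-≤ X (ℕₚ.<⇒≤ u<v) off
          where
          off : ∀ w → u ≤ w → w ≤ v → w ∉ X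
          off w u≤w w≤v w∈ with ℕₚ.m≤n⇒m<n∨m≡n u≤w | ℕₚ.m≤n⇒m<n∨m≡n w≤v
          ... | inj₁ u<w | inj₁ w<v = none (w , w∈ , u<w , w<v)
          ... | inj₂ u≡w | _        = u∉ (≡.subst (_∈ X) (≡.sym (Finₚ.toℕ-injective u≡w)) w∈)
          ... | inj₁ _   | inj₂ w≡v = v∉ (≡.subst (_∈ X) (Finₚ.toℕ-injective w≡v) w∈)
        ... | yes (x , x∈ , u<x , x<v) =
          Star.reverse (step-sym {X}) (arc-≤ X {zero} z≤n (λ w _ w≤u w∈ → below w≤u (∣X∣<2⇒unique X ∣X∣<2 x∈ w∈))) ◅◅
          (first-last ◅ Star.reverse (step-sym {X}) (arc-≤ X v≤N λ w v≤w _ w∈ → above v≤w (∣X∣<2⇒unique X ∣X∣<2 x∈ w∈)))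
          where
          last : Fin (suc N)
          last = fromℕ N
          below : ∀ {w} → w ≤ u → w ≢ x
          below w≤u ≡.refl = ℕₚ.<⇒≱ u<x w≤u
          above : ∀ {w} → v ≤ w → w ≢ x
          above v≤w ≡.refl = ℕₚ.<⇒≱ x<v v≤w
          v≤N : v ≤ last
          v≤N = ≡.subst (toℕ v ℕ.≤_) (≡.sym (Finₚ.toℕ-fromℕ N)) (Finₚ.toℕ≤pred[n] v)
          first-last : Step X zero last
          first-last = symmetric G (≡.subst (Edge G last) (next-last (nextView last)) (cycle last)) ,
            (λ w∈ → below z≤n (∣X∣<2⇒unique X ∣X∣<2 x∈ w∈)) ,
            (λ w∈ → above v≤N (∣X∣<2⇒unique X ∣X∣<2 x∈ w∈))
            where
            next-last : NextView last → next last ≡ zero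
            next-last (wrap _ eq) = eq
            next-last (step s)    = contradiction (Finₚ.toℕ≤pred[n] (next last))
              (ℕₚ.<⇒≱ (≡.subst (N ℕ.<_) (≡.sym (≡.trans s (≡.cong suc (Finₚ.toℕ-fromℕ N)))) ℕₚ.≤-refl))

      cycle⇒2-connected : 2 -Connected G
      cycle⇒2-connected = s≤s 2≤N , λ X ∣X∣<2 u v u∉ v∉ → connect X ∣X∣<2 u∉ v∉ (ℕₚ.<-cmp (toℕ u) (toℕ v))
        where
        connect : ∀ X → ∣ X ∣ ℕ.< 2 → ∀ {u v} → u ∉ X → v ∉ X → _ → Star (Step X) u v
        connect X ∣X∣<2 u∉ v∉ (tri< u<v _ _) = around X ∣X∣<2 u<v u∉ v∉
        connect X ∣X∣<2 u∉ v∉ (tri> _ _ v<u) = Star.reverse (step-sym {X}) (around X ∣X∣<2 v<u v∉ u∉)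
        connect X ∣X∣<2 u∉ v∉ (tri≈ _ u≡v _) with Finₚ.toℕ-injective u≡v
        ... | ≡.refl = Star.ε

    module _ (connected : 2 -Connected G) (noncrossing : NonCrossing G) where

      private
        -- The form in which two-connectedness is used: a set that edges can leave only through the
        -- single vertex m contains all other vertices as soon as it contains one of them.
        cut : ∀ {ℓ} (R : Pred (Fin (suc N)) ℓ) m → (∀ {x y} → R x → Edge G x y → R y ⊎ y ≡ m) →
          ∀ {u v} → u ≢ m → v ≢ m → R u → R v
        cut R m closed {u} {v} u≢m v≢m = walk
          (proj₂ connected ⁅ m ⁆ (s≤s (ℕₚ.≤-reflexive (Subsetₚ.∣⁅x⁆∣≡1 m))) u v
            (u≢m ∘ Subsetₚ.x∈⁅y⁆⇒x≡y m) (v≢m ∘ Subsetₚ.x∈⁅y⁆⇒x≡y m))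
          where
          walk : ∀ {u} → Star _ u v → R u → R v
          walk Star.ε r = r
          walk ((e , _ , y∉) ◅ path) r with closed r e
          ... | inj₁ r′     = walk path r′
          ... | inj₂ ≡.refl = contradiction (Subsetₚ.x∈⁅x⁆ m) y∉

        isolated : ∀ {u v} → u ≢ v → ¬ (∀ w → ¬ Edge G u w)
        isolated {u} {v} u≢v none with proj₂ connected ⊥ (ℕₚ.≤-trans (s≤s (ℕₚ.≤-reflexive (Subsetₚ.∣⊥∣≡0 (suc N)))) (s≤s z≤n)) u v Subsetₚ.∉⊥ Subsetₚ.∉⊥
        ... | Star.ε            = u≢v ≡.refl
        ... | (e , _) ◅ _  = none _ e

        -- Consider the vertices outside the interval from m to i. An edge from them into its
        -- interior would cross the edge mi, and none of them is adjacent to i; so m would cut them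
        -- off from i.
        lowest-neighbour : ∀ {i m} → Edge G i m → m < i → (∀ {w} → w < m → ¬ Edge G i w) →
          (∀ {w} → i < w → ¬ Edge G i w) → ∀ w → ¬ (w < m ⊎ i < w)
        lowest-neighbour {i} {m} e m<i below above w Rw =
          i∉R (cut R m closed (λ { ≡.refl → m∉R Rw }) (edge-≢ G e) Rw)
          where
          R : Pred (Fin (suc N)) _
          R w = w < m ⊎ i < w
          m∉R : ¬ R m
          m∉R (inj₁ m<m) = ℕₚ.<-irrefl ≡.refl m<m
          m∉R (inj₂ i<m) = ℕₚ.<-asym m<i i<m
          i∉R : ¬ R i
          i∉R (inj₁ i<m) = ℕₚ.<-asym m<i i<m
          i∉R (inj₂ i<i) = ℕₚ.<-irrefl ≡.refl i<i
          inner : ∀ {x y} → R x → m < y → y < i → ¬ Edge G x y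
          inner (inj₁ x<m) m<y y<i exy = noncrossing x<m m<y y<i exy (symmetric G e)
          inner (inj₂ i<x) m<y y<i exy = noncrossing m<y y<i i<x (symmetric G e) (symmetric G exy)
          to-i : ∀ {x} → R x → ¬ Edge G i x
          to-i (inj₁ x<m) = below x<m
          to-i (inj₂ i<x) = above i<x
          closed : ∀ {x y} → R x → Edge G x y → R y ⊎ y ≡ m
          closed {x} {y} Rx exy with Finₚ.<-cmp y m | Finₚ.<-cmp y i
          ... | tri< y<m _ _ | _            = inj₁ (inj₁ y<m)
          ... | tri≈ _ y≡m _ | _            = inj₂ y≡m
          ... | tri> _ _ m<y | tri< y<i _ _ = contradiction exy (inner Rx m<y y<i)
          ... | tri> _ _ m<y | tri≈ _ ≡.refl _ = contradiction (symmetric G exy) (to-i Rx)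
          ... | tri> _ _ m<y | tri> _ _ i<y = inj₁ (inj₂ i<y)

        -- Vertices strictly between i and its first neighbour m above could leave this range only
        -- through m: other edges out would cross im, and an edge to i contradicts the choice of m.
        next-neighbour : ∀ {i m} → Edge G i m → i < m → (∀ {w} → w < m → ¬ (i < w × Edge G i w)) →
          ∀ {w} → i < w → ¬ (w < m)
        next-neighbour {i} {m} e i<m between {w} i<w w<m =
          ℕₚ.<-irrefl ≡.refl (proj₁ (cut R m closed (λ { ≡.refl → ℕₚ.<-irrefl ≡.refl w<m }) (edge-≢ G e) (i<w , w<m)))
          where
          R : Pred (Fin (suc N)) _
          R w = i < w × w < m
          closed : ∀ {x y} → R x → Edge G x y → R y ⊎ y ≡ m
          closed {x} {y} (i<x , x<m) exy with Finₚ.<-cmp y i | Finₚ.<-cmp y m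
          ... | tri< y<i _ _ | _ = contradiction e (noncrossing y<i i<x x<m (symmetric G exy))
          ... | tri≈ _ ≡.refl _ | _ = contradiction (i<x , symmetric G exy) (between x<m)
          ... | tri> _ _ i<y | tri< y<m _ _ = inj₁ (i<y , y<m)
          ... | tri> _ _ i<y | tri≈ _ y≡m _ = inj₂ y≡m
          ... | tri> _ _ i<y | tri> _ _ m<y = contradiction exy (noncrossing i<x x<m m<y e)

      -- For the last vertex the lowest neighbour must be 0. For any other, the first neighbour
      -- above must be the successor; if there is none above, the successor is cut off by the lowest
      -- neighbour.
      2-connected⇒cycle : ∀ i → Edge G i (next i)
      2-connected⇒cycle i with nextView i
      ... | wrap i≡N next≡0 with least (edge? G i)
      ...   | inj₁ none = contradiction none (isolated {v = next i} λ eq →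
                ℕₚ.<⇒≢ (ℕₚ.<-trans (s≤s z≤n) 2≤N) (≡.trans (≡.cong toℕ (≡.sym (≡.trans eq next≡0))) i≡N))
      ...   | inj₂ (m , e , below) with m Finₚ.≟ zero
      ...     | yes ≡.refl = ≡.subst (Edge G i) (≡.sym next≡0) e
      ...     | no  m≢0 = contradiction (inj₁ (ℕₚ.n≢0⇒n>0 (m≢0 ∘ Finₚ.toℕ-injective)))
                  (lowest-neighbour e m<i below above zero)
        where
        m<i : m < i
        m<i = ≡.subst (toℕ m ℕ.<_) (≡.sym i≡N) (ℕₚ.≤∧≢⇒< (Finₚ.toℕ≤pred[n] m)
          λ m≡N → edge-≢ G e (Finₚ.toℕ-injective (≡.trans i≡N (≡.sym m≡N))))
        above : ∀ {w} → i < w → ¬ Edge G i w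
        above {w} i<w = contradiction (Finₚ.toℕ≤pred[n] w) (ℕₚ.<⇒≱ (≡.subst (ℕ._< toℕ w) i≡N i<w))
      2-connected⇒cycle i | step s with least (λ w → i Finₚ.<? w ×-dec edge? G i w)
      ...   | inj₂ (m , (i<m , e) , between) with m Finₚ.≟ next i
      ...     | yes ≡.refl = e
      ...     | no  m≢next = contradiction next<m (next-neighbour e i<m between i<next)
        where
        i<next : i < next i
        i<next = ℕₚ.≤-reflexive (≡.sym s)
        next<m : next i < m
        next<m = ℕₚ.≤∧≢⇒< (≡.subst (ℕ._≤ toℕ m) (≡.sym s) i<m) (m≢next ∘ ≡.sym ∘ Finₚ.toℕ-injective)
      2-connected⇒cycle i | step s | inj₁ noneAbove with least (edge? G i)
      ...   | inj₁ none = contradiction none (isolated {v = next i} λ eq →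
                ℕₚ.<⇒≢ (ℕₚ.≤-reflexive (≡.sym s)) (≡.cong toℕ eq))
      ...   | inj₂ (m , e , below) = contradiction (inj₂ (ℕₚ.≤-reflexive (≡.sym s)))
                (lowest-neighbour e m<i below (λ i<w e → noneAbove _ (i<w , e)) (next i))
        where
        m<i : m < i
        m<i = ℕₚ.≤∧≢⇒< (ℕₚ.≮⇒≥ λ i<m → noneAbove m (i<m , e)) (edge-≢ G e ∘ ≡.sym ∘ Finₚ.toℕ-injective)

  Increasing : ∀ {m n} → (Fin m → Fin n) → Set
  Increasing γ = ∀ {i j} → i < j → γ i < γ j

  increasing-injective : ∀ {m n} {γ : Fin m → Fin n} → Increasing γ → ∀ {i j} → γ i ≡ γ j → i ≡ j
  increasing-injective inc {i} {j} eq with Finₚ.<-cmp i j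
  ... | tri< i<j _ _ = contradiction (inc i<j) (ℕₚ.<-irrefl (≡.cong toℕ eq))
  ... | tri≈ _ i≡j _ = i≡j
  ... | tri> _ _ j<i = contradiction (inc j<i) (ℕₚ.<-irrefl (≡.cong toℕ (≡.sym eq)))

  -- Chords between points in convex position.

  module Positions {c ℓ₁ ℓ₂} (F : OrderedField c ℓ₁ ℓ₂) {s : ℕ} (p : Fin (3 ℕ.+ s) → Plane.Point F)
    (ccw : Plane.CounterClockwise F p) where

    open OrderedField F hiding (zero; _<_; _≤_)
    open Plane F
    open IntegerSolver commutativeRing
    open OrderedFieldProperties F
    open Lines F

    n : ℕ
    n = 3 ℕ.+ s

    outside-pos : ∀ {a b v : Fin n} → a < b → v < a ⊎ b < v → Pos (side (p a) (p b) at p v)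
    outside-pos {a} {b} {v} a<b (inj₁ v<a) = pos-resp
      (trans (orient-cyclic (p v) (p a) (p b)) (sym (side-at (p a) (p b) (p v)))) (ccw v<a a<b)
    outside-pos {a} {b} {v} a<b (inj₂ b<v) = pos-resp (sym (side-at (p a) (p b) (p v))) (ccw a<b b<v)

    inside-pos : ∀ {a b v : Fin n} → a < v → v < b → Pos (side (p b) (p a) at p v)
    inside-pos {a} {b} {v} a<v v<b = pos-resp
      (trans (sym (orient-cyclic (p b) (p a) (p v))) (sym (side-at (p b) (p a) (p v)))) (ccw a<v v<b)

    side-left : ∀ a b → side a b at a ≈ 0#
    side-left a b = trans (side-at a b a) (orient-left a b)

    side-right : ∀ a b → side a b at b ≈ 0#
    side-right a b = trans (side-at a b b) (orient-right a b)

    opposite-side : ∀ a b x → opposite (side a b) at x ≈ side b a at x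
    opposite-side a b x = trans (opposite-at (side a b) x) (trans (-‿cong (side-at a b x))
      (trans (sym (orient-swap b a x)) (sym (side-at b a x))))

    -- Up to a rotation, which `orient` does not see, the three vertices come in increasing order.
    convexity : ∀ {t} {γ : Fin (3 ℕ.+ t) → Fin n} → Increasing γ → ∀ i j → j ≢ i → j ≢ next i →
      Pos (orient (p (γ i)) (p (γ (next i))) (p (γ j)))
    convexity {t} {γ} inc i j j≢i j≢ni = by (nextView i)
      where
      a b v : Point
      a = p (γ i)
      b = p (γ (next i))
      v = p (γ j)
      by : NextView i → Pos (orient a b v)
      by (step e) with ℕₚ.<-cmp (toℕ j) (toℕ i)
      ... | tri< j<i _ _ = pos-resp (orient-cyclic v a b) (ccw (inc j<i) (inc (ℕₚ.≤-reflexive (≡.sym e))))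
      ... | tri≈ _ j≡i _ = contradiction (Finₚ.toℕ-injective j≡i) j≢i
      ... | tri> _ _ i<j = ccw (inc (ℕₚ.≤-reflexive (≡.sym e)))
            (inc (ℕₚ.≤∧≢⇒< (≡.subst (ℕ._≤ toℕ j) (≡.sym e) i<j) (j≢ni ∘ ≡.sym ∘ Finₚ.toℕ-injective)))
      by (wrap i≡ ni≡0) = pos-resp (sym (orient-cyclic a b v)) (ccw
        (inc (ℕₚ.≤∧≢⇒< (≡.subst (ℕ._≤ toℕ j) (≡.cong toℕ (≡.sym ni≡0)) z≤n) (j≢ni ∘ ≡.sym ∘ Finₚ.toℕ-injective)))
        (inc (ℕₚ.≤∧≢⇒< (≡.subst (toℕ j ℕ.≤_) (≡.sym i≡) (Finₚ.toℕ≤pred[n] j)) (j≢i ∘ Finₚ.toℕ-injective))))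

    segment-null : ∀ ℓ {a b x} → ℓ at a ≈ 0# → ℓ at b ≈ 0# → Segment a b x → ℓ at x ≈ 0#
    segment-null ℓ a≈0 b≈0 seg@(t , _) = trans (at-segment ℓ seg) (trans
      (+-cong (*-congˡ a≈0) (*-congˡ b≈0)) (solve 1 (λ t → (:1 :- t) :* :0 :+ t :* :0 := :0) refl t))

    vertex-on-line : ∀ {a b v : Fin n} → a < b → side (p a) (p b) at p v ≈ 0# → v ≡ a ⊎ v ≡ b
    vertex-on-line {a} {b} {v} a<b isNull with Finₚ.<-cmp v a | Finₚ.<-cmp v b
    ... | tri< v<a _ _ | _            = contradiction isNull (pos-≢0 (outside-pos a<b (inj₁ v<a)))
    ... | tri≈ _ v≡a _ | _            = inj₁ v≡a
    ... | _            | tri≈ _ v≡b _ = inj₂ v≡b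
    ... | _            | tri> _ _ b<v = contradiction isNull (pos-≢0 (outside-pos a<b (inj₂ b<v)))
    ... | tri> _ _ a<v | tri< v<b _ _ = contradiction
      (trans (sym (opposite-side (p a) (p b) (p v))) (trans (opposite-at (side (p a) (p b)) (p v))
        (trans (-‿cong isNull) (solve 0 (:- :0 := :0) refl))))
      (pos-≢0 (inside-pos a<v v<b))

    vertex-on-segment : ∀ {a b v : Fin n} → a ≢ b → Segment (p a) (p b) (p v) → v ≡ a ⊎ v ≡ b
    vertex-on-segment {a} {b} a≢b seg with Finₚ.<-cmp a b
    ... | tri< a<b _ _ = vertex-on-line a<b (segment-null (side (p a) (p b)) (side-left _ _) (side-right _ _) seg)
    ... | tri≈ _ a≡b _ = contradiction a≡b a≢b
    ... | tri> _ _ b<a = swap (vertex-on-line b<a (segment-null (side (p b) (p a)) (side-right _ _) (side-left _ _) seg))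

    -- The line tv has w and u strictly on opposite sides, so it meets the segment wu. The meeting
    -- point stays between t and v because it is on the inner side of the lines vw and wt.
    crossing-point : ∀ {t u v w : Fin n} → t < u → u < v → v < w →
      ∃ λ x → Segment (p t) (p v) x × Segment (p u) (p w) x
    crossing-point {t} {u} {v} {w} t<u u<v v<w = meet (crossing tv
        (outside-pos t<v (inj₂ v<w))
        (pos-resp (trans (sym (opposite-side (p t) (p v) (p u))) (opposite-at tv (p u))) (inside-pos t<u u<v)))
      where
      t<v : t < v
      t<v = ℕₚ.<-trans t<u u<v
      u<w : u < w
      u<w = ℕₚ.<-trans u<v v<w
      tv : Line
      tv = side (p t) (p v)
      meet : (∃ λ x → Segment (p w) (p u) x × tv at x ≈ 0#) → ∃ λ x → Segment (p t) (p v) x × Segment (p u) (p w) x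
      meet (x , seg , x≈0) = x ,
        on-line {d = p w} (ccw t<v v<w) (trans (sym (side-at (p t) (p v) x)) x≈0)
          (nonNeg-resp (trans (side-at (p v) (p w) x) (sym (orient-cyclic x (p v) (p w))))
            (segment-nonNeg (side (p v) (p w)) (≈⇒nonNeg (side-right _ _)) (<⇒≤ (outside-pos v<w (inj₁ u<v))) seg))
          (nonNeg-resp (trans (side-at (p w) (p t) x) (orient-cyclic (p w) (p t) x))
            (segment-nonNeg (side (p w) (p t)) (≈⇒nonNeg (side-left _ _)) (<⇒≤ (inside-pos t<u u<w)) seg)) ,
        segment-sym seg

    plane⇒noncrossing : ∀ {G} → IsPlane p G → NonCrossing G
    plane⇒noncrossing plane {t} {u} {v} {w} t<u u<v v<w e e′ =
      let x , seg , seg′ = crossing-point t<u u<v v<w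
          y , on , on′ , _ = plane e e′ different x seg seg′
      in disjoint on on′
      where
      different : ¬ ((t ≡ u × v ≡ w) ⊎ (t ≡ w × v ≡ u))
      different (inj₁ (≡.refl , _)) = ℕₚ.<-irrefl ≡.refl t<u
      different (inj₂ (_ , ≡.refl)) = ℕₚ.<-irrefl ≡.refl u<v
      disjoint : ∀ {y} → y ≡ t ⊎ y ≡ v → y ≡ u ⊎ y ≡ w → _
      disjoint (inj₁ ≡.refl) (inj₁ ≡.refl) = ℕₚ.<-irrefl ≡.refl t<u
      disjoint (inj₁ ≡.refl) (inj₂ ≡.refl) = ℕₚ.<-irrefl ≡.refl (ℕₚ.<-trans t<u (ℕₚ.<-trans u<v v<w))
      disjoint (inj₂ ≡.refl) (inj₁ ≡.refl) = ℕₚ.<-irrefl ≡.refl u<v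
      disjoint (inj₂ ≡.refl) (inj₂ ≡.refl) = ℕₚ.<-irrefl ≡.refl v<w

    -- The value at x is (1 - t) times a positive number plus a nonnegative one, so it vanishes only
    -- if t = 1.
    touch : ∀ ℓ {a b x} → ℓ at x ≈ 0# → Pos (ℓ at a) → NonNeg (ℓ at b) → Segment a b x → x ≈ᴾ b
    touch ℓ {a₁ , a₂} {b₁ , b₂} x≈0 0<a 0≤b seg@(t , 0≤t , t≤1 , e₁ , e₂) =
      trans e₁ (end a₁ b₁) , trans e₂ (end a₂ b₂)
      where
      A : Carrier
      A = ℓ at (a₁ , a₂)
      1-t≈0 : 1# - t ≈ 0#
      1-t≈0 with nonNeg-split (≤⇒nonNeg t≤1)
      ... | inj₂ eq    = eq
      ... | inj₁ 0<1-t = contradiction (trans (sym (at-segment ℓ seg)) x≈0)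
            (pos-≢0 (pos-+-nonNeg (*-pos 0<1-t 0<a) (nonNeg-* 0≤t 0≤b)))
      end : ∀ a b → (1# - t) * a + t * b ≈ b
      end a b = trans (solve 3 (λ t a b → (:1 :- t) :* a :+ t :* b := (:1 :- t) :* (a :- b) :+ b) refl t a b)
        (trans (+-congʳ (*-congʳ 1-t≈0)) (solve 2 (λ a b → :0 :* (a :- b) :+ b := b) refl a b))

    SharedEnd : (a b a′ b′ : Fin n) → Point → Set _
    SharedEnd a b a′ b′ x = ∃ λ w → (w ≡ a ⊎ w ≡ b) × (w ≡ a′ ⊎ w ≡ b′) × x ≈ᴾ p w

    touching : ∀ ℓ {a b a′ b′ x} → (∀ {v} → ℓ at p v ≈ 0# → v ≡ a ⊎ v ≡ b) → ℓ at x ≈ 0# →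
      NonNeg (ℓ at p a′) → NonNeg (ℓ at p b′) → Segment (p a′) (p b′) x →
      ¬ ((a′ ≡ a ⊎ a′ ≡ b) × (b′ ≡ a ⊎ b′ ≡ b)) → SharedEnd a b a′ b′ x
    touching ℓ {a} {b} {a′} {b′} {x} isNull x≈0 0≤a′ 0≤b′ seg different with nonNeg-split 0≤a′ | nonNeg-split 0≤b′
    ... | inj₂ a′≈0 | inj₂ b′≈0 = contradiction (isNull a′≈0 , isNull b′≈0) different
    ... | inj₁ 0<a′ | _         =
          let x≈b′ = touch ℓ x≈0 0<a′ 0≤b′ seg
          in b′ , isNull (trans (sym (at-cong ℓ x≈b′)) x≈0) , inj₂ ≡.refl , x≈b′
    ... | inj₂ _    | inj₁ 0<b′ =
          let x≈a′ = touch ℓ x≈0 0<b′ 0≤a′ (segment-sym seg)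
          in a′ , isNull (trans (sym (at-cong ℓ x≈a′)) x≈0) , inj₁ ≡.refl , x≈a′

    outside-nonNeg : ∀ {a b v : Fin n} → a < b → v ≤ a ⊎ b ≤ v → NonNeg (side (p a) (p b) at p v)
    outside-nonNeg {a} {b} a<b (inj₁ v≤a) with ℕₚ.m≤n⇒m<n∨m≡n v≤a
    ... | inj₁ v<a = <⇒≤ (outside-pos a<b (inj₁ v<a))
    ... | inj₂ v≡a = ≈⇒nonNeg (trans (reflexive (≡.cong (λ v → side (p a) (p b) at p v) (Finₚ.toℕ-injective v≡a))) (side-left _ _))
    outside-nonNeg {a} {b} a<b (inj₂ b≤v) with ℕₚ.m≤n⇒m<n∨m≡n b≤v
    ... | inj₁ b<v = <⇒≤ (outside-pos a<b (inj₂ b<v))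
    ... | inj₂ b≡v = ≈⇒nonNeg (trans (reflexive (≡.cong (λ v → side (p a) (p b) at p v) (Finₚ.toℕ-injective (≡.sym b≡v)))) (side-right _ _))

    inside-nonNeg : ∀ {a b v : Fin n} → a ≤ v → v ≤ b → NonNeg (side (p b) (p a) at p v)
    inside-nonNeg {a} {b} a≤v v≤b with ℕₚ.m≤n⇒m<n∨m≡n a≤v | ℕₚ.m≤n⇒m<n∨m≡n v≤b
    ... | inj₁ a<v | inj₁ v<b = <⇒≤ (inside-pos a<v v<b)
    ... | inj₂ a≡v | _        = ≈⇒nonNeg (trans (reflexive (≡.cong (λ v → side (p b) (p a) at p v) (Finₚ.toℕ-injective (≡.sym a≡v)))) (side-right _ _))
    ... | inj₁ _   | inj₂ v≡b = ≈⇒nonNeg (trans (reflexive (≡.cong (λ v → side (p b) (p a) at p v) (Finₚ.toℕ-injective v≡b))) (side-left _ _))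

    side-null : ∀ {a b x} → side a b at x ≈ 0# → side b a at x ≈ 0#
    side-null {a} {b} {x} eq = trans (sym (opposite-side a b x)) (trans (opposite-at (side a b) x)
      (trans (-‿cong eq) (solve 0 (:- :0 := :0) refl)))

    OneSide : (a b a′ b′ : Fin n) → Set
    OneSide a b a′ b′ =
      ((a′ ≤ a ⊎ b ≤ a′) × (b′ ≤ a ⊎ b ≤ b′)) ⊎ ((a ≤ a′ × a′ ≤ b) × (a ≤ b′ × b′ ≤ b))

    -- The second segment lies weakly on one side of the line ab and so reaches it only at an end,
    -- unless both its ends are on the line. No vertices but a and b are on that line, so the second
    -- case would make the edges equal.
    oneSide-touching : ∀ {a b a′ b′ x} → a < b → OneSide a b a′ b′ →
      ¬ ((a′ ≡ a ⊎ a′ ≡ b) × (b′ ≡ a ⊎ b′ ≡ b)) →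
      Segment (p a) (p b) x → Segment (p a′) (p b′) x → SharedEnd a b a′ b′ x
    oneSide-touching {a} {b} a<b (inj₁ (out , out′)) different seg seg′ =
      touching (side (p a) (p b)) (vertex-on-line a<b)
        (segment-null (side (p a) (p b)) (side-left _ _) (side-right _ _) seg)
        (outside-nonNeg a<b out) (outside-nonNeg a<b out′) seg′ different
    oneSide-touching {a} {b} a<b (inj₂ ((l , r) , (l′ , r′))) different seg seg′ =
      touching (side (p b) (p a)) (λ isNull → vertex-on-line a<b (side-null isNull))
        (segment-null (side (p b) (p a)) (side-right _ _) (side-left _ _) seg)
        (inside-nonNeg l r) (inside-nonNeg l′ r′) seg′ different

    -- The walls of the square of half-width M as affine functions, so that `interior-pos` carries a
    -- bound from the vertices of a polygon to its interior.
    west east south north : Carrier → Line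
    west  M = 1# , 0# , M
    east  M = - 1# , 0# , M
    south M = 0# , 1# , M
    north M = 0# , - 1# , M

    InBox : Carrier → Pred Point _
    InBox M x = Pos (west M at x) × Pos (east M at x) × Pos (south M at x) × Pos (north M at x)

    inBox⇒near : ∀ M x → InBox M x → Near M (0# , 0#) x
    inBox⇒near M (x , y) (w , e , s , n) =
      pos⇒near (pos-resp (solve 3 (λ M x y → (:- :1) :* x :+ :0 :* y :+ M := M :- (x :- :0)) refl M x y) e)
               (pos-resp (solve 3 (λ M x y → :1 :* x :+ :0 :* y :+ M := M :+ (x :- :0)) refl M x y) w) ,
      pos⇒near (pos-resp (solve 3 (λ M x y → :0 :* x :+ (:- :1) :* y :+ M := M :- (y :- :0)) refl M x y) n)
               (pos-resp (solve 3 (λ M x y → :0 :* x :+ :1 :* y :+ M := M :+ (y :- :0)) refl M x y) s)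

    enclose : ∀ {m} (q : Fin m → Point) → ∃ λ M → ∀ i → InBox M (q i)
    enclose q = let M , bound = upper-bound size in M , λ i → inside M (q i) (<⇒pos (bound i))
      where
      bound₁ bound₂ : Point → Carrier
      bound₁ (x , y) = proj₁ (abs-bound x)
      bound₂ (x , y) = proj₁ (abs-bound y)
      size : _ → Carrier
      size i = bound₁ (q i) + bound₂ (q i)
      inside : ∀ M x → Pos (M - (bound₁ x + bound₂ x)) → InBox M x
      inside M (x , y) r =
        let A , 0<A , A-x , A+x = abs-bound x
            B , 0<B , B-y , B+y = abs-bound y
        in pos-resp (solve 5 (λ A B M x y → (A :+ x) :+ B :+ (M :- (A :+ B)) := :1 :* x :+ :0 :* y :+ M) refl A B M x y) (pos-+ (pos-+ A+x 0<B) r) ,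
           pos-resp (solve 5 (λ A B M x y → (A :- x) :+ B :+ (M :- (A :+ B)) := (:- :1) :* x :+ :0 :* y :+ M) refl A B M x y) (pos-+ (pos-+ A-x 0<B) r) ,
           pos-resp (solve 5 (λ A B M x y → (B :+ y) :+ A :+ (M :- (A :+ B)) := :0 :* x :+ :1 :* y :+ M) refl A B M x y) (pos-+ (pos-+ B+y 0<A) r) ,
           pos-resp (solve 5 (λ A B M x y → (B :- y) :+ A :+ (M :- (A :+ B)) := :0 :* x :+ (:- :1) :* y :+ M) refl A B M x y) (pos-+ (pos-+ B-y 0<A) r)

    -- Serves the cells of a forest as well as the polygons met by the parser, of which only these
    -- properties are known.
    module Cell (G : Graph n) {t} {γ : Fin (3 ℕ.+ t) → Fin n} (increasing : Increasing γ)
      (sides : ∀ i → Edge G (γ i) (γ (next i)))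
      (separated : ∀ {u v} → Edge G u v → ∃ λ i →
        NonNeg (side (p (γ (next i))) (p (γ i)) at p u) × NonNeg (side (p (γ (next i))) (p (γ i)) at p v))
      (cycle : ∀ i → Edge G i (next i))
      where

      open Polygon F (p ∘ γ) (convexity increasing) public

      beyond : ∀ i {x} → NonNeg (side (p (γ (next i))) (p (γ i)) at x) → ¬ Pos (edge i at x)
      beyond i {x} 0≤x 0<x = ¬pos∧neg 0<x (nonNeg-resp
        (trans (sym (opposite-side (p (γ i)) (p (γ (next i))) x)) (opposite-at (edge i) x)) 0≤x)

      interior-off : ∀ {x} → Interior x → ¬ Drawing p G x
      interior-off {x} int (inj₁ (v , x≈v)) =
        -- Each vertex is an end of a hull edge, so `separated` covers the vertices too.
        let i , 0≤v , _ = separated (cycle v) in beyond i 0≤v (interior-resp x≈v int i)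
      interior-off int (inj₂ (u , v , e , seg)) =
        let i , 0≤u , 0≤v = separated e in beyond i (segment-nonNeg (side (p (γ (next i))) (p (γ i))) 0≤u 0≤v seg) (int i)

      boundary-drawn : ∀ {x} → OnBoundary x → Drawing p G x
      boundary-drawn (i , seg) = inj₂ (γ i , γ (next i) , sides i , seg)

      visible-interior : ∀ {x y} → Interior x → Visible p G x y → Interior y
      visible-interior {x} {y} int visible = by (exit y int)
        where
        by : Interior y ⊎ (∃ λ z → Segment x y z × OnBoundary z) → Interior y
        by (inj₁ int′)           = int′
        by (inj₂ (z , seg , on)) = contradiction (boundary-drawn on) (visible z seg)

      face⇒interior : ∀ {x y} → Interior x → Face p G x y → Interior y
      face⇒interior int Star.ε               = int
      face⇒interior int (fwd visible ◅ path) = face⇒interior (visible-interior int visible) path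
      face⇒interior int (bwd visible ◅ path) =
        face⇒interior (visible-interior int (λ z seg → visible z (segment-sym seg))) path

      interior⇒face : ∀ {x y} → Interior x → Interior y → Face p G x y
      interior⇒face int int′ = fwd (λ z seg → interior-off (interior-segment int int′ seg)) ◅ Star.ε

      interior-bounded : ∀ {x} → Interior x → Bounded (Face p G x)
      interior-bounded int = let M , inside = enclose (p ∘ γ) in M , λ y face →
        let within = λ ℓ pos → interior-pos ℓ pos (face⇒interior int face)
        in inBox⇒near M y ( within (west M) (λ i → proj₁ (inside i)) , within (east M) (λ i → proj₁ (proj₂ (inside i)))
                          , within (south M) (λ i → proj₁ (proj₂ (proj₂ (inside i)))) , within (north M) (λ i → proj₂ (proj₂ (proj₂ (inside i)))))

      interior-internal : ∀ {x} → Interior x → IsInternal p G x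
      interior-internal int = interior-off int , interior-bounded int

      frontier-face : ∀ {x} → Interior x → ∀ y → Frontier (Face p G x) y ⇔ OnBoundary y
      frontier-face int = frontier⇔boundary (face⇒interior int) (interior⇒face int)

      interior-isGon : ∀ {x} → Interior x → IsGon p G (3 ℕ.+ t) (Face p G x)
      interior-isGon int = γ , increasing-injective increasing , sides , frontier-face int

      -- The frontier determines which vertices are on a bounding cycle, since a vertex on a segment
      -- between two vertices is one of its ends. So γ and the cycle given by the angulation have
      -- the same range, and both are injective.
      gon-size : ∀ {k} → IsAngulation p G k → 3 ℕ.+ t ≡ k
      gon-size {k} (_ , _ , faces) = size (faces centre (interior-internal centre-interior))
        where
        size : IsGon p G k (Face p G centre) → 3 ℕ.+ t ≡ k
        size (δ , δ-injective , δ-sides , δ-frontier) = ℕₚ.≤-antisym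
          (Finₚ.injective⇒≤ {f = proj₁ ∘ γ-in-δ} λ {i} {j} eq → increasing-injective increasing
            (≡.trans (≡.sym (proj₂ (γ-in-δ i))) (≡.trans (≡.cong δ eq) (proj₂ (γ-in-δ j)))))
          (Finₚ.injective⇒≤ {f = proj₁ ∘ δ-in-γ} λ {i} {j} eq → δ-injective
            (≡.trans (≡.sym (proj₂ (δ-in-γ i))) (≡.trans (≡.cong γ eq) (proj₂ (δ-in-γ j)))))
          where
          end : ∀ {m} (ε : Fin m → Fin n) → (∀ i → Edge G (ε i) (ε (next i))) → ∀ {v} →
            (∃ λ i → Segment (p (ε i)) (p (ε (next i))) (p v)) → ∃ λ i → ε i ≡ v
          end ε ε-sides (i , seg) with vertex-on-segment (edge-≢ G (ε-sides i)) seg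
          ... | inj₁ v≡ = i , ≡.sym v≡
          ... | inj₂ v≡ = next i , ≡.sym v≡
          γ-in-δ : ∀ j → ∃ λ i → δ i ≡ γ j
          γ-in-δ j = end δ δ-sides (Equivalence.to (δ-frontier (p (γ j)))
            (Equivalence.from (frontier-face centre-interior (p (γ j))) (j , segment-left _ _)))
          δ-in-γ : ∀ i → ∃ λ j → γ j ≡ δ i
          δ-in-γ i = end γ sides (Equivalence.to (frontier-face centre-interior (p (δ i)))
            (Equivalence.from (δ-frontier (p (δ i))) (i , segment-left _ _)))

  -- From labels in ℕ to vertices.

  module Labels (N : ℕ) where

    -- Total on ℕ, so that chords can be placed without carrying bounds; it preserves the value of
    -- labels up to N.
    ι : ℕ → Fin (suc N)
    ι v = v mod suc N

    toℕ-ι : ∀ {v} → v ℕ.≤ N → toℕ (ι v) ≡ v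
    toℕ-ι v≤N = ≡.trans (Finₚ.toℕ-fromℕ< _) (m<n⇒m%n≡m (s≤s v≤N))

    ι-toℕ : ∀ u → ι (toℕ u) ≡ u
    ι-toℕ u = Finₚ.toℕ-injective (toℕ-ι (Finₚ.toℕ≤pred[n] u))

    ι-< : ∀ {u v} → u ℕ.< v → v ℕ.≤ N → ι u < ι v
    ι-< u<v v≤N = ≡.subst₂ ℕ._<_ (≡.sym (toℕ-ι (ℕₚ.≤-trans (ℕₚ.<⇒≤ u<v) v≤N))) (≡.sym (toℕ-ι v≤N)) u<v

    next-ι : ∀ {v} → v ℕ.< N → next (ι v) ≡ ι (suc v)
    next-ι {v} v<N with nextView (ι v)
    ... | step eq   = Finₚ.toℕ-injective (≡.trans eq (≡.trans (≡.cong suc (toℕ-ι (ℕₚ.<⇒≤ v<N))) (≡.sym (toℕ-ι v<N))))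
    ... | wrap v≡ _ = contradiction (≡.trans (≡.sym (toℕ-ι (ℕₚ.<⇒≤ v<N))) v≡) (ℕₚ.<⇒≢ v<N)

    ι-first : ι 0 ≡ zero
    ι-first = Finₚ.toℕ-injective (toℕ-ι z≤n)

    ι-last : ι N ≡ fromℕ N
    ι-last = Finₚ.toℕ-injective (≡.trans (toℕ-ι ℕₚ.≤-refl) (≡.sym (Finₚ.toℕ-fromℕ N)))

    -- The sequence is reversed: `c` decreases like a stack, whereas polygons are listed
    -- counter-clockwise.
    vertex : ∀ t → (ℕ → ℕ) → Fin (3 ℕ.+ t) → Fin (suc N)
    vertex t c i = ι (c (2 ℕ.+ t ∸ toℕ i))

    data SideView t (c : ℕ → ℕ) (i : Fin (3 ℕ.+ t)) : Set where
      gap  : ∀ j → j ℕ.< 2 ℕ.+ t → vertex t c i ≡ ι (c (suc j)) → vertex t c (next i) ≡ ι (c j) → SideView t c i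
      base : vertex t c i ≡ ι (c 0) → vertex t c (next i) ≡ ι (c (2 ℕ.+ t)) → SideView t c i

    sideView : ∀ t c i → SideView t c i
    sideView t c i with nextView i
    ... | step eq = gap (2 ℕ.+ t ∸ suc (toℕ i)) (s≤s (ℕₚ.m∸n≤m (suc t) (toℕ i)))
          (≡.cong (ι ∘ c) (ℕₚ.+-∸-assoc 1 (ℕₚ.≤-pred (≡.subst (ℕ._< 3 ℕ.+ t) eq (Finₚ.toℕ<n (next i))))))
          (≡.cong (λ v → ι (c (2 ℕ.+ t ∸ v))) eq)
    ... | wrap i≡ ni≡0 = base
          (≡.cong (ι ∘ c) (≡.trans (≡.cong (2 ℕ.+ t ∸_) i≡) (ℕₚ.n∸n≡0 (2 ℕ.+ t))))
          (≡.cong (λ j → ι (c (2 ℕ.+ t ∸ toℕ j))) ni≡0)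

    gap-index : ∀ t c {j} → j ℕ.< 2 ℕ.+ t → ∃ λ i → vertex t c i ≡ ι (c (suc j)) × vertex t c (next i) ≡ ι (c j)
    gap-index t c {j} j<s = inject₁ i ,
      ≡.cong (ι ∘ c) (≡.trans (≡.cong (2 ℕ.+ t ∸_) (≡.trans (Finₚ.toℕ-inject₁ i) i≡)) (ℕₚ.m∸[m∸n]≡n j<s)) ,
      ≡.cong (ι ∘ c) (≡.trans (≡.cong (2 ℕ.+ t ∸_) (≡.trans (≡.cong toℕ (next-inject₁ i)) (≡.trans (≡.cong suc i≡) i+1)))
        (ℕₚ.m∸[m∸n]≡n (ℕₚ.<⇒≤ j<s)))
      where
      i : Fin (2 ℕ.+ t)
      i = fromℕ< {2 ℕ.+ t ∸ suc j} (s≤s (ℕₚ.m∸n≤m (suc t) j))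
      i≡ : toℕ i ≡ 2 ℕ.+ t ∸ suc j
      i≡ = Finₚ.toℕ-fromℕ< _
      i+1 : suc (2 ℕ.+ t ∸ suc j) ≡ 2 ℕ.+ t ∸ j
      i+1 = ≡.sym (ℕₚ.+-∸-assoc 1 (ℕₚ.≤-pred j<s))

    base-index : ∀ t c → ∃ λ i → vertex t c i ≡ ι (c 0) × vertex t c (next i) ≡ ι (c (2 ℕ.+ t))
    base-index t c = fromℕ (2 ℕ.+ t) ,
      ≡.cong (ι ∘ c) (≡.trans (≡.cong (2 ℕ.+ t ∸_) (Finₚ.toℕ-fromℕ (2 ℕ.+ t))) (ℕₚ.n∸n≡0 (2 ℕ.+ t))) ,
      ≡.cong (λ j → ι (c (2 ℕ.+ t ∸ toℕ j))) (next-fromℕ (2 ℕ.+ t))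

    vertex-increasing : ∀ {t c} → Decreasing c (2 ℕ.+ t) → c 0 ℕ.≤ N → Increasing (vertex t c)
    vertex-increasing {t} {c} dec c₀≤N {i} {j} i<j = ι-<
      (decreasing-< dec (ℕₚ.∸-monoʳ-< i<j (Finₚ.toℕ≤pred[n] j)) (ℕₚ.m∸n≤m (2 ℕ.+ t) (toℕ i)))
      (ℕₚ.≤-trans (decreasing-≤ dec z≤n (ℕₚ.m∸n≤m (2 ℕ.+ t) (toℕ j))) c₀≤N)

    vertex-sides : ∀ (G : Graph (suc N)) {t c} → (∀ {j} → j ℕ.< 2 ℕ.+ t → Edge G (ι (c (suc j))) (ι (c j))) →
      Edge G (ι (c (2 ℕ.+ t))) (ι (c 0)) → ∀ i → Edge G (vertex t c i) (vertex t c (next i))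
    vertex-sides G {t} {c} gaps closing i with sideView t c i
    ... | gap j j<s l r = ≡.subst₂ (Edge G) (≡.sym l) (≡.sym r) (gaps j<s)
    ... | base l r      = ≡.subst₂ (Edge G) (≡.sym l) (≡.sym r) (symmetric G closing)

  module PlacedLabels {c ℓ₁ ℓ₂} (F : OrderedField c ℓ₁ ℓ₂) {s : ℕ} (p : Fin (3 ℕ.+ s) → Plane.Point F)
    (ccw : Plane.CounterClockwise F p) where

    open OrderedField F
      using (_≈_; 0#; -_; _-_; _*_; _+_; Carrier; commutativeRing; trans; sym; +-congˡ; +-cong; *-congʳ; -‿cong)
      renaming (refl to ≈-refl)
    open Plane F
    open IntegerSolver commutativeRing
    open OrderedFieldProperties F
    open Lines F
    open Positions F p ccw
    open Labels (2 ℕ.+ s)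

    -- Turns comparisons of labels into geometry: an arc of the hull lies weakly on the outer side
    -- of the chord that cuts it off. For the base side this is the arc that passes from the last
    -- point to the first.
    side-beyond : ∀ {t c} → Decreasing c (2 ℕ.+ t) → c 0 ℕ.≤ 2 ℕ.+ s → (σ : Side (2 ℕ.+ t)) →
      ∃ λ i → ∀ v → Beyond c σ (toℕ v) →
        NonNeg (side (p (vertex t c (next i))) (p (vertex t c i)) at p v)
    side-beyond {t} {c} dec c₀≤N (gap j j<s) = let i , l , r = gap-index t c j<s in i , λ v (c≤v , v≤c) →
      ≡.subst₂ (λ a b → NonNeg (side (p b) (p a) at p v)) (≡.sym l) (≡.sym r)
        (inside-nonNeg (≡.subst (ℕ._≤ toℕ v) (≡.sym (toℕ-ι (≤N j<s))) c≤v)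
                       (≡.subst (toℕ v ℕ.≤_) (≡.sym (toℕ-ι (≤N (ℕₚ.<⇒≤ j<s)))) v≤c))
      where
      ≤N : ∀ {j} → j ℕ.≤ 2 ℕ.+ t → c j ℕ.≤ 2 ℕ.+ s
      ≤N j≤s = ℕₚ.≤-trans (decreasing-≤ dec z≤n j≤s) c₀≤N
    side-beyond {t} {c} dec c₀≤N base = let i , l , r = base-index t c in i , λ v out →
      ≡.subst₂ (λ a b → NonNeg (side (p b) (p a) at p v)) (≡.sym l) (≡.sym r)
        (outside-nonNeg (ι-< (decreasing-< dec (s≤s z≤n) ℕₚ.≤-refl) c₀≤N) (placed v out))
      where
      placed : ∀ v → toℕ v ℕ.≤ c (2 ℕ.+ t) ⊎ c 0 ℕ.≤ toℕ v → v ≤ ι (c (2 ℕ.+ t)) ⊎ ι (c 0) ≤ v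
      placed v (inj₁ v≤) = inj₁ (≡.subst (toℕ v ℕ.≤_) (≡.sym (toℕ-ι (ℕₚ.≤-trans (decreasing-≤ dec z≤n ℕₚ.≤-refl) c₀≤N))) v≤)
      placed v (inj₂ ≤v) = inj₂ (≡.subst (ℕ._≤ toℕ v) (≡.sym (toℕ-ι c₀≤N)) ≤v)

    module Hull = Polygon F p (convexity {γ = id} id)

    -- The coordinate is moved in the direction in which a times it grows, until it leaves the
    -- interval of radius M around 0.
    escape : ∀ a x M → ¬ (a ≈ 0#) → ∃ λ y → NonNeg (a * (y - x)) × ¬ (Pos (M - (y - 0#)) × Pos (M + (y - 0#)))
    escape a x M a≢0 = by (sign a)
      where
      by : Sign a → ∃ λ y → NonNeg (a * (y - x)) × ¬ (Pos (M - (y - 0#)) × Pos (M + (y - 0#)))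
      by (null a≈0)     = contradiction a≈0 a≢0
      by (positive 0<a) = let z , x≤z , M≤z = max x M in
        z , nonNeg-* (<⇒≤ 0<a) (≤⇒nonNeg x≤z) , λ (q , _) → ¬pos∧neg q
          (nonNeg-resp (solve 2 (λ M z → z :- M := :- (M :- (z :- :0))) ≈-refl M z) (≤⇒nonNeg M≤z))
      by (negative a<0) = let z , -x≤z , M≤z = max (- x) M in
        - z , nonNeg-resp (solve 3 (λ a x z → (:- a) :* (z :- (:- x)) := a :* ((:- z) :- x)) ≈-refl a x z)
                (nonNeg-* (<⇒≤ a<0) (≤⇒nonNeg -x≤z)) ,
        λ (_ , q) → ¬pos∧neg q
          (nonNeg-resp (solve 2 (λ M z → z :- M := :- (M :+ ((:- z) :- :0))) ≈-refl M z) (≤⇒nonNeg M≤z))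

    -- Points outside the hull.

    module Exterior (G : Graph n) where

      drawing-in-hull : ∀ i {x} → Drawing p G x → NonNeg (Hull.edge i at x)
      drawing-in-hull i (inj₁ (v , x≈v)) = nonNeg-resp (sym (at-cong (Hull.edge i) x≈v)) (Hull.edge-vertex i v)
      drawing-in-hull i (inj₂ (u , v , _ , seg)) =
        segment-nonNeg (Hull.edge i) (Hull.edge-vertex i u) (Hull.edge-vertex i v) seg

      exterior-face : ∀ i {x y} → Pos (opposite (Hull.edge i) at x) → Pos (opposite (Hull.edge i) at y) → Face p G x y
      exterior-face i ext ext′ = fwd (λ z seg drawn → ¬pos∧neg (segment-pos (opposite (Hull.edge i)) ext ext′ seg)
        (nonNeg-resp (trans (solve 1 (λ x → x := :- (:- x)) ≈-refl _) (-‿cong (sym (opposite-at (Hull.edge i) z))))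
          (drawing-in-hull i drawn))) ◅ Star.ε

      move-pos : ∀ α β γ {x₁ x₂ y₁ y₂} → Pos ((α , β , γ) at (x₁ , x₂)) →
        NonNeg (α * (y₁ - x₁) + β * (y₂ - x₂)) → Pos ((α , β , γ) at (y₁ , y₂))
      move-pos α β γ {x₁} {x₂} {y₁} {y₂} 0<x 0≤δ = pos-resp
        (trans (+-congˡ (at-difference α β γ x₁ x₂ y₁ y₂))
          (solve 2 (λ v w → v :+ (w :- v) := w) ≈-refl ((α , β , γ) at (x₁ , x₂)) ((α , β , γ) at (y₁ , y₂))))
        (pos-+-nonNeg 0<x 0≤δ)

      -- The open half-plane beyond a hull edge belongs to one face; moving parallel to an axis on
      -- which its function depends, one stays in it and leaves any square.
      exterior-unbounded : ∀ i {x} → Pos (opposite (Hull.edge i) at x) → ¬ Bounded (Face p G x)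
      exterior-unbounded i {x₁ , x₂} ext (M , bounded) = by (sign α) (sign β)
        where
        α β γ : Carrier
        α = proj₁ (opposite (Hull.edge i))
        β = proj₁ (proj₂ (opposite (Hull.edge i)))
        γ = proj₂ (proj₂ (opposite (Hull.edge i)))
        along₁ : ¬ (α ≈ 0#) → _
        along₁ α≢0 = let y , 0≤ , far = escape α x₁ M α≢0 in
          far (near⇒pos (proj₁ (bounded (y , x₂) (exterior-face i ext (move-pos α β γ ext
            (nonNeg-resp (solve 3 (λ u β x → u := u :+ β :* (x :- x)) ≈-refl (α * (y - x₁)) β x₂) 0≤))))))
        along₂ : ¬ (β ≈ 0#) → _
        along₂ β≢0 = let y , 0≤ , far = escape β x₂ M β≢0 in
          far (near⇒pos (proj₂ (bounded (x₁ , y) (exterior-face i ext (move-pos α β γ ext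
            (nonNeg-resp (solve 3 (λ u α x → u := α :* (x :- x) :+ u) ≈-refl (β * (y - x₂)) α x₁) 0≤))))))
        by : Sign α → Sign β → _
        by (positive 0<α) _ = along₁ (pos-≢0 0<α)
        by (negative α<0) _ = along₁ λ α≈0 → pos-≢0 α<0 (trans (-‿cong α≈0) (solve 0 (:- :0 := :0) ≈-refl))
        by (null _) (positive 0<β) = along₂ (pos-≢0 0<β)
        by (null _) (negative β<0) = along₂ λ β≈0 → pos-≢0 β<0 (trans (-‿cong β≈0) (solve 0 (:- :0 := :0) ≈-refl))
        -- A constant function would be positive at x and hence at the vertex `p i`, where its value
        -- is at most 0.
        by (null α≈0) (null β≈0) = ¬pos∧neg (move-pos α β γ ext (≈⇒nonNeg constant))
          (nonNeg-resp (trans (solve 1 (λ x → x := :- (:- x)) ≈-refl _) (-‿cong (sym (opposite-at (Hull.edge i) (p i)))))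
            (Hull.edge-vertex i i))
          where
          constant : α * (proj₁ (p i) - x₁) + β * (proj₂ (p i) - x₂) ≈ 0#
          constant = trans (+-cong (*-congʳ α≈0) (*-congʳ β≈0))
            (solve 2 (λ u v → :0 :* u :+ :0 :* v := :0) ≈-refl (proj₁ (p i) - x₁) (proj₂ (p i) - x₂))

  -- The graph of a forest.

  module PathGraph (e N : ℕ) where

    open Paths e
    open PathInjectivity e
    open Counting e
    open Labels N

    Adjacent : ∀ {m q} → Path m q → Fin (suc N) → Fin (suc N) → Set
    Adjacent P u v = Chord P (toℕ u) (toℕ v) ⊎ Chord P (toℕ v) (toℕ u)

    adjacent? : ∀ {m q} (P : Path m q) u v → Dec (Adjacent P u v)
    adjacent? P u v = chord? P (toℕ u) (toℕ v) ⊎-dec chord? P (toℕ v) (toℕ u)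

    pathGraph : ∀ {m q} → Path m q → Graph (suc N)
    pathGraph P = graphOf (adjacent? P) swap λ { (inj₁ c) → ℕₚ.<-irrefl ≡.refl (chord-< P c)
                                               ; (inj₂ c) → ℕₚ.<-irrefl ≡.refl (chord-< P c) }

    adjacent⇒edge : ∀ {m q} (P : Path m q) {u v} → Adjacent P u v → Edge (pathGraph P) u v
    adjacent⇒edge P {u} = ∈-tabulate⁺ (adjacent? P u)

    edge⇒adjacent : ∀ {m q} (P : Path m q) {u v} → Edge (pathGraph P) u v → Adjacent P u v
    edge⇒adjacent P {u} = ∈-tabulate⁻ (adjacent? P u)

    chord⇒edge : ∀ {m q} (P : Path m q) {u v} → v ℕ.≤ N → Chord P u v → Edge (pathGraph P) (ι u) (ι v)
    chord⇒edge P {u} {v} v≤N c = adjacent⇒edge P (inj₁ (≡.subst₂ (Chord P)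
      (≡.sym (toℕ-ι (ℕₚ.≤-trans (ℕₚ.<⇒≤ (chord-< P c)) v≤N))) (≡.sym (toℕ-ι v≤N)) c))

    edge⇒chord : ∀ {m q} (P : Path m q) {u v} → u < v → Edge (pathGraph P) u v → Chord P (toℕ u) (toℕ v)
    edge⇒chord P u<v edge with edge⇒adjacent P edge
    ... | inj₁ c = c
    ... | inj₂ c = contradiction (chord-< P c) (ℕₚ.<-asym u<v)

    -- After the last leaf only its hull edge ends at the top; each later node adds one chord there,
    -- with a new start since it begins below the last tree. So a spine of j nodes gives j + 1
    -- edges.
    top-degree : ∀ {m q} (P : Path m q) → 0 ℕ.< m → top P ℕ.≤ N → (S : Subset (suc N)) →
      (∀ {u} → u ∈ S → Chord P (toℕ u) (top P)) → (∀ {u} → Chord P (toℕ u) (top P) → u ∈ S) →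
      ∣ S ∣ ≡ suc (spine P)
    top-degree (leaf P) _ t<N S S⇒ ⇒S = ≡.trans
      (∣insert∣ ⊥ S (ι (top P)) Subsetₚ.∉⊥ (⇒S (inj₁ (toℕ-ι (ℕₚ.<⇒≤ t<N) , ≡.refl)))
        (λ y∈⊥ → contradiction y∈⊥ Subsetₚ.∉⊥) (λ y≢ y∈S → contradiction (S⇒ y∈S) (only y≢)))
      (≡.cong suc (Subsetₚ.∣⊥∣≡0 (suc N)))
      where
      only : ∀ {y} → y ≢ ι (top P) → ¬ Chord (leaf P) (toℕ y) (suc (top P))
      only y≢ (inj₁ (y≡ , _)) = y≢ (Finₚ.toℕ-injective (≡.trans y≡ (≡.sym (toℕ-ι (ℕₚ.<⇒≤ t<N)))))
      only y≢ (inj₂ c)        = ℕₚ.<-irrefl ≡.refl (chord-≤top P c)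
    top-degree (node {m} P) _ t≤N S S⇒ ⇒S = ≡.trans
      (∣insert∣ S₀ S (ι (stack P d)) new
        (⇒S (inj₁ (toℕ-d , ≡.refl))) (λ y∈ → ⇒S (inj₂ (∈-tabulate⁻ chords? y∈))) (λ y≢ y∈ → old y≢ (S⇒ y∈)))
      (≡.cong suc (top-degree P (ℕₚ.≤-trans (s≤s z≤n) (ℕₚ.m≤n+m d m)) t≤N S₀ (∈-tabulate⁻ chords?) (∈-tabulate⁺ chords?)))
      where
      chords? : ∀ u → Dec (Chord P (toℕ u) (top P))
      chords? u = chord? P (toℕ u) (top P)
      S₀ : Subset (suc N)
      S₀ = tabulate (λ u → does (chords? u))
      toℕ-d : toℕ (ι (stack P d)) ≡ stack P d
      toℕ-d = toℕ-ι (ℕₚ.≤-trans (decreasing-≤ (stack-decreasing P) z≤n (ℕₚ.m≤n+m d m)) t≤N)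
      new : ι (stack P d) ∉ S₀
      new ∈S₀ = ℕₚ.<⇒≱ (stack-1-d {m} P) (≡.subst (stack P 1 ℕ.≤_) toℕ-d (chord-top P (∈-tabulate⁻ chords? ∈S₀)))
      old : ∀ {y} → y ≢ ι (stack P d) → Chord (node {m} P) (toℕ y) (top P) → y ∈ S₀
      old y≢ (inj₁ (y≡ , _)) = contradiction (Finₚ.toℕ-injective (≡.trans y≡ (≡.sym toℕ-d))) y≢
      old y≢ (inj₂ c)        = ∈-tabulate⁺ chords? c

    root-degree : ∀ {m q} (P : Path m q) → 0 ℕ.< m → top P ≡ N → ∣ neighbours (pathGraph P) (root N) ∣ ≡ suc (spine P)
    root-degree P 0<m top≡ = top-degree P 0<m (ℕₚ.≤-reflexive top≡) (neighbours (pathGraph P) (root N))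
      (λ u∈ → to-top (edge⇒adjacent P u∈)) (λ c → adjacent⇒edge P (inj₂ (≡.subst (Chord P _) (≡.sym root≡) c)))
      where
      root≡ : toℕ (root N) ≡ top P
      root≡ = ≡.trans (Finₚ.toℕ-fromℕ N) (≡.sym top≡)
      to-top : ∀ {u} → Adjacent P (root N) u → Chord P (toℕ u) (top P)
      to-top (inj₂ c) = ≡.subst (Chord P _) root≡ c
      to-top {u} (inj₁ c) = contradiction (chord-< P c)
        (ℕₚ.≤⇒≯ (≡.subst (toℕ u ℕ.≤_) (≡.sym (Finₚ.toℕ-fromℕ N)) (Finₚ.toℕ≤pred[n] u)))

    path-cycle : ∀ {q} (P : Path 1 q) → top P ≡ N → ∀ i → Edge (pathGraph P) i (next i)
    path-cycle P top≡ i with nextView i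
    ... | step eq = adjacent⇒edge P (inj₁ (≡.subst (Chord P (toℕ i)) (≡.sym eq)
            (hull-chord P (≡.subst (suc (toℕ i) ℕ.≤_) (≡.sym top≡) (≡.subst (ℕ._≤ N) eq (Finₚ.toℕ≤pred[n] (next i)))))))
    ... | wrap i≡ ni≡0 = adjacent⇒edge P (inj₂ (≡.subst₂ (Chord P)
            (≡.trans (stack-bottom P) (≡.cong toℕ (≡.sym ni≡0))) (≡.trans top≡ (≡.sym i≡)) (stack-chord P (s≤s z≤n))))

    sameChords⇒≡ : ∀ {m q} (P P′ : Path m q) → top P ≡ N →
      (∀ u → neighbours (pathGraph P) u ≡ neighbours (pathGraph P′) u) → P ≡ P′
    sameChords⇒≡ P P′ top≡ eq = path-unique P P′
      (transfer P P′ (ℕₚ.≤-reflexive top≡) λ {u} {v} → ≡.subst (v ∈_) (eq u))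
      (transfer P′ P (ℕₚ.≤-reflexive (≡.trans (top-unique P′ P) top≡)) λ {u} {v} → ≡.subst (v ∈_) (≡.sym (eq u)))
      where
      transfer : ∀ {m q} (P P′ : Path m q) → top P ℕ.≤ N →
        (∀ {u v} → Edge (pathGraph P) u v → Edge (pathGraph P′) u v) → P ⊑ P′
      transfer P P′ t≤N sub {u} {v} c = ≡.subst₂ (Chord P′) (toℕ-ι u≤N) (toℕ-ι v≤N)
        (edge⇒chord P′ (ι-< (chord-< P c) v≤N) (sub (chord⇒edge P v≤N c)))
        where
        v≤N : v ℕ.≤ N
        v≤N = ℕₚ.≤-trans (chord-≤top P c) t≤N
        u≤N : u ℕ.≤ N
        u≤N = ℕₚ.≤-trans (ℕₚ.<⇒≤ (chord-< P c)) v≤N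

  -- The faces of the graph of a forest.

  module PathFaces {c ℓ₁ ℓ₂} (F : OrderedField c ℓ₁ ℓ₂) {s : ℕ} (p : Fin (3 ℕ.+ s) → Plane.Point F)
    (ccw : Plane.CounterClockwise F p) (e : ℕ) where

    open OrderedField F using (_≈_; 0#; Carrier; trans; sym)
    open Plane F
    open OrderedFieldProperties F
    open Lines F
    open Positions F p ccw
    open Labels (2 ℕ.+ s)
    open PlacedLabels F p ccw
    open Paths e
    open PathGraph e (2 ℕ.+ s)

    N : ℕ
    N = 2 ℕ.+ s

    InCell : (ℕ → ℕ) → Point → Set _
    InCell c x = ∀ i → Pos (side (p (vertex e c i)) (p (vertex e c (next i))) at x)

    module CellPolygon {c} (dec : Decreasing c d) (c₀≤N : c 0 ℕ.≤ N) =
      Polygon F (p ∘ vertex e c) (convexity (vertex-increasing dec c₀≤N))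

    Left : ∀ {m q} → Path m q → ℕ → Point → Set _
    Left P i x = Pos (side (p (ι (stack P (suc i)))) (p (ι (stack P i))) at x)

    -- Invariant: x is in a cell or strictly on the far side of the chord over every tree, away from
    -- its leaves. At a node the sign of the new chord decides: x is still on the far side, or in
    -- the new cell, or on the chord itself.
    locate-cell : ∀ {m q x} (P : Path m q) → top P ℕ.≤ N → Hull.Interior x →
      (∀ {u v} → Chord P u v → ¬ Segment (p (ι u)) (p (ι v)) x) →
      (∃ λ j → InCell (cell P j) x) ⊎ (∀ {i} → i ℕ.< m → Left P i x)
    locate-cell []       _ _ _ = inj₂ λ ()
    locate-cell {x = x} (leaf P) t<N hull off = by (locate-cell P (ℕₚ.<⇒≤ t<N) hull (off ∘ inj₂))
      where
      by : (∃ λ j → InCell (cell P j) x) ⊎ (∀ {i} → i ℕ.< _ → Left P i x) → _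
      by (inj₁ found) = inj₁ found
      by (inj₂ toLeft)  = inj₂ λ { {zero} _ → ≡.subst (λ v → Pos (side (p (ι (top P))) (p v) at x)) (next-ι t<N) (hull (ι (top P)))
                               ; {suc i} (s≤s i<m) → toLeft i<m }
    locate-cell {suc m} {x = x} (node P) t≤N hull off = by (locate-cell P t≤N hull (off ∘ inj₂))
      where
      a b : Point
      a = p (ι (stack P d))
      b = p (ι (top P))
      d≤m : d ℕ.≤ m ℕ.+ d
      d≤m = ℕₚ.m≤n+m d m
      open CellPolygon {stack P} (cell-decreasing (node P) zero) t≤N
      module _ (toLeft : ∀ {i} → i ℕ.< m ℕ.+ d → Left P i x) where
        -- General in the sign condition: `Pos` for the open cell, `NonNeg` when x is on the line of
        -- the new chord.
        sides-of : ∀ {P : Carrier → Set ℓ₂} → (∀ {y} → Pos y → P y) → P (side b a at x) → ∀ i → P (edge i at x)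
        sides-of {Q} pos⇒ closing i with sideView e (stack P) i
        ... | gap j j<d l r = ≡.subst₂ (λ u v → Q (side (p u) (p v) at x)) (≡.sym l) (≡.sym r) (pos⇒ (toLeft (ℕₚ.<-≤-trans j<d d≤m)))
        ... | base l r      = ≡.subst₂ (λ u v → Q (side (p u) (p v) at x)) (≡.sym l) (≡.sym r) closing
        decide : Sign (side a b at x) → (∃ λ j → InCell (cell (node P) j) x) ⊎ (∀ {i} → i ℕ.< suc m → Left (node P) i x)
        decide (positive 0<ab) = inj₂ λ { {zero} _ → 0<ab ; {suc i} (s≤s i<m) → toLeft (ℕₚ.+-monoˡ-≤ d i<m) }
        decide (negative ab<0) = inj₁ (zero , sides-of id
          (pos-resp (trans (sym (opposite-at (side a b) x)) (opposite-side a b x)) ab<0))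
        decide (null ab≈0) = let i , l , r = base-index e (stack P)
                                 ba≈0 = side-null ab≈0
          in contradiction
            (segment-sym (≡.subst₂ (λ u v → Segment (p u) (p v) x) l r
              (on-side (sides-of <⇒≤ (≈⇒nonNeg ba≈0)) i
                (≡.subst₂ (λ u v → side (p u) (p v) at x ≈ 0#) (≡.sym l) (≡.sym r) ba≈0))))
            (off (inj₁ (≡.refl , ≡.refl)))
      by : (∃ λ j → InCell (cell P j) x) ⊎ (∀ {i} → i ℕ.< m ℕ.+ d → Left P i x) →
        (∃ λ j → InCell (cell (node P) j) x) ⊎ (∀ {i} → i ℕ.< suc m → Left (node P) i x)
      by (inj₁ (j , found)) = inj₁ (suc j , found)
      by (inj₂ toLeft)        = decide toLeft (sign (side a b at x))

    nested⇒oneSide : ∀ {a b a′ b′ : Fin n} → a < b → a′ < b′ → Nested (toℕ a) (toℕ b) (toℕ a′) (toℕ b′) → OneSide a b a′ b′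
    nested⇒oneSide a<b a′<b′ (inj₁ b≤a′) = inj₁ (inj₂ b≤a′ , inj₂ (ℕₚ.≤-trans b≤a′ (ℕₚ.<⇒≤ a′<b′)))
    nested⇒oneSide a<b a′<b′ (inj₂ (inj₁ b′≤a)) = inj₁ (inj₁ (ℕₚ.≤-trans (ℕₚ.<⇒≤ a′<b′) b′≤a) , inj₁ b′≤a)
    nested⇒oneSide a<b a′<b′ (inj₂ (inj₂ (inj₁ (a≤a′ , b′≤b)))) =
      inj₂ ((a≤a′ , ℕₚ.≤-trans (ℕₚ.<⇒≤ a′<b′) b′≤b) , (ℕₚ.≤-trans a≤a′ (ℕₚ.<⇒≤ a′<b′) , b′≤b))
    nested⇒oneSide a<b a′<b′ (inj₂ (inj₂ (inj₂ (a′≤a , b≤b′)))) = inj₁ (inj₁ a′≤a , inj₂ b≤b′)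

    module _ {q} (P : Path 1 q) (top≡N : top P ≡ N) where

      private
        G : Graph n
        G = pathGraph P

        cycle : ∀ i → Edge G i (next i)
        cycle = path-cycle P top≡N

        data Oriented (u v : Fin n) : Set where
          up   : u < v → Chord P (toℕ u) (toℕ v) → Oriented u v
          down : v < u → Chord P (toℕ v) (toℕ u) → Oriented u v

        oriented : ∀ {u v} → Edge G u v → Oriented u v
        oriented edge with edge⇒adjacent P edge
        ... | inj₁ c = up (chord-< P c) c
        ... | inj₂ c = down (chord-< P c) c

      path-plane : IsPlane p G
      path-plane {u} {v} {u′} {v′} edge edge′ different x seg seg′ = by (oriented edge) (oriented edge′)
        where
        apart : ¬ ((u′ ≡ u ⊎ u′ ≡ v) × (v′ ≡ u ⊎ v′ ≡ v))
        apart (inj₁ ≡.refl , inj₁ ≡.refl) = edge-≢ G edge′ ≡.refl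
        apart (inj₁ ≡.refl , inj₂ ≡.refl) = different (inj₁ (≡.refl , ≡.refl))
        apart (inj₂ ≡.refl , inj₁ ≡.refl) = different (inj₂ (≡.refl , ≡.refl))
        apart (inj₂ ≡.refl , inj₂ ≡.refl) = edge-≢ G edge′ ≡.refl
        flip : ∀ {a b a′ b′} → SharedEnd a b a′ b′ x → SharedEnd a b b′ a′ x
        flip (w , on , on′ , eq) = w , on , swap on′ , eq
        flipˡ : ∀ {a b a′ b′} → SharedEnd a b a′ b′ x → SharedEnd b a a′ b′ x
        flipˡ (w , on , on′ , eq) = w , swap on , on′ , eq
        by : Oriented u v → Oriented u′ v′ → SharedEnd u v u′ v′ x
        by (up u<v c) (up u′<v′ c′) =
          oneSide-touching u<v (nested⇒oneSide u<v u′<v′ (chords-nested P c c′)) apart seg seg′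
        by (up u<v c) (down v′<u′ c′) =
          flip (oneSide-touching u<v (nested⇒oneSide u<v v′<u′ (chords-nested P c c′))
            (λ (x , y) → apart (y , x)) seg (segment-sym seg′))
        by (down v<u c) (up u′<v′ c′) =
          flipˡ (oneSide-touching v<u (nested⇒oneSide v<u u′<v′ (chords-nested P c c′))
            (λ (x , y) → apart (swap x , swap y)) (segment-sym seg) seg′)
        by (down v<u c) (down v′<u′ c′) =
          flipˡ (flip (oneSide-touching v<u (nested⇒oneSide v<u v′<u′ (chords-nested P c c′))
            (λ (x , y) → apart (swap y , swap x)) (segment-sym seg) (segment-sym seg′)))

      private
        cell-≤N : ∀ j → cell P j 0 ℕ.≤ N
        cell-≤N j = ℕₚ.≤-trans (cell-≤top P j) (ℕₚ.≤-reflexive top≡N)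

        cell-sides : ∀ j i → Edge G (vertex e (cell P j) i) (vertex e (cell P j) (next i))
        cell-sides j = vertex-sides G {e} {cell P j}
          (λ i<d → chord⇒edge P (ℕₚ.≤-trans (decreasing-≤ (cell-decreasing P j) z≤n (ℕₚ.<⇒≤ i<d)) (cell-≤N j)) (cell-side P j i<d))
          (chord⇒edge P (cell-≤N j) (cell-base P j))

        cell-separated : ∀ j {u v} → Edge G u v → ∃ λ i →
          let a = p (vertex e (cell P j) i) ; b = p (vertex e (cell P j) (next i)) in
          NonNeg (side b a at p u) × NonNeg (side b a at p v)
        cell-separated j edge with oriented edge
        ... | up _ ch = let σ , Bu , Bv = chord-separated P ch j
                            i , out = side-beyond (cell-decreasing P j) (cell-≤N j) σ
                        in i , out _ Bu , out _ Bv
        ... | down _ ch = let σ , Bv , Bu = chord-separated P ch j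
                              i , out = side-beyond (cell-decreasing P j) (cell-≤N j) σ
                          in i , out _ Bu , out _ Bv

      module Face (j : Fin q) = Cell G (vertex-increasing (cell-decreasing P j) (cell-≤N j))
        (cell-sides j) (cell-separated j) cycle

      open Exterior G

      internal-located : ∀ {x} → IsInternal p G x → ∃ λ j → Face.Interior j x
      internal-located {x} (off , bounded) = inside (all-or-null (λ i → Hull.edge i at x) closed)
        where
        closed : Hull.Closed x
        closed i x<0 = exterior-unbounded i (pos-resp (sym (opposite-at (Hull.edge i) x)) (neg⇒pos x<0)) bounded
        found : Hull.Interior x → (∃ λ j → InCell (cell P j) x) ⊎ (∀ {i} → i ℕ.< 1 → Left P i x) → ∃ λ j → Face.Interior j x
        found hull (inj₁ located) = located
        -- The chord over the only tree is the hull edge from the first to the last point, so its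
        -- far side is outside the hull.
        found hull (inj₂ toLeft) = contradiction
          (nonNeg-resp (trans (sym (opposite-side (p (fromℕ N)) (p zero) x)) (opposite-at (side (p (fromℕ N)) (p zero)) x))
            (<⇒≤ (≡.subst₂ (λ u v → Pos (side (p u) (p v) at x)) bottom last (toLeft (s≤s z≤n)))))
          (¬pos∧neg (≡.subst (λ v → Pos (side (p (fromℕ N)) (p v) at x)) (next-fromℕ N) (hull (fromℕ N))))
          where
          bottom : ι (stack P 1) ≡ zero
          bottom = ≡.trans (≡.cong ι (stack-bottom P)) ι-first
          last : ι (stack P 0) ≡ fromℕ N
          last = ≡.trans (≡.cong ι top≡N) ι-last
        inside : (∀ i → Pos (Hull.edge i at x)) ⊎ (∃ λ i → Hull.edge i at x ≈ 0#) → ∃ λ j → Face.Interior j x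
        inside (inj₂ (i , x≈0)) = contradiction (inj₂ (i , next i , cycle i , Hull.on-side closed i x≈0)) off
        inside (inj₁ hull) = found hull (locate-cell P (ℕₚ.≤-reflexive top≡N) hull
          λ ch seg → off (inj₂ (_ , _ , chord⇒edge P (ℕₚ.≤-trans (chord-≤top P ch) (ℕₚ.≤-reflexive top≡N)) ch , seg)))

      path-angulation : IsAngulation p G (suc d)
      path-angulation = cycle⇒2-connected (s≤s (s≤s z≤n)) G cycle , path-plane ,
        λ x internal → let j , int = internal-located internal in Face.interior-isGon j int

      private
        -- Through x the centre of cell j would be in the face, hence in the interior, of cell i;
        -- but all vertices of cell j, and so its centre, are behind one side of cell i.
        not-apart : ∀ {i j x} → Apart (cell P i) (cell P j) → Face.Interior i x → ¬ Face.Interior j x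
        not-apart {i} {j} (σ , out) int int′ =
          let h , beyond = side-beyond (cell-decreasing P i) (cell-≤N i) σ
              centre-in = Face.face⇒interior i int (Face.interior⇒face j int′ (Face.centre-interior j))
          in Face.beyond i h (Face.centre-nonNeg j _ λ l → beyond (vertex e (cell P j) l)
               (≡.subst (Beyond (cell P i) σ) (≡.sym (toℕ-ι (ℕₚ.≤-trans
                 (decreasing-≤ (cell-decreasing P j) z≤n (ℕₚ.m∸n≤m d (toℕ l))) (cell-≤N j))))
                 (out (ℕₚ.m∸n≤m d (toℕ l))))) (centre-in h)

      face-unique : ∀ {i j x} → Face.Interior i x → Face.Interior j x → i ≡ j
      face-unique {i} {j} int int′ with i Finₚ.≟ j
      ... | yes i≡j = i≡j
      ... | no  i≢j with cells-apart P i j i≢j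
      ...   | inj₁ apart = contradiction int′ (not-apart apart int)
      ...   | inj₂ apart = contradiction int (not-apart apart int′)

      path-faces : HasCardinality (internalFaces p G) q
      path-faces = record
        { to        = λ (_ , internal) → proj₁ (internal-located internal)
        ; from      = λ j → Face.centre j , Face.interior-internal j (Face.centre-interior j)
        ; to-cong   = λ {x} {y} → same {x} {y}
        ; from-cong = λ { ≡.refl → Star.ε }
        ; inverse   = (λ {j} {x} x~ → ≡.sym (face-unique
                          (Face.face⇒interior j (Face.centre-interior j) (Eq.symmetric _ x~))
                          (proj₂ (internal-located (proj₂ x)))))
                    , (λ { {x} ≡.refl → Face.interior⇒face _ (Face.centre-interior _) (proj₂ (internal-located (proj₂ x))) })
        }
        where
        same : ∀ {x y : Σ Point (IsInternal p G)} → Face p G (proj₁ x) (proj₁ y) →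
          proj₁ (internal-located (proj₂ x)) ≡ proj₁ (internal-located (proj₂ y))
        same {x} {y} x~y = face-unique
          (Face.face⇒interior _ (proj₂ (internal-located (proj₂ x))) x~y) (proj₂ (internal-located (proj₂ y)))

open PlaneGraphs

-- The bijection between angulations and trees

open import Data.Nat.Base using (_+_; _*_; _∸_; _≤_)

⊖1-injective : ∀ {m n} → m ⊖ 1 ≡ n ⊖ 1 → m ≡ n
⊖1-injective {m} {n} eq = ℤₚ.+-injective (∙-cancelʳ (ℤ.- (+ 1)) (+ m) (+ n)
  (≡.trans (ℤₚ.m-n≡m⊖n m 1) (≡.trans eq (≡.sym (ℤₚ.m-n≡m⊖n n 1)))))

rootDegree-cong : ∀ {m} (G H : Graph (suc m)) → (∀ u → neighbours G u ≡ neighbours H u) → rootDegree G ≡ rootDegree H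
rootDegree-cong {m} G H eq = ≡.cong (λ S → ∣ S ∣ ⊖ 2) (eq (root m))

module Bijection {c ℓ₁ ℓ₂} (F : OrderedField c ℓ₁ ℓ₂) (e r s : ℕ) (p : Fin (3 + s) → Plane.Point F)
  (ccw : Plane.CounterClockwise F p) (size : 2 + s ≡ 1 + suc e * r) where

  open Plane F
  open Positions F p ccw
  open Labels (2 + s)
  open PlacedLabels F p ccw
  open Paths e
  open PathInjectivity e
  open Counting e
  open PathGraph e (2 + s)
  open PathFaces F p ccw e

  module _ (G : Graph n) (angulation : IsAngulation p G (3 + e)) where

    private
      noncrossing : NonCrossing G
      noncrossing = plane⇒noncrossing {G} (proj₁ (proj₂ angulation))

      cycle : ∀ i → Edge G i (next i)
      cycle = 2-connected⇒cycle (s≤s (s≤s z≤n)) G (proj₁ angulation) noncrossing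

      -- The bound is part of the relation because `ι` wraps around above N.
      E : ℕ → ℕ → Set
      E u v = u ℕ.< v × v ≤ N × Edge G (ι u) (ι v)

      E? : ∀ u v → Dec (E u v)
      E? u v = u ℕₚ.<? v ×-dec (v ℕₚ.≤? N ×-dec edge? G (ι u) (ι v))

      edge⇒E : ∀ {u v} → toℕ u ℕ.< toℕ v → Edge G u v → E (toℕ u) (toℕ v)
      edge⇒E {u} {v} u<v edge = u<v , Finₚ.toℕ≤pred[n] v , ≡.subst₂ (Edge G) (≡.sym (ι-toℕ u)) (≡.sym (ι-toℕ v)) edge

      E⇒edge : ∀ {u v} → E (toℕ u) (toℕ v) → Edge G u v
      E⇒edge {u} {v} (_ , _ , edge) = ≡.subst₂ (Edge G) (ι-toℕ u) (ι-toℕ v) edge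

      cell-size : ∀ {c t} → 2 ≤ t → IsCell E c t → t ≡ d
      -- A cell from `c 0` down to its last index t + 2 has t + 3 vertices, and k = d + 1; so one
      -- successor is cancelled.
      cell-size {c} {suc (suc t)} (s≤s (s≤s _)) cell = ℕₚ.suc-injective
        (Cell.gon-size G (vertex-increasing decreasing c₀≤N)
          (vertex-sides G {t} {c} (λ i<s → proj₂ (proj₂ (sides i<s))) (proj₂ (proj₂ closing))) separated cycle angulation)
        where
        open IsCell cell
        c₀≤N : c 0 ≤ N
        c₀≤N = proj₁ (proj₂ closing)
        separated : ∀ {u v} → Edge G u v → ∃ λ i → _
        separated {u} {v} edge with ℕₚ.<-cmp (toℕ u) (toℕ v)
        ... | tri< u<v _ _ = let σ , Bu , Bv = separates (edge⇒E u<v edge)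
                                 i , out = side-beyond decreasing c₀≤N σ
                             in i , out u Bu , out v Bv
        ... | tri≈ _ u≡v _ = contradiction (Finₚ.toℕ-injective u≡v) (edge-≢ G edge)
        ... | tri> _ _ v<u = let σ , Bv , Bu = separates (edge⇒E v<u (symmetric G edge))
                                 i , out = side-beyond decreasing c₀≤N σ
                             in i , out u Bu , out v Bv

      open Parse e N E E? proj₁ (proj₁ ∘ proj₂)
        (λ t<u u<v v<w (_ , v≤N , tv) (_ , w≤N , uw) →
          noncrossing (ι-< t<u (ℕₚ.≤-trans (ℕₚ.<⇒≤ u<v) v≤N)) (ι-< u<v v≤N) (ι-< v<w w≤N) tv uw)
        (λ {u} u<N → ℕₚ.≤-refl , u<N , ≡.subst (Edge G (ι u)) (next-ι u<N) (cycle (ι u)))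
        (s≤s z≤n)
        (s≤s z≤n , ℕₚ.≤-refl , ≡.subst₂ (Edge G) (≡.sym ι-first) (≡.sym ι-last)
          (symmetric G (≡.subst (Edge G (fromℕ N)) (next-fromℕ N) (cycle (fromℕ N)))))
        cell-size

    fromAngulation : Σ (Path 1 r) λ P → ∀ u → neighbours (pathGraph P) u ≡ neighbours G u
    fromAngulation = let q , P , top≡N , sound , complete = parse in
      -- The number of nodes comes from the number of vertices: the top is 1 + q (k - 2) by
      -- `top-size` and 1 + (k - 2) r by `size`.
      build P (ℕₚ.*-cancelˡ-≡ q r (suc e) (ℕₚ.suc-injective
        (≡.trans (≡.cong suc (ℕₚ.*-comm (suc e) q)) (≡.trans (≡.sym (top-size P)) (≡.trans top≡N size))))) sound complete
      where
      build : ∀ {q} (P : Path 1 q) → q ≡ r → (∀ {u v} → Chord P u v → E u v) → (∀ {u v} → E u v → Chord P u v) →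
        Σ (Path 1 r) λ P → ∀ u → neighbours (pathGraph P) u ≡ neighbours G u
      build P ≡.refl sound complete = P , λ u → subset-≡ (neighbours (pathGraph P) u) (neighbours G u)
        (λ {v} v∈ → to (edge⇒adjacent P v∈)) (λ {v} v∈ → adjacent⇒edge P (from v∈ (ℕₚ.<-cmp (toℕ u) (toℕ v))))
        where
        to : ∀ {u v} → Adjacent P u v → Edge G u v
        to (inj₁ ch) = E⇒edge (sound ch)
        to (inj₂ ch) = symmetric G (E⇒edge (sound ch))
        from : ∀ {u v} → Edge G u v → Tri (toℕ u ℕ.< toℕ v) (toℕ u ≡ toℕ v) (toℕ v ℕ.< toℕ u) → Adjacent P u v
        from edge (tri< u<v _ _) = inj₁ (complete (edge⇒E u<v edge))
        from edge (tri≈ _ u≡v _) = contradiction (Finₚ.toℕ-injective u≡v) (edge-≢ G edge)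
        from edge (tri> _ _ v<u) = inj₂ (complete (edge⇒E v<u (symmetric G edge)))

  path-top : (P : Path 1 r) → top P ≡ N
  path-top P = ≡.trans (top-size P) (≡.trans (≡.cong suc (ℕₚ.*-comm r (suc e))) (≡.sym size))

  path-rootDegree : (P : Path 1 r) → rootDegree (pathGraph P) ≡ spine P ⊖ 1
  path-rootDegree P = ≡.trans (≡.cong (_⊖ 2) (root-degree P (s≤s z≤n) (path-top P))) (ℤₚ.[1+m]⊖[1+n]≡m⊖n (spine P) 1)

  module _ {j v : ℕ} (spined↔v : Spined j 1 r ↔ Fin v) where

    private
      module Count = Inverse spined↔v

      Angulation : Set _
      Angulation = Σ (Graph n) λ G →
        IsAngulation p G (3 + e) × HasCardinality (internalFaces p G) r × rootDegree G ≡ j ⊖ 1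

      toSpined : Angulation → Spined j 1 r
      toSpined (G , angulation , _ , degree) = let P , eq = fromAngulation G angulation in
        P , ⊖1-injective {spine P} {j} (≡.trans (≡.sym (path-rootDegree P)) (≡.trans (rootDegree-cong (pathGraph P) G eq) degree))

      toSpined-neighbours : ∀ A u → neighbours (pathGraph (proj₁ (toSpined A))) u ≡ neighbours (proj₁ A) u
      toSpined-neighbours (G , angulation , _) = proj₂ (fromAngulation G angulation)

      fromSpined : Spined j 1 r → Angulation
      fromSpined (P , eq) = pathGraph P , path-angulation P (path-top P) , path-faces P (path-top P) ,
        ≡.trans (path-rootDegree P) (≡.cong (_⊖ 1) eq)

      spined-≡ : (A B : Spined j 1 r) → (∀ u → neighbours (pathGraph (proj₁ A)) u ≡ neighbours (pathGraph (proj₁ B)) u) → A ≡ B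
      spined-≡ (P , eq) (Q , eq′) same with sameChords⇒≡ P Q (path-top P) same
      ... | ≡.refl = ≡.cong (P ,_) (ℕₚ.≡-irrelevant eq eq′)

    angulations-cardinality : HasCardinality (angulations p (3 + e) r (j ⊖ 1)) v
    angulations-cardinality = record
      { to        = Count.to ∘ toSpined
      ; from      = fromSpined ∘ Count.from
      ; to-cong   = λ {A} {B} A≈B → ≡.cong Count.to (spined-≡ (toSpined A) (toSpined B) λ u →
          ≡.trans (toSpined-neighbours A u) (≡.trans (A≈B u) (≡.sym (toSpined-neighbours B u))))
      ; from-cong = λ { ≡.refl u → ≡.refl }
      ; inverse   = (λ {i} {A} A≈ → ≡.trans (≡.cong Count.to (spined-≡ (toSpined A) (Count.from i) λ u →
                        ≡.trans (toSpined-neighbours A u) (A≈ u))) (Count.strictlyInverseˡ i))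
                  , (λ { {A} ≡.refl u → ≡.trans
                        (≡.cong (λ B → neighbours (pathGraph (proj₁ B)) u) (Count.strictlyInverseʳ (toSpined A)))
                        (toSpined-neighbours A u) })
      }

theorem6 : ∀ {c ℓ₁ ℓ₂} (F : OrderedField c ℓ₁ ℓ₂) → let open Plane F in
    (k r : ℕ) .{{_ : NonZero r}} → 3 ≤ k →
    (p : Fin (2 + (k ∸ 2) * r) → Point) → ConvexPosition p → CounterClockwise p →
    (j : ℕ) → 1 ≤ j → j ≤ r →
    ∃ λ v → HasCardinality (angulations p k r (j ⊖ 1)) v ×
    (+ v / 1 ≡ (+ j / r) *ℚ (+ (((k ∸ 1) * r ∸ j ∸ 1) C (r ∸ j)) / 1))
theorem6 F k zero 3≤k p _ ccw j 1≤j j≤0 = contradiction (ℕₚ.≤-trans 1≤j j≤0) λ ()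
theorem6 F (suc (suc (suc e))) r@(suc r′) (s≤s (s≤s (s≤s _))) p _ ccw j 1≤j j≤r =
  count (j * suc e) (r ∸ j) ,
  -- With k = 3 + e and r = 1 + r′, the number 2 + (k - 2) r of points computes to 3 + (r′ + e r),
  -- so `size` holds by `refl`.
  Bijection.angulations-cardinality F e r (r′ + e * r) p ccw ≡.refl (spined↔fin j≤r) ,
  fraction (count (j * suc e) (r ∸ j)) j r _
    -- `ballot` has r in the form (r - j) + j.
    (≡.subst (λ m → m * count (j * suc e) (r ∸ j) ≡ j * ((suc (suc e) * m ∸ j ∸ 1) C (r ∸ j)))
      (ℕₚ.m∸n+n≡m j≤r) (ballot j (r ∸ j)))
  where open Counting e
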